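{- The edge generating series of the Motzkin lattices is $$\sum_{n\ge0}\ell(\mathcal{M}_n)x^n=\frac{(1+x)\big(1-2x-x^2-(1-x)\sqrt{1-2x-3x^2}\big)}{2x^2\sqrt{1-2x-3x^2}}.$$ Moreover: (i) for $n\ge1$, $\ell(\mathcal{M}_n)=T_n-M_n+T_{n-1}-M_{n-1}$; (ii) for $n\ge3$, $\ell(\mathcal{M}_n)=[x^{n-2}](1+x+x^2)^n+[x^{n-3}](1+x+x^2)^{n-1}$; (iii) for $n\ge1$, $\ell(\mathcal{M}_n)=\frac2n\sum_{k=0}^{\lfloor n/2\rfloor}\binom nk\binom{n-k}{k}\frac{k(n-k)}{k+1}$. Finally, $\ell(\mathcal{M}_n)\sim \frac{2\cdot3^n}{\sqrt{3n\pi}}$ and $i(\mathcal{M}_n)=\ell(\mathcal{M}_n)/|\mathcal{M}_n|\sim\frac49 n$.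
   Context: Steps: $U=(1,1)$, $D=(1,-1)$, $H=(1,0)$. $\mathcal{M}_n$ is the set of Motzkin paths of length $n$ (lattice paths from $(0,0)$ to $(n,0)$ with steps $U,D,H$ never going below the $x$-axis), partially ordered by $\gamma_1\le\gamma_2$ iff $\gamma_1$ lies weakly below $\gamma_2$. $\ell(P)$ is the number of edges (covering pairs) of the Hasse diagram of a finite poset $P$, and $i(P)=\ell(P)/|P|$. $T_n=[x^n](1+x+x^2)^n$ is the central trinomial coefficient (generating series $1/\sqrt{1-2x-3x^2}$), and $M_n=|\mathcal{M}_n|$ is the $n$-th Motzkin number (generating series $(1-x-\sqrt{1-2x-3x^2})/(2x^2)$). $a_n\sim b_n$ means $a_n/b_n\to1$. -}

module Defs where

open import Level using (0ℓ)
open import Data.Bool.Base using (Bool; true; false; if_then_else_) renaming (T to IsTrue)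
open import Data.Empty using (⊥)
open import Data.Fin.Base using (Fin; zero; suc; toℕ; inject₁; fromℕ)
import Data.Fin.Properties as Fin
open import Data.Integer.Base using (+_)
import Data.Integer.Base as ℤ
import Data.Integer.Properties as ℤ
open import Data.List.Base using (List; []; _∷_; _++_; map; length; filter; cartesianProduct)
open import Data.List.Membership.Propositional using (_∈_; find; lose)
open import Data.List.Membership.Propositional.Properties using (∈-map⁺; ∈-map⁻; ∈-++⁺ˡ; ∈-++⁺ʳ; ∈-++⁻)
open import Data.List.Relation.Binary.Disjoint.Propositional using (Disjoint)
open import Data.List.Relation.Unary.AllPairs using ([]; _∷_)
import Data.List.Relation.Unary.All as All
open import Data.List.Relation.Unary.Any using (here; any?)
open import Data.List.Relation.Unary.Unique.Propositional using (Unique)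
import Data.List.Relation.Unary.Unique.Propositional.Properties as Unique
open import Data.Nat.Base using (ℕ; zero; suc; z≤n; s≤s)
import Data.Nat.Base as ℕ
import Data.Nat.Properties as ℕ
import Data.Nat.DivMod as ℕ
open import Data.Product.Base using (∃; ∃₂; Σ; _×_; _,_; proj₁; proj₂; uncurry)
open import Data.Rational.Base using (ℚ; 0ℚ; 1ℚ; ½; _+_; _-_; _*_; _/_; 1/_; _<_; _≤_; _⊔_; _⊓_; Positive)
import Data.Rational.Base as ℚ
import Data.Rational.Properties as ℚ
import Data.Rational.Unnormalised.Base as ℚᵘ
import Data.Rational.Unnormalised.Properties as ℚᵘ
open import Data.Rational.Solver using (module +-*-Solver)
open import Data.Nat.Solver using () renaming (module +-*-Solver to ℕ-Solver)
open import Data.Rational.Literals using (fromℤ)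
import Data.Sum.Base as Sum
open import Data.Sum.Base using (_⊎_; inj₁; inj₂)
open import Data.Vec.Functional using (Vector)
open import Function.Base using (_∘_)
open import Relation.Binary.Core using (Rel)
open import Relation.Binary.Definitions using (Decidable; tri<; tri≈; tri>)
open import Relation.Binary.PropositionalEquality
open import Relation.Binary.Structures using (IsDecPartialOrder)
import Relation.Binary.Construct.NonStrictToStrict as Strict
open import Relation.Nullary using (¬_; yes; no; contradiction)
open import Relation.Nullary.Decidable using (map′; _×-dec_; ¬?)
open import Relation.Unary using (Pred)

open import Algebra.Properties.CommutativeMonoid.Sum ℚ.+-0-commutativeMonoid public using (sum; sum-syntax; sum⁺-syntax; sum-cong-≗; sum-init-last)

record FinitePoset : Set₁ where
  field
    Carrier           : Set
    _⊑_               : Rel Carrier 0ℓ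
    isDecPartialOrder : IsDecPartialOrder _≡_ _⊑_
    elements          : List Carrier
    complete          : ∀ x → x ∈ elements
    unique            : Unique elements

  open IsDecPartialOrder isDecPartialOrder public using (_≟_) renaming (_≤?_ to _⊑?_)
  open Strict _≡_ _⊑_ public using () renaming (_<_ to _⊏_)

  infix 4 _⋖_ _⊏?_ _⋖?_

  _⋖_ : Rel Carrier 0ℓ
  x ⋖ y = x ⊏ y × ¬ ∃ λ z → x ⊏ z × z ⊏ y

  _⊏?_ : Decidable _⊏_
  _⊏?_ = Strict.<-decidable _≡_ _⊑_ _≟_ _⊑?_

  _⋖?_ : Decidable _⋖_
  x ⋖? y = (x ⊏? y) ×-dec ¬? (map′ (λ w → proj₁ (find w) , proj₂ (proj₂ (find w)))
                                   (λ (z , b) → lose (complete z) b)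
                                   (any? (λ z → (x ⊏? z) ×-dec (z ⊏? y)) elements))

open FinitePoset using (elements)

∣_∣ : FinitePoset → ℕ
∣ P ∣ = length (elements P)

ℓ : FinitePoset → ℕ
ℓ P = length (filter (uncurry (FinitePoset._⋖?_ P)) (cartesianProduct (elements P) (elements P)))

i : (P : FinitePoset) → .{{_ : ℕ.NonZero ∣ P ∣}} → ℚ
i P = + ℓ P / ∣ P ∣

-- Path h n: lattice paths from (0 , h) to (n , 0) with steps U = (1 , 1),
-- H = (1 , 0), D = (1 , -1) that never go below the x-axis.
data Path : ℕ → ℕ → Set where
  []  : Path 0 0
  U∷_ : ∀ {h n} → Path (suc h) n → Path h (suc n)
  H∷_ : ∀ {h n} → Path h n → Path h (suc n)
  D∷_ : ∀ {h n} → Path h n → Path (suc h) (suc n)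

MotzkinPath : ℕ → Set
MotzkinPath n = Path 0 n

-- the ordinate of the path at abscissa k
height : ∀ {h n} → Path h n → Fin (suc n) → ℕ
height {h} _      zero    = h
height     (U∷ p) (suc k) = height p k
height     (H∷ p) (suc k) = height p k
height     (D∷ p) (suc k) = height p k

infix 4 _⊑ᴹ_

-- Paths are linear between consecutive integer abscissae, so lying weakly
-- below is tested at the integer ones.
_⊑ᴹ_ : ∀ {h n} → Rel (Path h n) 0ℓ
p ⊑ᴹ q = ∀ k → height p k ℕ.≤ height q k

height-injective : ∀ {h n} (p q : Path h n) → (∀ k → height p k ≡ height q k) → p ≡ q
height-injective []     []     e = refl
height-injective (U∷ p) (U∷ q) e = cong U∷_ (height-injective p q (e ∘ suc))
height-injective (U∷ p) (H∷ q) e = contradiction (e (suc zero)) ℕ.1+n≢n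
height-injective (U∷ p) (D∷ q) e = contradiction (sym (e (suc zero))) (ℕ.m≢1+n+m _ {1})
height-injective (H∷ p) (U∷ q) e = contradiction (sym (e (suc zero))) ℕ.1+n≢n
height-injective (H∷ p) (H∷ q) e = cong H∷_ (height-injective p q (e ∘ suc))
height-injective (H∷ p) (D∷ q) e = contradiction (e (suc zero)) ℕ.1+n≢n
height-injective (D∷ p) (U∷ q) e = contradiction (e (suc zero)) (ℕ.m≢1+n+m _ {1})
height-injective (D∷ p) (H∷ q) e = contradiction (sym (e (suc zero))) ℕ.1+n≢n
height-injective (D∷ p) (D∷ q) e = cong D∷_ (height-injective p q (e ∘ suc))

⊑ᴹ-antisym : ∀ {h n} {p q : Path h n} → p ⊑ᴹ q → q ⊑ᴹ p → p ≡ q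
⊑ᴹ-antisym p⊑q q⊑p = height-injective _ _ (λ k → ℕ.≤-antisym (p⊑q k) (q⊑p k))

_⊑ᴹ?_ : ∀ {h n} → Decidable (_⊑ᴹ_ {h} {n})
p ⊑ᴹ? q = Fin.all? (λ k → height p k ℕ.≤? height q k)

⊑ᴹ-isDecPartialOrder : ∀ {h n} → IsDecPartialOrder _≡_ (_⊑ᴹ_ {h} {n})
⊑ᴹ-isDecPartialOrder = record
  { isPartialOrder = record
    { isPreorder = record
      { isEquivalence = isEquivalence
      ; reflexive     = λ { refl k → ℕ.≤-refl }
      ; trans         = λ p⊑q q⊑r k → ℕ.≤-trans (p⊑q k) (q⊑r k)
      }
    ; antisym = ⊑ᴹ-antisym
    }
  ; _≟_  = λ p q → map′ (uncurry ⊑ᴹ-antisym) (λ { refl → (λ _ → ℕ.≤-refl) , (λ _ → ℕ.≤-refl) })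
                        ((p ⊑ᴹ? q) ×-dec (q ⊑ᴹ? p))
  ; _≤?_ = _⊑ᴹ?_
  }

paths : ∀ h n → List (Path h n)
downs : ∀ h n → List (Path h (suc n))

paths h       (suc n) = map U∷_ (paths (suc h) n) ++ map H∷_ (paths h n) ++ downs h n
paths zero    zero    = [] ∷ []
paths (suc h) zero    = []

downs zero    n = []
downs (suc h) n = map D∷_ (paths h n)

∈-paths : ∀ {h n} (p : Path h n) → p ∈ paths h n
∈-paths []               = here refl
∈-paths {h} {suc n} (U∷ p) = ∈-++⁺ˡ (∈-map⁺ U∷_ (∈-paths p))
∈-paths {h} {suc n} (H∷ p) = ∈-++⁺ʳ (map U∷_ (paths (suc h) n)) (∈-++⁺ˡ (∈-map⁺ H∷_ (∈-paths p)))
∈-paths {suc h} {suc n} (D∷ p) =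
  ∈-++⁺ʳ (map U∷_ (paths (suc (suc h)) n)) (∈-++⁺ʳ (map H∷_ (paths (suc h) n)) (∈-map⁺ D∷_ (∈-paths p)))

H∉downs : ∀ h {n} {p : Path h n} → ¬ (H∷ p) ∈ downs h n
H∉downs (suc h) H∈ with ∈-map⁻ D∷_ H∈
... | ()

U∉downs : ∀ h {n} {p : Path (suc h) n} → ¬ (U∷ p) ∈ downs h n
U∉downs (suc h) U∈ with ∈-map⁻ D∷_ U∈
... | ()

paths-unique : ∀ h n → Unique (paths h n)
downs-unique : ∀ h n → Unique (downs h n)

paths-unique zero    zero    = All.[] ∷ []
paths-unique (suc h) zero    = []
paths-unique h       (suc n) =
  Unique.++⁺ (Unique.map⁺ (λ { refl → refl }) (paths-unique (suc h) n))
    (Unique.++⁺ (Unique.map⁺ (λ { refl → refl }) (paths-unique h n)) (downs-unique h n) H-disjoint)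
    U-disjoint
  where
  H-disjoint : Disjoint (map H∷_ (paths h n)) (downs h n)
  H-disjoint (H∈ , D∈) with ∈-map⁻ H∷_ H∈
  ... | _ , _ , refl = H∉downs h D∈

  U-disjoint : Disjoint (map U∷_ (paths (suc h) n)) (map H∷_ (paths h n) ++ downs h n)
  U-disjoint (U∈ , HD∈) with ∈-map⁻ U∷_ U∈ | ∈-++⁻ (map H∷_ (paths h n)) HD∈
  ... | _ , _ , refl | inj₂ D∈ = U∉downs h D∈
  ... | _ , _ , refl | inj₁ H∈ with ∈-map⁻ H∷_ H∈
  ...   | ()

downs-unique zero    n = []
downs-unique (suc h) n = Unique.map⁺ (λ { refl → refl }) (paths-unique h n)

𝓜 : ℕ → FinitePoset
𝓜 n = record
  { Carrier           = MotzkinPath n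
  ; _⊑_               = _⊑ᴹ_
  ; isDecPartialOrder = ⊑ᴹ-isDecPartialOrder
  ; elements          = paths 0 n
  ; complete          = ∈-paths
  ; unique            = paths-unique 0 n
  }

flat : ∀ n → MotzkinPath n
flat zero    = []
flat (suc n) = H∷ flat n

∣𝓜∣-nonZero : ∀ n → ℕ.NonZero ∣ 𝓜 n ∣
∣𝓜∣-nonZero n with paths 0 n | ∈-paths (flat n)
... | _ ∷ _ | _ = _

ι : ℕ → ℚ
ι n = fromℤ (+ n)

FPS : Set
FPS = ℕ → ℚ

infixl 6 _+ˢ_ _-ˢ_
infixl 7 _*ˢ_
infixr 8 _·ˢ_
infixr 9 _^ˢ_
infix 10 √ˢ_

1ˢ X : FPS
1ˢ zero    = 1ℚ
1ˢ (suc n) = 0ℚ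
X  zero    = 0ℚ
X  (suc n) = 1ˢ n

_+ˢ_ _-ˢ_ _*ˢ_ : FPS → FPS → FPS
(f +ˢ g) n = f n + g n
(f -ˢ g) n = f n - g n
(f *ˢ g) n = ∑[ k ≤ n ] (f (toℕ k) * g (n ℕ.∸ toℕ k))

_·ˢ_ : ℚ → FPS → FPS
(c ·ˢ f) n = c * f n

_^ˢ_ : FPS → ℕ → FPS
f ^ˢ zero  = 1ˢ
f ^ˢ suc n = f *ˢ f ^ˢ n

-- For f with constant term 1, √ˢ f is the series s with s 0 = 1 and s² = f
-- (see √ˢ-square), obtained by solving
--   f (n+1) = 2 s (n+1) + ∑ { s i · s j | i + j = n + 1, i and j positive }
-- for s (n+1). Only the coefficients of index at most n of √ˢ-upTo f n are
-- meaningful.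
√ˢ-upTo : FPS → ℕ → FPS
√ˢ-upTo f zero    k = 1ℚ
√ˢ-upTo f (suc n) k =
  if k ℕ.≤ᵇ n then s k
  else ½ * (f (suc n) - ∑[ j < n ] (s (suc (toℕ j)) * s (n ℕ.∸ toℕ j)))
  where s = √ˢ-upTo f n

√ˢ_ : FPS → FPS
(√ˢ f) n = √ˢ-upTo f n n

√ˢ-upTo-stable : ∀ f {k n} → k ℕ.≤ n → √ˢ-upTo f n k ≡ (√ˢ f) k
√ˢ-upTo-stable f {n = zero} z≤n = refl
√ˢ-upTo-stable f {k} {suc n} k≤1+n with ℕ.m≤n⇒m<n∨m≡n k≤1+n
... | inj₂ refl = refl
... | inj₁ (s≤s k≤n) with k ℕ.≤ᵇ n | ℕ.≤⇒≤ᵇ k≤n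
...   | true | _ = √ˢ-upTo-stable f k≤n

√ˢ-suc : ∀ f n → (√ˢ f) (suc n) ≡
  ½ * (f (suc n) - ∑[ j < n ] ((√ˢ f) (suc (toℕ j)) * (√ˢ f) (n ℕ.∸ toℕ j)))
√ˢ-suc f n with suc n ℕ.≤ᵇ n | ℕ.≤ᵇ⇒≤ (suc n) n
... | true  | 1+n≤n = contradiction (1+n≤n _) ℕ.1+n≰n
... | false | _     = cong (λ m → ½ * (f (suc n) - m)) (sum-cong-≗ {n} λ j →
  cong₂ _*_ (√ˢ-upTo-stable f (Fin.toℕ<n j)) (√ˢ-upTo-stable f (ℕ.m∸n≤m n (toℕ j))))

√ˢ-square : ∀ f → f 0 ≡ 1ℚ → √ˢ f *ˢ √ˢ f ≗ f
√ˢ-square f f0≡1 zero    = sym f0≡1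
√ˢ-square f f0≡1 (suc n) = begin
  1ℚ * x + sum mid                        ≡⟨ cong (λ y → 1ℚ * x + y) (sum-init-last mid) ⟩
  1ℚ * x + (sum (mid ∘ inject₁) + mid (fromℕ n))
    ≡⟨ cong (λ y → 1ℚ * x + y) (cong₂ _+_ (sum-cong-≗ {n} (λ j → cong g (Fin.toℕ-inject₁ j)))
                                  (trans (cong g (Fin.toℕ-fromℕ n)) (cong (x *_) (cong s (ℕ.n∸n≡0 n))))) ⟩
  1ℚ * x + (m + x * 1ℚ)                   ≡⟨ cong (λ y → 1ℚ * y + (m + y * 1ℚ)) (√ˢ-suc f n) ⟩
  1ℚ * (½ * (f (suc n) - m)) + (m + ½ * (f (suc n) - m) * 1ℚ)
    ≡⟨ solve 2 (λ a b → con 1ℚ :* (con ½ :* (a :- b)) :+ (b :+ con ½ :* (a :- b) :* con 1ℚ) := a)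
         refl (f (suc n)) m ⟩
  f (suc n)                               ∎
  where
  open ≡-Reasoning
  open +-*-Solver
  s = √ˢ f
  x = s (suc n)
  g : ℕ → ℚ
  g k = s (suc k) * s (n ℕ.∸ k)
  mid : Vector ℚ (suc n)
  mid k = g (toℕ k)
  m = ∑[ j < n ] g (toℕ j)

0<1 : 0ℚ < 1ℚ
0<1 = ℚ.positive⁻¹ 1ℚ

p<p+1 : ∀ p → p < p + 1ℚ
p<p+1 p = subst (_< p + 1ℚ) (ℚ.+-identityʳ p) (ℚ.+-monoʳ-< p 0<1)

p-1<p : ∀ p → p - 1ℚ < p
p-1<p p = subst (p - 1ℚ <_) (ℚ.+-identityʳ p) (ℚ.+-monoʳ-< p (ℚ.negative⁻¹ (ℚ.- 1ℚ)))

⊓-glb-< : ∀ {p q r} → r < p → r < q → r < p ⊓ q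
⊓-glb-< {p} {q} r<p r<q with ℚ.⊓-sel p q
... | inj₁ e = subst (_ <_) (sym e) r<p
... | inj₂ e = subst (_ <_) (sym e) r<q

⊔-lub-< : ∀ {p q r} → p < r → q < r → p ⊔ q < r
⊔-lub-< {p} {q} p<r q<r with ℚ.⊔-sel p q
... | inj₁ e = subst (_< _) (sym e) p<r
... | inj₂ e = subst (_< _) (sym e) q<r

*-mono-<-pos : ∀ {p q r} → 0ℚ < r → p < q → r * p < r * q
*-mono-<-pos {r = r} 0<r = ℚ.*-monoʳ-<-pos r {{ℚ.positive 0<r}}

square-mono-< : ∀ {p q} → 0ℚ ≤ p → p < q → p * p < q * q
square-mono-< {p} {q} 0≤p p<q = ℚ.≤-<-trans
  (ℚ.*-monoˡ-≤-nonNeg p {{ℚ.nonNegative 0≤p}} (ℚ.<⇒≤ p<q))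
  (ℚ.*-monoˡ-<-pos q {{ℚ.positive (ℚ.≤-<-trans 0≤p p<q)}} p<q)

recip : ∀ p → .(0ℚ < p) → ℚ
recip p 0<p = (1/ p) {{ℚ.pos⇒nonZero p {{ℚ.positive 0<p}}}}

*-recip : ∀ p .(0<p : 0ℚ < p) → p * recip p 0<p ≡ 1ℚ
*-recip p 0<p = ℚ.*-inverseʳ p {{ℚ.pos⇒nonZero p {{ℚ.positive 0<p}}}}

0<recip : ∀ {p} (0<p : 0ℚ < p) → 0ℚ < recip p 0<p
0<recip {p} 0<p = ℚ.positive⁻¹ _ {{ℚ.1/pos⇒pos p {{ℚ.positive 0<p}}}}

*-cancel-recip : ∀ p q .(0<p : 0ℚ < p) → p * (recip p 0<p * q) ≡ q
*-cancel-recip p q 0<p = begin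
  p * (recip p 0<p * q) ≡⟨ ℚ.*-assoc p _ q ⟨
  p * recip p 0<p * q   ≡⟨ cong (_* q) (*-recip p 0<p) ⟩
  1ℚ * q                ≡⟨ ℚ.*-identityˡ q ⟩
  q                     ∎
  where open ≡-Reasoning

recip-< : ∀ {p q} (0<p : 0ℚ < p) .(0<q : 0ℚ < q) → 1ℚ < p * q → recip p 0<p < q
recip-< {p} {q} 0<p 0<q 1<pq = ℚ.*-cancelˡ-<-nonNeg p {{ℚ.nonNegative (ℚ.<⇒≤ 0<p)}}
  (subst (_< p * q) (sym (*-recip p 0<p)) 1<pq)

<-recip : ∀ {p q} (0<p : 0ℚ < p) → p * q < 1ℚ → q < recip p 0<p
<-recip {p} {q} 0<p pq<1 = ℚ.*-cancelˡ-<-nonNeg p {{ℚ.nonNegative (ℚ.<⇒≤ 0<p)}}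
  (subst (p * q <_) (sym (*-recip p 0<p)) pq<1)

recip-anti : ∀ {p q} (0<p : 0ℚ < p) (0<q : 0ℚ < q) → p < q → recip q 0<q < recip p 0<p
recip-anti {p} {q} 0<p 0<q p<q = <-recip 0<p
  (subst (p * recip q 0<q <_) (*-recip q 0<q)
    (ℚ.*-monoˡ-<-pos (recip q 0<q) {{ℚ.positive (0<recip 0<q)}} p<q))

recip-swap-< : ∀ {p q} (0<p : 0ℚ < p) (0<q : 0ℚ < q) → recip p 0<p < q → recip q 0<q < p
recip-swap-< {p} {q} 0<p 0<q 1/p<q = recip-< 0<q 0<p
  (subst (1ℚ <_) (ℚ.*-comm p q) (subst (_< p * q) (*-recip p 0<p) (*-mono-<-pos 0<p 1/p<q)))

<-swap-recip : ∀ {p q} (0<p : 0ℚ < p) (0<q : 0ℚ < q) → q < recip p 0<p → p < recip q 0<q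
<-swap-recip {p} {q} 0<p 0<q q<1/p = <-recip 0<q
  (subst (_< 1ℚ) (ℚ.*-comm p q) (subst (p * q <_) (*-recip p 0<p) (*-mono-<-pos 0<p q<1/p)))

-- Two-sided located Dedekind cuts of ℚ.
record ℝ : Set₁ where
  no-eta-equality
  field
    -- L q means q < x, and U q means x < q
    L U         : Pred ℚ 0ℓ
    L-inhabited : ∃ L
    U-inhabited : ∃ U
    L-lower     : ∀ {p q} → p < q → L q → L p
    U-upper     : ∀ {p q} → p < q → U p → U q
    L-open      : ∀ {p} → L p → ∃ λ q → p < q × L q
    U-open      : ∀ {q} → U q → ∃ λ p → p < q × U p
    disjoint    : ∀ {q} → L q → U q → ⊥
    located     : ∀ {p q} → p < q → L p ⊎ U q

  L<U : ∀ {p q} → L p → U q → p < q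
  L<U {p} {q} Lp Uq with ℚ.<-cmp p q
  ... | tri< p<q _ _ = p<q
  ... | tri≈ _ refl _ = contradiction Uq (disjoint Lp)
  ... | tri> _ _ q<p = contradiction Uq (disjoint (L-lower q<p Lp))

  L-lower-≤ : ∀ {p q} → p ≤ q → L q → L p
  L-lower-≤ {p} {q} p≤q Lq with ℚ.<-cmp p q
  ... | tri< p<q _ _ = L-lower p<q Lq
  ... | tri≈ _ refl _ = Lq
  ... | tri> _ _ q<p = contradiction (ℚ.≤-<-trans p≤q q<p) (ℚ.<-irrefl refl)

  U-upper-≤ : ∀ {p q} → p ≤ q → U p → U q
  U-upper-≤ {p} {q} p≤q Up with ℚ.<-cmp p q
  ... | tri< p<q _ _ = U-upper p<q Up
  ... | tri≈ _ refl _ = Up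
  ... | tri> _ _ q<p = contradiction (ℚ.≤-<-trans p≤q q<p) (ℚ.<-irrefl refl)

open ℝ

record IsPositive (x : ℝ) : Set where
  constructor isPositive
  field 0<x : L x 0ℚ

open IsPositive

infixr 7 _·_
infix  8 √_ _⁻¹

fromℚ : ℚ → ℝ
fromℚ c .L q = q < c
fromℚ c .U q = c < q
fromℚ c .L-inhabited = c - 1ℚ , p-1<p c
fromℚ c .U-inhabited = c + 1ℚ , p<p+1 c
fromℚ c .L-lower = ℚ.<-trans
fromℚ c .U-upper p<q c<p = ℚ.<-trans c<p p<q
fromℚ c .L-open p<c = let m , p<m , m<c = ℚ.<-dense p<c in m , p<m , m<c
fromℚ c .U-open c<q = let m , c<m , m<q = ℚ.<-dense c<q in m , m<q , c<m
fromℚ c .disjoint = ℚ.<-asym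
fromℚ c .located {p} {q} p<q with p ℚ.<? c
... | yes p<c = inj₁ p<c
... | no  p≮c = inj₂ (ℚ.≤-<-trans (ℚ.≮⇒≥ p≮c) p<q)

-- c x for rational c of any sign: q < c x iff q < c p and q < c r for some
-- rationals p < x < r.
_·_ : ℚ → ℝ → ℝ
(c · x) .L q = ∃₂ λ p r → L x p × U x r × q < c * p × q < c * r
(c · x) .U q = ∃₂ λ p r → L x p × U x r × c * p < q × c * r < q
(c · x) .L-inhabited =
  let p , Lp = L-inhabited x ; r , Ur = U-inhabited x ; m = (c * p) ⊓ (c * r) in
  m - 1ℚ , p , r , Lp , Ur ,
  ℚ.<-≤-trans (p-1<p m) (ℚ.p⊓q≤p (c * p) (c * r)) , ℚ.<-≤-trans (p-1<p m) (ℚ.p⊓q≤q (c * p) (c * r))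
(c · x) .U-inhabited =
  let p , Lp = L-inhabited x ; r , Ur = U-inhabited x ; m = (c * p) ⊔ (c * r) in
  m + 1ℚ , p , r , Lp , Ur ,
  ℚ.≤-<-trans (ℚ.p≤p⊔q (c * p) (c * r)) (p<p+1 m) , ℚ.≤-<-trans (ℚ.p≤q⊔p (c * p) (c * r)) (p<p+1 m)
(c · x) .L-lower q<q′ (p , r , Lp , Ur , q′<cp , q′<cr) =
  p , r , Lp , Ur , ℚ.<-trans q<q′ q′<cp , ℚ.<-trans q<q′ q′<cr
(c · x) .U-upper q<q′ (p , r , Lp , Ur , cp<q , cr<q) =
  p , r , Lp , Ur , ℚ.<-trans cp<q q<q′ , ℚ.<-trans cr<q q<q′
(c · x) .L-open (p , r , Lp , Ur , q<cp , q<cr) =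
  let m , q<m , m< = ℚ.<-dense (⊓-glb-< q<cp q<cr) in
  m , q<m , p , r , Lp , Ur , ℚ.<-≤-trans m< (ℚ.p⊓q≤p (c * p) (c * r)) , ℚ.<-≤-trans m< (ℚ.p⊓q≤q (c * p) (c * r))
(c · x) .U-open (p , r , Lp , Ur , cp<q , cr<q) =
  let m , <m , m<q = ℚ.<-dense (⊔-lub-< cp<q cr<q) in
  m , m<q , p , r , Lp , Ur , ℚ.≤-<-trans (ℚ.p≤p⊔q (c * p) (c * r)) <m , ℚ.≤-<-trans (ℚ.p≤q⊔p (c * p) (c * r)) <m
(c · x) .disjoint {q} (p , r , Lp , Ur , q<cp , q<cr) (p′ , r′ , Lp′ , Ur′ , cp′<q , cr′<q)
  with ℚ.≤-total 0ℚ c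
... | inj₁ 0≤c = ℚ.<-irrefl refl (ℚ.<-trans q<cp (ℚ.≤-<-trans
        (ℚ.*-monoˡ-≤-nonNeg c {{ℚ.nonNegative 0≤c}} (ℚ.<⇒≤ (L<U x Lp Ur′))) cr′<q))
... | inj₂ c≤0 = ℚ.<-irrefl refl (ℚ.<-trans q<cr (ℚ.≤-<-trans
        (ℚ.*-monoˡ-≤-nonPos c {{ℚ.nonPositive c≤0}} (ℚ.<⇒≤ (L<U x Lp′ Ur))) cp′<q))
(c · x) .located {a} {b} a<b with ℚ.<-cmp 0ℚ c
... | tri≈ _ refl _ with L-inhabited x | U-inhabited x | 0ℚ ℚ.<? b
...   | p , Lp | r , Ur | yes 0<b =
        inj₂ (p , r , Lp , Ur , subst (_< b) (sym (ℚ.*-zeroˡ p)) 0<b , subst (_< b) (sym (ℚ.*-zeroˡ r)) 0<b)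
...   | p , Lp | r , Ur | no  0≮b =
        let a<0 = ℚ.<-≤-trans a<b (ℚ.≮⇒≥ 0≮b) in
        inj₁ (p , r , Lp , Ur , subst (a <_) (sym (ℚ.*-zeroˡ p)) a<0 , subst (a <_) (sym (ℚ.*-zeroˡ r)) a<0)
(c · x) .located {a} {b} a<b | tri< 0<c _ _
  with located x (*-mono-<-pos (0<recip 0<c) a<b)
...   | inj₁ La/c =
        let p , a/c<p , Lp = L-open x La/c
            r , Ur = U-inhabited x
            a<cp = subst (_< c * p) (*-cancel-recip c a 0<c) (*-mono-<-pos 0<c a/c<p)
        in inj₁ (p , r , Lp , Ur , a<cp , ℚ.<-trans a<cp (*-mono-<-pos 0<c (L<U x Lp Ur)))
...   | inj₂ Ub/c =
        let r , r<b/c , Ur = U-open x Ub/c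
            p , Lp = L-inhabited x
            cr<b = subst (c * r <_) (*-cancel-recip c b 0<c) (*-mono-<-pos 0<c r<b/c)
        in inj₂ (p , r , Lp , Ur , ℚ.<-trans (*-mono-<-pos 0<c (L<U x Lp Ur)) cr<b , cr<b)
(c · x) .located {a} {b} a<b | tri> _ _ c<0 = neg
  where
  d = ℚ.- c
  0<d : 0ℚ < d
  0<d = ℚ.neg-antimono-< c<0
  c*- : ∀ p → c * (ℚ.- p) ≡ d * p
  c*- p = solve 2 (λ c p → c :* (:- p) := (:- c) :* p) refl c p
    where open +-*-Solver
  c-anti : ∀ {p q} → p < q → c * q < c * p
  c-anti = ℚ.*-monoʳ-<-neg c {{ℚ.negative c<0}}
  cancel : ∀ q → c * (ℚ.- (recip d 0<d * q)) ≡ q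
  cancel q = trans (c*- (recip d 0<d * q)) (*-cancel-recip d q 0<d)
  neg : L (c · x) a ⊎ U (c · x) b
  neg with located x (ℚ.neg-antimono-< (*-mono-<-pos (0<recip 0<d) a<b))
  ... | inj₁ L-b/d =
        let p , b/c<p , Lp = L-open x L-b/d
            r , Ur = U-inhabited x
            cp<b = subst (c * p <_) (cancel b) (c-anti b/c<p)
        in inj₂ (p , r , Lp , Ur , cp<b , ℚ.<-trans (c-anti (L<U x Lp Ur)) cp<b)
  ... | inj₂ U-a/d =
        let r , r<a/c , Ur = U-open x U-a/d
            p , Lp = L-inhabited x
            a<cr = subst (_< c * r) (cancel a) (c-anti r<a/c)
        in inj₁ (p , r , Lp , Ur , ℚ.<-trans a<cr (c-anti (L<U x Lp Ur)) , a<cr)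

_⁻¹ : (x : ℝ) → {{IsPositive x}} → ℝ
((x ⁻¹) {{x>0}}) .L q = ∃ λ r → Σ (0ℚ < r) λ 0<r → U x r × q < recip r 0<r
((x ⁻¹) {{x>0}}) .U q = ∃ λ p → Σ (0ℚ < p) λ 0<p → L x p × recip p 0<p < q
((x ⁻¹) {{x>0}}) .L-inhabited =
  let r , Ur = U-inhabited x ; 0<r = L<U x (0<x x>0) Ur in
  recip r 0<r - 1ℚ , r , 0<r , Ur , p-1<p _
((x ⁻¹) {{x>0}}) .U-inhabited =
  let p , 0<p , Lp = L-open x (0<x x>0) in
  recip p 0<p + 1ℚ , p , 0<p , Lp , p<p+1 _
((x ⁻¹) {{x>0}}) .L-lower q<q′ (r , 0<r , Ur , q′<) = r , 0<r , Ur , ℚ.<-trans q<q′ q′<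
((x ⁻¹) {{x>0}}) .U-upper q<q′ (p , 0<p , Lp , <q) = p , 0<p , Lp , ℚ.<-trans <q q<q′
((x ⁻¹) {{x>0}}) .L-open (r , 0<r , Ur , q<) =
  let m , q<m , m< = ℚ.<-dense q< in m , q<m , r , 0<r , Ur , m<
((x ⁻¹) {{x>0}}) .U-open (p , 0<p , Lp , <q) =
  let m , <m , m<q = ℚ.<-dense <q in m , m<q , p , 0<p , Lp , <m
((x ⁻¹) {{x>0}}) .disjoint (r , 0<r , Ur , q<) (p , 0<p , Lp , <q) =
  ℚ.<-asym (ℚ.<-trans <q q<) (recip-anti 0<p 0<r (L<U x Lp Ur))
((x ⁻¹) {{x>0}}) .located {a} {b} a<b with 0ℚ ℚ.<? a
... | no 0≮a =
      let r , Ur = U-inhabited x ; 0<r = L<U x (0<x x>0) Ur in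
      inj₁ (r , 0<r , Ur , ℚ.≤-<-trans (ℚ.≮⇒≥ 0≮a) (0<recip 0<r))
... | yes 0<a with located x (recip-anti 0<a (ℚ.<-trans 0<a a<b) a<b)
...   | inj₁ L1/b =
        let 0<b = ℚ.<-trans 0<a a<b
            p , 1/b<p , Lp = L-open x L1/b
            0<p = ℚ.<-trans (0<recip 0<b) 1/b<p
        in inj₂ (p , 0<p , Lp , recip-swap-< 0<b 0<p 1/b<p)
...   | inj₂ U1/a =
        let r , r<1/a , Ur = U-open x U1/a
            0<r = L<U x (0<x x>0) Ur
        in inj₁ (r , 0<r , Ur , <-swap-recip 0<a 0<r r<1/a)

-- the square root of x ⊔ 0
√_ : ℝ → ℝ
(√ x) .L q = ∃ λ p → q < p × (p ≤ 0ℚ ⊎ 0ℚ < p × L x (p * p))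
(√ x) .U q = ∃ λ p → p < q × 0ℚ ≤ p × U x (p * p)
(√ x) .L-inhabited = 0ℚ - 1ℚ , 0ℚ , p-1<p 0ℚ , inj₁ ℚ.≤-refl
(√ x) .U-inhabited =
  let r , Ur = U-inhabited x
      m = r ⊔ 1ℚ
      1≤m = ℚ.p≤q⊔p r 1ℚ
      0≤m = ℚ.≤-trans (ℚ.<⇒≤ 0<1) 1≤m
      m≤m² = subst (_≤ m * m) (ℚ.*-identityʳ m) (ℚ.*-monoˡ-≤-nonNeg m {{ℚ.nonNegative 0≤m}} 1≤m)
  in m + 1ℚ , m , p<p+1 m , 0≤m , U-upper-≤ x (ℚ.≤-trans (ℚ.p≤p⊔q r 1ℚ) m≤m²) Ur
(√ x) .L-lower q<q′ (p , q′<p , Lp) = p , ℚ.<-trans q<q′ q′<p , Lp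
(√ x) .U-upper q<q′ (p , p<q , Up) = p , ℚ.<-trans p<q q<q′ , Up
(√ x) .L-open (p , q<p , Lp) = let m , q<m , m<p = ℚ.<-dense q<p in m , q<m , p , m<p , Lp
(√ x) .U-open (p , p<q , Up) = let m , p<m , m<q = ℚ.<-dense p<q in m , m<q , p , p<m , Up
(√ x) .disjoint (p , q<p , inj₁ p≤0) (p′ , p′<q , 0≤p′ , _) =
  ℚ.<-irrefl refl (ℚ.<-≤-trans (ℚ.<-trans p′<q q<p) (ℚ.≤-trans p≤0 0≤p′))
(√ x) .disjoint (p , q<p , inj₂ (0<p , Lp²)) (p′ , p′<q , 0≤p′ , Up′²) =
  ℚ.<-asym (square-mono-< 0≤p′ (ℚ.<-trans p′<q q<p)) (L<U x Lp² Up′²)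
(√ x) .located {a} {b} a<b with ℚ.<-dense a<b
... | n , a<n , n<b with ℚ.<-dense a<n
...   | m , a<m , m<n with 0ℚ ℚ.<? m
...     | no  0≮m = inj₁ (m , a<m , inj₁ (ℚ.≮⇒≥ 0≮m))
...     | yes 0<m with located x (square-mono-< (ℚ.<⇒≤ 0<m) m<n)
...       | inj₁ Lm² = inj₁ (m , a<m , inj₂ (0<m , Lm²))
...       | inj₂ Un² = inj₂ (n , n<b , ℚ.<⇒≤ (ℚ.<-trans 0<m m<n) , Un²)

instance
  √-isPositive : ∀ {x} {{_ : IsPositive x}} → IsPositive (√ x)
  √-isPositive {x} {{x>0}} =
    let r , 0<r , Lr = L-open x (0<x x>0)
        m = r ⊓ 1ℚ
        0<m = ⊓-glb-< 0<r 0<1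
        m²≤m = subst (m * m ≤_) (ℚ.*-identityʳ m)
                 (ℚ.*-monoˡ-≤-nonNeg m {{ℚ.nonNegative (ℚ.<⇒≤ 0<m)}} (ℚ.p⊓q≤q r 1ℚ))
    in isPositive (m , 0<m , inj₂ (0<m , L-lower-≤ x (ℚ.≤-trans m²≤m (ℚ.p⊓q≤p r 1ℚ)) Lr))

  ·-isPositive : ∀ {c x} {{_ : Positive c}} {{_ : IsPositive x}} → IsPositive (c · x)
  ·-isPositive {c} {x} {{c>0}} {{x>0}} =
    let p , 0<p , Lp = L-open x (0<x x>0)
        r , Ur = U-inhabited x
        0<c* : ∀ {q} → 0ℚ < q → 0ℚ < c * q
        0<c* {q} 0<q = subst (_< c * q) (ℚ.*-zeroʳ c) (ℚ.*-monoʳ-<-pos c {{c>0}} 0<q)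
    in isPositive (p , r , Lp , Ur , 0<c* 0<p , 0<c* (L<U x (0<x x>0) Ur))

∑< : ℕ → (ℕ → ℕ) → ℕ
∑< zero    f = 0
∑< (suc n) f = f 0 ℕ.+ ∑< n (f ∘ suc)

indicator : Bool → ℕ
indicator b = if b then 1 else 0

count : ℕ → (ℕ → ℕ → Bool) → ℕ
count m P = ∑< m λ a → ∑< m λ b → indicator (P a b)

-- π is the area of the unit disc, four times the area of its quadrant.
-- Divide the unit square into m² cells
--   [a / m , (a + 1) / m] × [b / m , (b + 1) / m]   (a, b < m).
-- Those contained in the closed unit disc are counted by inner m, those
-- meeting the open unit disc by outer m.
isInner isOuter : ℕ → ℕ → ℕ → Bool
isInner m a b = suc a ℕ.* suc a ℕ.+ suc b ℕ.* suc b ℕ.≤ᵇ m ℕ.* m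
isOuter m a b = a ℕ.* a ℕ.+ b ℕ.* b ℕ.<ᵇ m ℕ.* m

inner outer : ℕ → ℕ
inner m = count m (isInner m)
outer m = count m (isOuter m)

∑<-mono : ∀ n {f g} → (∀ k → f k ℕ.≤ g k) → ∑< n f ℕ.≤ ∑< n g
∑<-mono zero    f≤g = z≤n
∑<-mono (suc n) f≤g = ℕ.+-mono-≤ (f≤g 0) (∑<-mono n (f≤g ∘ suc))

∑<-cong : ∀ n {f g} → (∀ k → k ℕ.< n → f k ≡ g k) → ∑< n f ≡ ∑< n g
∑<-cong zero    f≡g = refl
∑<-cong (suc n) f≡g = cong₂ ℕ._+_ (f≡g 0 (s≤s z≤n)) (∑<-cong n (λ k k<n → f≡g (suc k) (s≤s k<n)))

∑<-grow : ∀ n f → ∑< n f ℕ.≤ ∑< (suc n) f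
∑<-grow zero    f = z≤n
∑<-grow (suc n) f = ℕ.+-monoʳ-≤ (f 0) (∑<-grow n (f ∘ suc))

∑<-+ : ∀ m n f → ∑< (m ℕ.+ n) f ≡ ∑< m f ℕ.+ ∑< n (λ k → f (m ℕ.+ k))
∑<-+ zero    n f = refl
∑<-+ (suc m) n f = trans (cong (f 0 ℕ.+_) (∑<-+ m n (f ∘ suc))) (sym (ℕ.+-assoc (f 0) _ _))

∑<-const : ∀ n c → ∑< n (λ _ → c) ≡ n ℕ.* c
∑<-const zero    c = refl
∑<-const (suc n) c = cong (c ℕ.+_) (∑<-const n c)

∑<-* : ∀ n c f → ∑< n (λ k → c ℕ.* f k) ≡ c ℕ.* ∑< n f
∑<-* zero    c f = sym (ℕ.*-zeroʳ c)
∑<-* (suc n) c f = trans (cong (c ℕ.* f 0 ℕ.+_) (∑<-* n c (f ∘ suc))) (sym (ℕ.*-distribˡ-+ c (f 0) _))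

∑<-suc+ : ∀ n f → ∑< n (suc ∘ f) ≡ n ℕ.+ ∑< n f
∑<-suc+ zero    f = refl
∑<-suc+ (suc n) f = cong suc (begin
  f 0 ℕ.+ ∑< n (λ k → suc (f (suc k)))   ≡⟨ cong (f 0 ℕ.+_) (∑<-suc+ n (f ∘ suc)) ⟩
  f 0 ℕ.+ (n ℕ.+ ∑< n (f ∘ suc))         ≡⟨ ℕ.+-assoc (f 0) n _ ⟨
  f 0 ℕ.+ n ℕ.+ ∑< n (f ∘ suc)           ≡⟨ cong (ℕ._+ ∑< n (f ∘ suc)) (ℕ.+-comm (f 0) n) ⟩
  n ℕ.+ f 0 ℕ.+ ∑< n (f ∘ suc)           ≡⟨ ℕ.+-assoc n (f 0) _ ⟩
  n ℕ.+ (f 0 ℕ.+ ∑< n (f ∘ suc))         ∎)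
  where open ≡-Reasoning

∑<-block : ∀ m k .{{_ : ℕ.NonZero k}} f → ∑< (m ℕ.* k) (λ a → f (a ℕ./ k)) ≡ k ℕ.* ∑< m f
∑<-block zero    k f = sym (ℕ.*-zeroʳ k)
∑<-block (suc m) k f = begin
  ∑< (k ℕ.+ m ℕ.* k) (λ a → f (a ℕ./ k))
    ≡⟨ ∑<-+ k (m ℕ.* k) (λ a → f (a ℕ./ k)) ⟩
  ∑< k (λ a → f (a ℕ./ k)) ℕ.+ ∑< (m ℕ.* k) (λ a → f ((k ℕ.+ a) ℕ./ k))
    ≡⟨ cong₂ ℕ._+_ (∑<-cong k (λ a a<k → cong f (ℕ.m<n⇒m/n≡0 a<k)))
                   (∑<-cong (m ℕ.* k) (λ a _ → cong f (shift a))) ⟩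
  ∑< k (λ _ → f 0) ℕ.+ ∑< (m ℕ.* k) (λ a → f (suc (a ℕ./ k)))
    ≡⟨ cong₂ ℕ._+_ (∑<-const k (f 0)) (∑<-block m k (f ∘ suc)) ⟩
  k ℕ.* f 0 ℕ.+ k ℕ.* ∑< m (f ∘ suc)
    ≡⟨ ℕ.*-distribˡ-+ k (f 0) _ ⟨
  k ℕ.* (f 0 ℕ.+ ∑< m (f ∘ suc)) ∎
  where
  open ≡-Reasoning
  shift : ∀ a → (k ℕ.+ a) ℕ./ k ≡ suc (a ℕ./ k)
  shift a = trans (ℕ.m/n≡1+[m∸n]/n (ℕ.m≤m+n k a)) (cong (λ b → suc (b ℕ./ k)) (ℕ.m+n∸m≡n k a))

indicator≤1 : ∀ b → indicator b ℕ.≤ 1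
indicator≤1 true  = ℕ.≤-refl
indicator≤1 false = z≤n

indicator-mono : ∀ b c → (IsTrue b → IsTrue c) → indicator b ℕ.≤ indicator c
indicator-mono false c     b⇒c = z≤n
indicator-mono true  true  b⇒c = ℕ.≤-refl
indicator-mono true  false b⇒c = contradiction (b⇒c _) (λ ())

count-block : ∀ m k .{{_ : ℕ.NonZero k}} P →
  count (m ℕ.* k) (λ a b → P (a ℕ./ k) (b ℕ./ k)) ≡ k ℕ.* (k ℕ.* count m P)
count-block m k P = begin
  ∑< (m ℕ.* k) (λ a → ∑< (m ℕ.* k) (λ b → indicator (P (a ℕ./ k) (b ℕ./ k))))
    ≡⟨ ∑<-cong (m ℕ.* k) (λ a _ → ∑<-block m k (λ b → indicator (P (a ℕ./ k) b))) ⟩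
  ∑< (m ℕ.* k) (λ a → k ℕ.* ∑< m (λ b → indicator (P (a ℕ./ k) b)))
    ≡⟨ ∑<-block m k (λ a → k ℕ.* ∑< m (λ b → indicator (P a b))) ⟩
  k ℕ.* ∑< m (λ a → k ℕ.* ∑< m (λ b → indicator (P a b)))
    ≡⟨ cong (k ℕ.*_) (∑<-* m k (λ a → ∑< m (λ b → indicator (P a b)))) ⟩
  k ℕ.* (k ℕ.* count m P) ∎
  where open ≡-Reasoning

count-mono : ∀ m P Q → (∀ a b → IsTrue (P a b) → IsTrue (Q a b)) → count m P ℕ.≤ count m Q
count-mono m P Q P⇒Q = ∑<-mono m λ a → ∑<-mono m λ b → indicator-mono (P a b) (Q a b) (P⇒Q a b)

*-square : ∀ a b → (a ℕ.* b) ℕ.* (a ℕ.* b) ≡ (a ℕ.* a) ℕ.* (b ℕ.* b)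
*-square a b = ℕ.[m*n]*[o*p]≡[m*o]*[n*p] a b a b

inner-outer : ∀ m k .{{_ : ℕ.NonZero m}} .{{_ : ℕ.NonZero k}} a b →
  IsTrue (isInner m (a ℕ./ k) (b ℕ./ k)) → IsTrue (isOuter k (a ℕ./ m) (b ℕ./ m))
inner-outer m k a b t = ℕ.<⇒<ᵇ {A′ ℕ.* A′ ℕ.+ B′ ℕ.* B′} {k ℕ.* k} (ℕ.*-cancelʳ-< (m ℕ.* m) _ _ (begin-strict
  (A′ ℕ.* A′ ℕ.+ B′ ℕ.* B′) ℕ.* (m ℕ.* m)                    ≡⟨ ℕ.*-distribʳ-+ (m ℕ.* m) (A′ ℕ.* A′) _ ⟩
  A′ ℕ.* A′ ℕ.* (m ℕ.* m) ℕ.+ B′ ℕ.* B′ ℕ.* (m ℕ.* m)        ≡⟨ cong₂ ℕ._+_ (*-square A′ m) (*-square B′ m) ⟨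
  A′ ℕ.* m ℕ.* (A′ ℕ.* m) ℕ.+ B′ ℕ.* m ℕ.* (B′ ℕ.* m)        ≤⟨ ℕ.+-mono-≤ (ℕ.*-mono-≤ (ℕ.m/n*n≤m a m) (ℕ.m/n*n≤m a m)) (ℕ.*-mono-≤ (ℕ.m/n*n≤m b m) (ℕ.m/n*n≤m b m)) ⟩
  a ℕ.* a ℕ.+ b ℕ.* b                                        <⟨ ℕ.+-mono-< (ℕ.*-mono-< (below a) (below a)) (ℕ.*-mono-< (below b) (below b)) ⟩
  suc A ℕ.* k ℕ.* (suc A ℕ.* k) ℕ.+ suc B ℕ.* k ℕ.* (suc B ℕ.* k)
                                                             ≡⟨ cong₂ ℕ._+_ (*-square (suc A) k) (*-square (suc B) k) ⟩
  suc A ℕ.* suc A ℕ.* (k ℕ.* k) ℕ.+ suc B ℕ.* suc B ℕ.* (k ℕ.* k)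
                                                             ≡⟨ ℕ.*-distribʳ-+ (k ℕ.* k) (suc A ℕ.* suc A) _ ⟨
  (suc A ℕ.* suc A ℕ.+ suc B ℕ.* suc B) ℕ.* (k ℕ.* k)        ≤⟨ ℕ.*-monoˡ-≤ (k ℕ.* k) (ℕ.≤ᵇ⇒≤ (suc A ℕ.* suc A ℕ.+ suc B ℕ.* suc B) (m ℕ.* m) t) ⟩
  m ℕ.* m ℕ.* (k ℕ.* k)                                      ≡⟨ ℕ.*-comm (m ℕ.* m) _ ⟩
  k ℕ.* k ℕ.* (m ℕ.* m)                                      ∎))
  where
  open ℕ.≤-Reasoning
  A = a ℕ./ k ; B = b ℕ./ k ; A′ = a ℕ./ m ; B′ = b ℕ./ m
  below : ∀ c → c ℕ.< suc (c ℕ./ k) ℕ.* k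
  below c = begin-strict
    c                            ≡⟨ ℕ.m≡m%n+[m/n]*n c k ⟩
    c ℕ.% k ℕ.+ c ℕ./ k ℕ.* k    <⟨ ℕ.+-monoˡ-< _ (ℕ.m%n<n c k) ⟩
    k ℕ.+ c ℕ./ k ℕ.* k          ∎

inner≤outer : ∀ m k .{{_ : ℕ.NonZero m}} .{{_ : ℕ.NonZero k}} →
  inner m ℕ.* (k ℕ.* k) ℕ.≤ outer k ℕ.* (m ℕ.* m)
inner≤outer m k = begin
  inner m ℕ.* (k ℕ.* k)    ≡⟨ trans (ℕ.*-comm (inner m) _) (ℕ.*-assoc k k _) ⟩
  k ℕ.* (k ℕ.* inner m)    ≡⟨ count-block m k (isInner m) ⟨
  count (m ℕ.* k) (λ a b → isInner m (a ℕ./ k) (b ℕ./ k))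
                           ≤⟨ count-mono (m ℕ.* k) (λ a b → isInner m (a ℕ./ k) (b ℕ./ k)) (λ a b → isOuter k (a ℕ./ m) (b ℕ./ m)) (inner-outer m k) ⟩
  count (m ℕ.* k) (λ a b → isOuter k (a ℕ./ m) (b ℕ./ m))
                           ≡⟨ cong (λ l → count l (λ a b → isOuter k (a ℕ./ m) (b ℕ./ m))) (ℕ.*-comm m k) ⟩
  count (k ℕ.* m) (λ a b → isOuter k (a ℕ./ m) (b ℕ./ m))
                           ≡⟨ count-block k m (isOuter k) ⟩
  m ℕ.* (m ℕ.* outer k)    ≡⟨ trans (ℕ.*-comm (outer k) _) (ℕ.*-assoc m m _) ⟨
  outer k ℕ.* (m ℕ.* m)    ∎
  where open ℕ.≤-Reasoning

outer≤inner : ∀ m → outer m ℕ.≤ inner m ℕ.+ (m ℕ.+ m)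
outer≤inner zero       = z≤n
outer≤inner m@(suc m′) = begin
  ∑< m (o 0) ℕ.+ ∑< m′ (λ a → o (suc a) 0 ℕ.+ ∑< m′ (λ b → o (suc a) (suc b)))
    ≤⟨ ℕ.+-mono-≤ (∑<-mono m (λ b → indicator≤1 (isOuter m 0 b))) (∑<-mono m′ row) ⟩
  ∑< m (λ _ → 1) ℕ.+ ∑< m′ (λ a → suc (∑< m (i′ a)))
    ≤⟨ ℕ.+-monoʳ-≤ (∑< m (λ _ → 1)) (∑<-grow m′ (λ a → suc (∑< m (i′ a)))) ⟩
  ∑< m (λ _ → 1) ℕ.+ ∑< m (λ a → suc (∑< m (i′ a)))
    ≡⟨ cong₂ ℕ._+_ (trans (∑<-const m 1) (ℕ.*-identityʳ m)) (∑<-suc+ m (λ a → ∑< m (i′ a))) ⟩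
  m ℕ.+ (m ℕ.+ inner m)
    ≡⟨ ℕ.+-assoc m m _ ⟨
  m ℕ.+ m ℕ.+ inner m
    ≡⟨ ℕ.+-comm (m ℕ.+ m) _ ⟩
  inner m ℕ.+ (m ℕ.+ m) ∎
  where
  open ℕ.≤-Reasoning
  o i′ : ℕ → ℕ → ℕ
  o  a b = indicator (isOuter m a b)
  i′ a b = indicator (isInner m a b)
  o⇒i : ∀ a b → IsTrue (isOuter m (suc a) (suc b)) → IsTrue (isInner m a b)
  o⇒i a b t = ℕ.≤⇒≤ᵇ (ℕ.<⇒≤ (ℕ.<ᵇ⇒< (suc a ℕ.* suc a ℕ.+ suc b ℕ.* suc b) (m ℕ.* m) t))
  row : ∀ a → o (suc a) 0 ℕ.+ ∑< m′ (λ b → o (suc a) (suc b)) ℕ.≤ suc (∑< m (i′ a))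
  row a = ℕ.+-mono-≤ (indicator≤1 (isOuter m (suc a) 0))
    (ℕ.≤-trans (∑<-mono m′ (λ b → indicator-mono (isOuter m (suc a) (suc b)) (isInner m a b) (o⇒i a b)))
               (∑<-grow m′ (i′ a)))

/-mono : ∀ a b c d .{{_ : ℕ.NonZero b}} .{{_ : ℕ.NonZero d}} →
  a ℕ.* d ℕ.≤ c ℕ.* b → + a / b ≤ + c / d
/-mono a (suc b) c (suc d) ad≤cb = ℚ.toℚᵘ-cancel-≤ (begin
  ℚ.toℚᵘ (+ a / suc b)      ≃⟨ ℚ.toℚᵘ-fromℚᵘ (ℚᵘ.mkℚᵘ (+ a) b) ⟩
  ℚᵘ.mkℚᵘ (+ a) b           ≤⟨ ℚᵘ.*≤* (subst₂ ℤ._≤_ (ℤ.pos-* a (suc d)) (ℤ.pos-* c (suc b)) (ℤ.+≤+ ad≤cb)) ⟩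
  ℚᵘ.mkℚᵘ (+ c) d           ≃⟨ ℚ.toℚᵘ-fromℚᵘ (ℚᵘ.mkℚᵘ (+ c) d) ⟨
  ℚ.toℚᵘ (+ c / suc d)      ∎)
  where open ℚᵘ.≤-Reasoning

/-+-distrib : ∀ a c b d .{{_ : ℕ.NonZero b}} .{{_ : ℕ.NonZero d}} .{{_ : ℕ.NonZero (b ℕ.* d)}} →
  + (a ℕ.* d ℕ.+ c ℕ.* b) / (b ℕ.* d) ≡ + a / b + + c / d
/-+-distrib a c b@(suc b′) d@(suc d′) = ℚ.toℚᵘ-injective (begin
  ℚ.toℚᵘ (+ (a ℕ.* d ℕ.+ c ℕ.* b) / (b ℕ.* d))  ≈⟨ ℚ.toℚᵘ-fromℚᵘ _ ⟩
  (+ (a ℕ.* d ℕ.+ c ℕ.* b)) ℚᵘ./ (b ℕ.* d)      ≡⟨ cong (ℚᵘ._/ (b ℕ.* d)) (trans (ℤ.pos-+ (a ℕ.* d) _) (cong₂ ℤ._+_ (ℤ.pos-* a d) (ℤ.pos-* c b))) ⟩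
  ℚᵘ.mkℚᵘ (+ a) b′ ℚᵘ.+ ℚᵘ.mkℚᵘ (+ c) d′        ≈⟨ ℚᵘ.+-cong (ℚ.toℚᵘ-fromℚᵘ (ℚᵘ.mkℚᵘ (+ a) b′)) (ℚ.toℚᵘ-fromℚᵘ (ℚᵘ.mkℚᵘ (+ c) d′)) ⟨
  ℚ.toℚᵘ (+ a / b) ℚᵘ.+ ℚ.toℚᵘ (+ c / d)        ≈⟨ ℚ.toℚᵘ-homo-+ (+ a / b) (+ c / d) ⟨
  ℚ.toℚᵘ (+ a / b + + c / d)                    ∎)
  where open import Relation.Binary.Reasoning.Setoid ℚᵘ.≃-setoid

archimedean : ∀ c {δ} → 0ℚ < δ → ∃ λ k → + c / suc k < δ
archimedean c {ℚ.mkℚ (+ 0) d-1 cop} (ℚ.*<* (ℤ.+<+ ()))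
archimedean c {ℚ.mkℚ ℤ.-[1+ a ] d-1 cop} (ℚ.*<* ())
archimedean c {δ@(ℚ.mkℚ ℤ.+[1+ a ] d-1 cop)} _ = k , ℚ.toℚᵘ-cancel-< (begin-strict
  ℚ.toℚᵘ (+ c / suc k)    ≃⟨ ℚ.toℚᵘ-fromℚᵘ (ℚᵘ.mkℚᵘ (+ c) k) ⟩
  ℚᵘ.mkℚᵘ (+ c) k         <⟨ ℚᵘ.*<* (subst₂ ℤ._<_ (ℤ.pos-* c (suc d-1)) refl (ℤ.+<+ (ℕ.≤-trans (s≤s ℕ.≤-refl) (ℕ.m≤n*m (suc k) (suc a))))) ⟩
  ℚ.toℚᵘ δ                ∎)
  where
  open ℚᵘ.≤-Reasoning
  k = c ℕ.* suc d-1

-- These use the mesh 1 / (m + 1).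
lowerArea upperArea : ℕ → ℚ
lowerArea m = + (4 ℕ.* inner (suc m)) / (suc m ℕ.* suc m)
upperArea m = + (4 ℕ.* outer (suc m)) / (suc m ℕ.* suc m)

lower≤upper : ∀ m k → lowerArea m ≤ upperArea k
lower≤upper m k = /-mono (4 ℕ.* inner (suc m)) (suc m ℕ.* suc m) (4 ℕ.* outer (suc k)) (suc k ℕ.* suc k) (subst₂ ℕ._≤_
  (sym (ℕ.*-assoc 4 (inner (suc m)) _)) (sym (ℕ.*-assoc 4 (outer (suc k)) _))
  (ℕ.*-monoʳ-≤ 4 (inner≤outer (suc m) (suc k))))

rearrange : ∀ x y → 4 ℕ.* (x ℕ.+ (y ℕ.+ y)) ℕ.* (y ℕ.* y ℕ.* y) ≡ (4 ℕ.* x ℕ.* y ℕ.+ 8 ℕ.* (y ℕ.* y)) ℕ.* (y ℕ.* y)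
rearrange = solve 2 (λ x y → con 4 :* (x :+ (y :+ y)) :* (y :* y :* y) := (con 4 :* x :* y :+ con 8 :* (y :* y)) :* (y :* y)) refl
  where open ℕ-Solver

upper≤lower+8/m : ∀ m → upperArea m ≤ lowerArea m + + 8 / suc m
upper≤lower+8/m m = subst (upperArea m ≤_) (/-+-distrib (4 ℕ.* I) 8 (n ℕ.* n) n)
  (/-mono (4 ℕ.* O) (n ℕ.* n) (4 ℕ.* I ℕ.* n ℕ.+ 8 ℕ.* (n ℕ.* n)) (n ℕ.* n ℕ.* n) (begin
    4 ℕ.* O ℕ.* (n ℕ.* n ℕ.* n)                            ≤⟨ ℕ.*-monoˡ-≤ (n ℕ.* n ℕ.* n) (ℕ.*-monoʳ-≤ 4 (outer≤inner n)) ⟩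
    4 ℕ.* (I ℕ.+ (n ℕ.+ n)) ℕ.* (n ℕ.* n ℕ.* n)            ≡⟨ rearrange I n ⟩
    (4 ℕ.* I ℕ.* n ℕ.+ 8 ℕ.* (n ℕ.* n)) ℕ.* (n ℕ.* n)      ∎))
  where
  open ℕ.≤-Reasoning
  n = suc m ; I = inner n ; O = outer n

separate : ∀ l u {p q e} → u ≤ l + e → e < q - p → p < l ⊎ u < q
separate l u {p} {q} {e} u≤l+e e<q-p with p ℚ.<? l
... | yes p<l = inj₁ p<l
... | no  p≮l = inj₂ (begin-strict
  u             ≤⟨ u≤l+e ⟩
  l + e         ≤⟨ ℚ.+-monoˡ-≤ e (ℚ.≮⇒≥ p≮l) ⟩
  p + e         <⟨ ℚ.+-monoʳ-< p e<q-p ⟩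
  p + (q - p)   ≡⟨ solve 2 (λ x y → x :+ (y :- x) := y) refl p q ⟩
  q             ∎)
  where
  open ℚ.≤-Reasoning
  open +-*-Solver

π : ℝ
π .L q = ∃ λ m → q < lowerArea m
π .U q = ∃ λ m → upperArea m < q
π .L-inhabited = lowerArea 0 - 1ℚ , 0 , p-1<p (lowerArea 0)
π .U-inhabited = upperArea 0 + 1ℚ , 0 , p<p+1 (upperArea 0)
π .L-lower p<q (m , q<) = m , ℚ.<-trans p<q q<
π .U-upper p<q (m , <p) = m , ℚ.<-trans <p p<q
π .L-open (m , p<) = let q , p<q , q< = ℚ.<-dense p< in q , p<q , m , q<
π .U-open (m , <q) = let p , <p , p<q = ℚ.<-dense <q in p , p<q , m , <p
π .disjoint (m , q<) (k , <q) =
  ℚ.<-irrefl refl (ℚ.<-trans <q (ℚ.<-≤-trans q< (lower≤upper m k)))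
π .located {p} {q} p<q =
  let m , 8/m<q-p = archimedean 8 (subst (_< q - p) (ℚ.+-inverseʳ p) (ℚ.+-monoˡ-< (ℚ.- p) p<q)) in
  Sum.map (m ,_) (m ,_) (separate (lowerArea m) (upperArea m) (upper≤lower+8/m m) 8/m<q-p)

instance
  π-isPositive : IsPositive π
  π-isPositive = isPositive (1 , ℚ.positive⁻¹ (lowerArea 1))

  ι-positive : ∀ {n} .{{_ : ℕ.NonZero n}} → Positive (ι n)
  ι-positive {suc n} = _

Sequence : Set₁
Sequence = (n : ℕ) → .{{_ : ℕ.NonZero n}} → ℝ

infix 4 _∼_

-- a n / b n tends to 1: for every ε, eventually b n is positive (so that the
-- quotient is defined) and 1 - ε < a n / b n < 1 + ε. Indices start at 1, as
-- b 0 may be undefined.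
_∼_ : (ℕ → ℚ) → Sequence → Set
a ∼ b = ∀ ε → 0ℚ < ε → ∃ λ N → ∀ n .{{_ : ℕ.NonZero n}} → N ℕ.≤ n →
  Σ (IsPositive (b n)) λ b>0 →
    let a/b = a n · (b n ⁻¹) {{b>0}} in L a/b (1ℚ - ε) × U a/b (1ℚ + ε)

M : ℕ → ℚ
M n = ι ∣ 𝓜 n ∣

1+X+X² : FPS
1+X+X² = 1ˢ +ˢ X +ˢ X ^ˢ 2

T : ℕ → ℚ
T n = (1+X+X² ^ˢ n) n

1-2X-3X² : FPS
1-2X-3X² = 1ˢ -ˢ ι 2 ·ˢ X -ˢ ι 3 ·ˢ X ^ˢ 2

-- A covering pair of Motzkin paths arises by raising one vertex by one. Counted
-- over all starting heights, covering pairs satisfy a linear recursion, which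
-- the reflection principle and the ballot identity solve in terms of trinomial
-- coefficients.
--
-- Put e n = T n + T (n - 1), so that ℓ n = e n - M n - M (n - 1); the series of
-- e is √((1 + x) / (1 - 3 x)). The recurrence of e shows that n e(n)² / 9^n
-- increases and (n + 1) e(n)² / 9^n decreases, so e(n) ≈ c 3^n / √n for a
-- constant c. The derivative of the series has the explicit square
-- 4 / ((1 + x) (1 - 3 x)³), whose coefficients are the convolutions
-- ∑ i e(i) (N - i) e(N - i) ≈ c² 3^N ∑ √(i (N - i)). The last sum is, up to
-- O(N), the area of a half disc of diameter N; comparing it with the lattice
-- cells that define π gives c² = 4 / (3 π), with explicit error bounds.

module Submission where

open import Defs
open import Algebra.Bundles using (CommutativeRing)
open import Algebra.Structures using (IsCommutativeRing)
import Algebra.Properties.Group as GroupProperties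
import Algebra.Solver.Ring as RingSolver
import Algebra.Solver.Ring.AlmostCommutativeRing as ACR
open import Data.Bool.Base using (Bool; true; false) renaming (T to IsTrue)
open import Data.Empty using (⊥)
open import Data.Fin.Base using (Fin; toℕ)
import Data.Integer.Base as ℤ
import Data.Integer.Properties as ℤ
open import Data.List.Base using (List; []; _∷_; _++_; map; length; filter; cartesianProduct)
open import Data.List.Membership.Propositional using (_∈_)
open import Data.List.Membership.Propositional.Properties using (∈-map⁺; ∈-map⁻; ∈-++⁺ˡ; ∈-++⁺ʳ; ∈-++⁻; ∈-filter⁺; ∈-filter⁻)
open import Data.List.Membership.Propositional.Properties.WithK using (unique∧set⇒bag)
import Data.List.Properties as List
open import Data.List.Relation.Binary.BagAndSetEquality using (∼bag⇒↭)
open import Data.List.Relation.Binary.Permutation.Propositional.Properties using (↭-length)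
open import Data.List.Relation.Unary.All using ([])
open import Data.List.Relation.Unary.AllPairs using ([]; _∷_)
open import Data.List.Relation.Unary.Any using (here)
open import Data.List.Relation.Unary.Unique.Propositional using (Unique)
import Data.List.Relation.Unary.Unique.Propositional.Properties as Unique
open import Data.Maybe.Base using (Maybe; just; nothing)
open import Data.Nat.Base as ℕ using (ℕ; zero; suc; z≤n; s≤s; _^_; ⌊_/2⌋)
open import Data.Nat.Combinatorics using (nCk+nC[k+1]≡[n+1]C[k+1]; k>n⇒nCk≡0; nCk≡nC[n∸k]; nCk≡n!/k![n-k]!; k![n∸k]!∣n!)
import Data.Nat.DivMod as ℕ
import Data.Nat.ListAction as ListAction
import Data.Nat.ListAction.Properties as ListAction
import Data.Nat.Properties as ℕ
open import Data.Nat.Tactic.RingSolver using (solve-∀)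
open import Data.Product.Base using (∃; Σ; _×_; _,_; proj₁; proj₂; uncurry)
open import Data.Rational.Base as ℚ using (ℚ; 0ℚ; 1ℚ; ½)
import Data.Rational.Properties as ℚ
open import Data.Rational.Solver using (module +-*-Solver)
import Data.Rational.Unnormalised.Base as ℚᵘ
import Data.Rational.Unnormalised.Properties as ℚᵘ
open import Data.Sum.Base using (_⊎_; inj₁; inj₂; [_,_]′)
open import Data.Vec.Functional using (foldr)
open import Function.Base using (_∘_; id)
open import Function.Bundles using (mk⇔)
open import Level using (0ℓ)
open import Relation.Binary.PropositionalEquality
open import Relation.Binary.Structures using (IsEquivalence)
open import Relation.Nullary using (Dec; ¬_; yes; no; does; contradiction)
open import Relation.Unary using (Decidable)

-- Squaring the series of `e` itself would lead to ∑ e(i) e(N - i) ≈ c² 3^N ∑ 1 / √(i (N - i)), a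
-- sum with singular ends that is no area. Differentiation replaces the summand by the half chord
-- √(i (N - i)), which fits the definition of π by lattice cells. The constant c is never
-- constructed as a limit. Each single index m ≥ 3 gives integer inequalities valid for every radius
-- R ≥ 1, 3 m e(m)² `inner R` ≤ 9^m R² ≤ 3 (m + 1) e(m)² `outer R`, hence 4 · 9^m / (3 (m + 1)
-- e(m)²) ≤ π ≤ 4 · 9^m / (3 m e(m)²). Square roots are handled through integers whose squares are
-- compared, so real numbers enter only at the very end. The factor 4 / 9 comes from 2 M_n = 3 e(n +
-- 1) - e(n + 2): since e(n + 1) / e(n) ≈ 3 (1 - 1 / (2n)), this difference is about 9 e(n) / (2n).

-- Covering pairs of lattice paths, and the recursion that counts them.

module Covers where
  open import Data.Fin.Base using (zero; suc)
  open import Data.Nat.Base using (_+_; _*_; _≤_; _<_)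

  -- The covers of p arise by raising one vertex of p by one. lift p raises
  -- the initial vertex; raising a later one changes two consecutive steps.
  lift : ∀ {h n} → Path h n → List (Path (suc h) n)
  lift []     = []
  lift (U∷ p) = (H∷ p) ∷ []
  lift (H∷ p) = (D∷ p) ∷ []
  lift (D∷ p) = []

  ups : ∀ {h n} → Path h n → List (Path h n)
  ups []     = []
  ups (U∷ p) = map U∷_ (ups p)
  ups (H∷ p) = map U∷_ (lift p) ++ map H∷_ (ups p)
  ups (D∷ p) = map H∷_ (lift p) ++ map D∷_ (ups p)

  -- A rank function: every move in `ups` adds exactly one to it, which leaves no room for a path
  -- strictly between.
  area : ∀ {h n} → Path h n → ℕ
  area p = foldr _+_ 0 (height p)

  sum-mono : ∀ {n} {f g : Fin n → ℕ} → (∀ k → f k ≤ g k) → foldr _+_ 0 f ≤ foldr _+_ 0 g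
  sum-mono {zero}  f≤g = z≤n
  sum-mono {suc n} f≤g = ℕ.+-mono-≤ (f≤g zero) (sum-mono (f≤g ∘ suc))

  sum-injective : ∀ {n} {f g : Fin n → ℕ} → (∀ k → f k ≤ g k) →
    foldr _+_ 0 g ≤ foldr _+_ 0 f → ∀ k → f k ≡ g k
  sum-injective {suc n} {f} {g} f≤g ≥ zero = ℕ.≤-antisym (f≤g zero)
    (ℕ.+-cancelʳ-≤ (foldr _+_ 0 (g ∘ suc)) _ _ (ℕ.≤-trans ≥ (ℕ.+-monoʳ-≤ (f zero) (sum-mono (f≤g ∘ suc)))))
  sum-injective {suc n} {f} {g} f≤g ≥ (suc k) = sum-injective (f≤g ∘ suc)
    (ℕ.+-cancelˡ-≤ (g zero) _ _ (ℕ.≤-trans ≥ (ℕ.+-monoˡ-≤ (foldr _+_ 0 (f ∘ suc)) (f≤g zero)))) k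

  area-lift : ∀ {h n} (p : Path h n) {r} → r ∈ lift p → area r ≡ suc (area p)
  area-lift (U∷ p) (here refl) = refl
  area-lift (H∷ p) (here refl) = refl

  lift-above : ∀ {h n} (p : Path h n) {r} → r ∈ lift p → ∀ k → height p k ≤ height r k
  lift-above (U∷ p) (here refl) zero    = ℕ.n≤1+n _
  lift-above (U∷ p) (here refl) (suc k) = ℕ.≤-refl
  lift-above (H∷ p) (here refl) zero    = ℕ.n≤1+n _
  lift-above (H∷ p) (here refl) (suc k) = ℕ.≤-refl

  ups-above : ∀ {h n} (p : Path h n) {r} → r ∈ ups p → area r ≡ suc (area p) × p ⊑ᴹ r
  ups-above {h} (U∷ p) r∈ with ∈-map⁻ U∷_ r∈
  ... | s , s∈ , refl = let a , b = ups-above p s∈ in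
    trans (cong (h +_) a) (ℕ.+-suc h _) , λ { zero → ℕ.≤-refl ; (suc k) → b k }
  ups-above {h} (H∷ p) r∈ with ∈-++⁻ (map U∷_ (lift p)) r∈
  ... | inj₁ r∈₁ with ∈-map⁻ U∷_ r∈₁
  ...   | s , s∈ , refl = trans (cong (h +_) (area-lift p s∈)) (ℕ.+-suc h _) ,
                          λ { zero → ℕ.≤-refl ; (suc k) → lift-above p s∈ k }
  ups-above {h} (H∷ p) r∈ | inj₂ r∈₂ with ∈-map⁻ H∷_ r∈₂
  ...   | s , s∈ , refl = let a , b = ups-above p s∈ in
    trans (cong (h +_) a) (ℕ.+-suc h _) , λ { zero → ℕ.≤-refl ; (suc k) → b k }
  ups-above {h} (D∷ p) r∈ with ∈-++⁻ (map H∷_ (lift p)) r∈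
  ... | inj₁ r∈₁ with ∈-map⁻ H∷_ r∈₁
  ...   | s , s∈ , refl = trans (cong (h +_) (area-lift p s∈)) (ℕ.+-suc h _) ,
                          λ { zero → ℕ.≤-refl ; (suc k) → lift-above p s∈ k }
  ups-above {h} (D∷ p) r∈ | inj₂ r∈₂ with ∈-map⁻ D∷_ r∈₂
  ...   | s , s∈ , refl = let a , b = ups-above p s∈ in
    trans (cong (h +_) a) (ℕ.+-suc h _) , λ { zero → ℕ.≤-refl ; (suc k) → b k }

  Below : ∀ {h h′ n} → Path h n → Path h′ n → Set
  Below p q = ∀ k → height p k ≤ height q k

  -- When the starting heights differ, the raised vertex may also be the first.
  raise-strict : ∀ {h h′ n} (p : Path h n) (q : Path h′ n) → h < h′ → Below p q →
    (∃ λ r → r ∈ lift p × Below r q) ⊎ (∃ λ r → r ∈ ups p × Below r q)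
  raise-strict [] [] ()
  raise-strict (U∷ p) q h<h′ b = inj₁ (H∷ p , here refl , λ { zero → h<h′ ; (suc k) → b (suc k) })
  raise-strict (H∷ p) q h<h′ b = inj₁ (D∷ p , here refl , λ { zero → h<h′ ; (suc k) → b (suc k) })
  -- The start of a down step cannot be raised, as the step would become -2, so a later vertex must
  -- be. The recursion applies because `q` starts at height at least `2 + h` and loses at most one
  -- in its first step, hence stays strictly above `h`.
  raise-strict {suc h} {h′} (D∷_ {n = n} p) q h<h′ b = tail q h<h′ b
    where
    extend : ∀ {h″} (q′ : Path h″ n) → h < h″ → Below p q′ →
      (∃ λ r → r ∈ map H∷_ (lift p) ++ map D∷_ (ups p) × (∀ k → height r (suc k) ≤ height q′ k))
    extend q′ h<h″ b with raise-strict p q′ h<h″ b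
    ... | inj₁ (r , r∈ , b′) = H∷ r , ∈-++⁺ˡ (∈-map⁺ H∷_ r∈) , b′
    ... | inj₂ (r , r∈ , b′) = D∷ r , ∈-++⁺ʳ (map H∷_ (lift p)) (∈-map⁺ D∷_ r∈) , b′
    tail : ∀ {h′} (q : Path h′ (suc n)) → suc h < h′ → Below (D∷ p) q →
      (∃ λ r → r ∈ [] × Below r q) ⊎ (∃ λ r → r ∈ ups (D∷ p) × Below r q)
    tail (U∷ q′) h<h′ b =
      let r , r∈ , b′ = extend q′ (ℕ.<-trans (ℕ.n<1+n h) (ℕ.m<n⇒m<1+n h<h′)) (b ∘ suc) in
      inj₂ (r , r∈ , λ { zero → ℕ.<⇒≤ h<h′ ; (suc k) → b′ k })
    tail (H∷ q′) h<h′ b =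
      let r , r∈ , b′ = extend q′ (ℕ.<-trans (ℕ.n<1+n h) h<h′) (b ∘ suc) in
      inj₂ (r , r∈ , λ { zero → ℕ.<⇒≤ h<h′ ; (suc k) → b′ k })
    tail (D∷ q′) h<h′ b =
      let r , r∈ , b′ = extend q′ (ℕ.≤-pred h<h′) (b ∘ suc) in
      inj₂ (r , r∈ , λ { zero → ℕ.<⇒≤ h<h′ ; (suc k) → b′ k })

  -- While the first steps agree, the recursion follows them; once they differ, the rest of `q`
  -- starts strictly above the rest of `p`, and `raise-strict` finds a vertex.
  raise : ∀ {h n} (p q : Path h n) → p ⊑ᴹ q → p ≡ q ⊎ (∃ λ r → r ∈ ups p × r ⊑ᴹ q)
  raise []     []     b = inj₁ refl
  raise (U∷ p) (U∷ q) b with raise p q (b ∘ suc)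
  ... | inj₁ refl          = inj₁ refl
  ... | inj₂ (r , r∈ , b′) = inj₂ (U∷ r , ∈-map⁺ U∷_ r∈ , λ { zero → ℕ.≤-refl ; (suc k) → b′ k })
  raise (U∷ p) (H∷ q) b = contradiction (b (suc zero)) ℕ.1+n≰n
  raise (U∷ p) (D∷ q) b = contradiction (ℕ.<⇒≤ (b (suc zero))) ℕ.1+n≰n
  raise (H∷ p) (U∷ q) b with raise-strict p q (ℕ.n<1+n _) (b ∘ suc)
  ... | inj₁ (r , r∈ , b′) = inj₂ (U∷ r , ∈-++⁺ˡ (∈-map⁺ U∷_ r∈) , λ { zero → ℕ.≤-refl ; (suc k) → b′ k })
  ... | inj₂ (r , r∈ , b′) = inj₂ (H∷ r , ∈-++⁺ʳ (map U∷_ (lift p)) (∈-map⁺ H∷_ r∈) , λ { zero → ℕ.≤-refl ; (suc k) → b′ k })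
  raise (H∷ p) (H∷ q) b with raise p q (b ∘ suc)
  ... | inj₁ refl          = inj₁ refl
  ... | inj₂ (r , r∈ , b′) = inj₂ (H∷ r , ∈-++⁺ʳ (map U∷_ (lift p)) (∈-map⁺ H∷_ r∈) , λ { zero → ℕ.≤-refl ; (suc k) → b′ k })
  raise (H∷ p) (D∷ q) b = contradiction (b (suc zero)) ℕ.1+n≰n
  raise (D∷ p) (U∷ q) b with raise-strict p q (ℕ.m<n⇒m<1+n (ℕ.n<1+n _)) (b ∘ suc)
  ... | inj₁ (r , r∈ , b′) = inj₂ (H∷ r , ∈-++⁺ˡ (∈-map⁺ H∷_ r∈) , λ { zero → ℕ.≤-refl ; (suc k) → b′ k })
  ... | inj₂ (r , r∈ , b′) = inj₂ (D∷ r , ∈-++⁺ʳ (map H∷_ (lift p)) (∈-map⁺ D∷_ r∈) , λ { zero → ℕ.≤-refl ; (suc k) → b′ k })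
  raise (D∷ p) (H∷ q) b with raise-strict p q (ℕ.n<1+n _) (b ∘ suc)
  ... | inj₁ (r , r∈ , b′) = inj₂ (H∷ r , ∈-++⁺ˡ (∈-map⁺ H∷_ r∈) , λ { zero → ℕ.≤-refl ; (suc k) → b′ k })
  ... | inj₂ (r , r∈ , b′) = inj₂ (D∷ r , ∈-++⁺ʳ (map H∷_ (lift p)) (∈-map⁺ D∷_ r∈) , λ { zero → ℕ.≤-refl ; (suc k) → b′ k })
  raise (D∷ p) (D∷ q) b with raise p q (b ∘ suc)
  ... | inj₁ refl          = inj₁ refl
  ... | inj₂ (r , r∈ , b′) = inj₂ (D∷ r , ∈-++⁺ʳ (map H∷_ (lift p)) (∈-map⁺ D∷_ r∈) , λ { zero → ℕ.≤-refl ; (suc k) → b′ k })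

  lift-unique : ∀ {h n} (p : Path h n) → Unique (lift p)
  lift-unique []     = []
  lift-unique (U∷ p) = [] ∷ []
  lift-unique (H∷ p) = [] ∷ []
  lift-unique (D∷ p) = []

  ups-unique : ∀ {h n} (p : Path h n) → Unique (ups p)
  ups-unique []     = []
  ups-unique (U∷ p) = Unique.map⁺ (λ { refl → refl }) (ups-unique p)
  ups-unique (H∷ p) = Unique.++⁺ (Unique.map⁺ (λ { refl → refl }) (lift-unique p))
    (Unique.map⁺ (λ { refl → refl }) (ups-unique p)) disj
    where
    disj : ∀ {r} → r ∈ map U∷_ (lift p) × r ∈ map H∷_ (ups p) → ⊥
    disj (a , b) with ∈-map⁻ U∷_ a | ∈-map⁻ H∷_ b
    ... | _ , _ , refl | _ , _ , ()
  ups-unique (D∷ p) = Unique.++⁺ (Unique.map⁺ (λ { refl → refl }) (lift-unique p))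
    (Unique.map⁺ (λ { refl → refl }) (ups-unique p)) disj
    where
    disj : ∀ {r} → r ∈ map H∷_ (lift p) × r ∈ map D∷_ (ups p) → ⊥
    disj (a , b) with ∈-map⁻ H∷_ a | ∈-map⁻ D∷_ b
    ... | _ , _ , refl | _ , _ , ()

  module _ {n : ℕ} where
    open FinitePoset (𝓜 n) using (_⊏_; _⋖_; _⋖?_)

    area-strict : ∀ {p q} → p ⊏ q → area p < area q
    area-strict {p} {q} (p⊑q , p≢q) = ℕ.≰⇒> λ q≤p →
      p≢q (height-injective p q (sum-injective p⊑q q≤p))

    ups⇒⋖ : ∀ {p r} → r ∈ ups p → p ⋖ r
    ups⇒⋖ {p} {r} r∈ with ups-above p r∈
    ... | area-r , p⊑r =
      (p⊑r , λ { refl → contradiction (sym area-r) ℕ.1+n≢n }) ,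
      λ { (z , p⊏z , z⊏r) → ℕ.1+n≰n (ℕ.<-≤-trans (ℕ.≤-<-trans (area-strict p⊏z) (area-strict z⊏r)) (ℕ.≤-reflexive area-r)) }

    -- By `raise`, some move of `p` lies below `q`; since nothing fits strictly between `p` and `q`,
    -- that move is `q` itself.
    ⋖⇒ups : ∀ {p q} → p ⋖ q → q ∈ ups p
    ⋖⇒ups {p} {q} ((p⊑q , p≢q) , none) with raise p q p⊑q
    ... | inj₁ p≡q = contradiction p≡q p≢q
    ... | inj₂ (r , r∈ , r⊑q) with FinitePoset._≟_ (𝓜 n) r q
    ...   | yes refl = r∈
    ...   | no r≢q   = contradiction (r , proj₁ (ups⇒⋖ r∈) , r⊑q , r≢q) none

    -- Two duplicate-free lists with the same members are permutations of each other, so the filter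
    -- in the definition of `ℓ` can be traded for the explicit list of moves.
    upper-covers : ∀ p → length (filter (p ⋖?_) (paths 0 n)) ≡ length (ups p)
    upper-covers p = ↭-length (∼bag⇒↭ (unique∧set⇒bag
      (Unique.filter⁺ (p ⋖?_) (paths-unique 0 n)) (ups-unique p)
      (mk⇔ (λ q∈ → ⋖⇒ups (proj₂ (∈-filter⁻ (p ⋖?_) {xs = paths 0 n} q∈)))
           (λ q∈ → ∈-filter⁺ (p ⋖?_) (∈-paths _) (ups⇒⋖ q∈)))))

  length-filter-map : ∀ {A B : Set} {P : B → Set} (P? : Decidable P) (f : A → B) xs →
    length (filter P? (map f xs)) ≡ length (filter (P? ∘ f) xs)
  length-filter-map P? f []       = refl
  length-filter-map P? f (x ∷ xs) with does (P? (f x))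
  ... | true  = cong suc (length-filter-map P? f xs)
  ... | false = length-filter-map P? f xs

  length-filter-product : ∀ {A B : Set} {R : A → B → Set} (R? : ∀ x y → Dec (R x y)) xs ys →
    length (filter (uncurry R?) (cartesianProduct xs ys)) ≡ ListAction.sum (map (λ x → length (filter (R? x) ys)) xs)
  length-filter-product R? []       ys = refl
  length-filter-product R? (x ∷ xs) ys = trans
    (cong length (List.filter-++ (uncurry R?) (map (x ,_) ys) (cartesianProduct xs ys)))
    (trans (List.length-++ (filter (uncurry R?) (map (x ,_) ys)))
      (cong₂ _+_ (length-filter-map (uncurry R?) (x ,_) ys) (length-filter-product R? xs ys)))

  total : ∀ {A : Set} → (A → ℕ) → List A → ℕ
  total f xs = ListAction.sum (map f xs)

  total-++ : ∀ {A : Set} (f : A → ℕ) xs ys → total f (xs ++ ys) ≡ total f xs + total f ys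
  total-++ f xs ys = trans (cong ListAction.sum (List.map-++ f xs ys)) (ListAction.sum-++ (map f xs) (map f ys))

  total-map : ∀ {A B : Set} (f : B → ℕ) (g : A → B) xs → total f (map g xs) ≡ total (f ∘ g) xs
  total-map f g xs = cong ListAction.sum (sym (List.map-∘ xs))

  total-cong : ∀ {A : Set} {f g : A → ℕ} → f ≗ g → total f ≗ total g
  total-cong f≗g xs = cong ListAction.sum (List.map-cong f≗g xs)

  total-+ : ∀ {A : Set} (f g : A → ℕ) xs → total (λ x → f x + g x) xs ≡ total f xs + total g xs
  total-+ f g []       = refl
  total-+ f g (x ∷ xs) rewrite total-+ f g xs = interchange (f x) (g x) (total f xs) (total g xs)
    where
    interchange : ∀ a b c d → a + b + (c + d) ≡ a + c + (b + d)
    interchange = solve-∀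

  total-length : ∀ {A : Set} (xs : List A) → total (λ _ → 1) xs ≡ length xs
  total-length []       = refl
  total-length (x ∷ xs) = cong suc (total-length xs)

  N liftCount edgeCount : ℕ → ℕ → ℕ
  N         h n = length (paths h n)
  liftCount h n = total (length ∘ lift) (paths h n)
  edgeCount h n = total (length ∘ ups) (paths h n)

  ℓ≡edgeCount : ∀ n → ℓ (𝓜 n) ≡ edgeCount 0 n
  ℓ≡edgeCount n = trans
    (length-filter-product (FinitePoset._⋖?_ (𝓜 n)) (paths 0 n) (paths 0 n))
    (total-cong upper-covers (paths 0 n))

  total-paths : ∀ {h n} (f : Path h (suc n) → ℕ) → total f (paths h (suc n)) ≡
    total (f ∘ U∷_) (paths (suc h) n) + (total (f ∘ H∷_) (paths h n) + total f (downs h n))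
  total-paths {h} {n} f = trans (total-++ f (map U∷_ (paths (suc h) n)) _)
    (cong₂ _+_ (total-map f U∷_ (paths (suc h) n)) (trans (total-++ f (map H∷_ (paths h n)) _)
      (cong (_+ total f (downs h n)) (total-map f H∷_ (paths h n)))))

  N-zero : ∀ n → N 0 (suc n) ≡ N 1 n + N 0 n
  N-zero n = trans (sym (total-length (paths 0 (suc n)))) (trans (total-paths {0} {n} (λ _ → 1))
    (cong₂ _+_ (total-length (paths 1 n)) (trans (ℕ.+-identityʳ _) (total-length (paths 0 n)))))

  N-suc : ∀ h n → N (suc h) (suc n) ≡ N (suc (suc h)) n + (N (suc h) n + N h n)
  N-suc h n = trans (sym (total-length (paths (suc h) (suc n)))) (trans (total-paths {suc h} {n} (λ _ → 1))
    (cong₂ _+_ (total-length (paths (suc (suc h)) n)) (cong₂ _+_ (total-length (paths (suc h) n))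
      (trans (total-map (λ _ → 1) D∷_ (paths h n)) (total-length (paths h n))))))

  total-zero : ∀ {A : Set} (xs : List A) → total (λ _ → 0) xs ≡ 0
  total-zero []       = refl
  total-zero (x ∷ xs) = total-zero xs

  -- The initial vertex can be raised exactly when the first step is not down.
  liftCount-suc : ∀ h n → liftCount h (suc n) ≡ N (suc h) n + N h n
  liftCount-suc h n = trans (total-paths {h} {n} (length ∘ lift)) (cong₂ _+_ (total-length (paths (suc h) n))
    (trans (cong₂ _+_ (total-length (paths h n)) (d h)) (ℕ.+-identityʳ _)))
    where
    d : ∀ h → total (length ∘ lift) (downs h n) ≡ 0
    d zero    = refl
    d (suc h) = trans (total-map (length ∘ lift) D∷_ (paths h n)) (total-zero (paths h n))

  total-lift+ups : ∀ {h n} (xs : List (Path h n)) →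
    total (λ p → length (lift p) + length (ups p)) xs ≡ total (length ∘ lift) xs + total (length ∘ ups) xs
  total-lift+ups = total-+ (length ∘ lift) (length ∘ ups)

  edgeCount-zero : ∀ n → edgeCount 0 (suc n) ≡ edgeCount 1 n + (liftCount 0 n + edgeCount 0 n)
  edgeCount-zero n = trans (total-paths {0} {n} (length ∘ ups)) (cong₂ _+_
    (total-cong (λ p → List.length-map U∷_ (ups p)) (paths 1 n))
    (trans (ℕ.+-identityʳ _) (trans (total-cong (λ p → trans (List.length-++ (map U∷_ (lift p)))
        (cong₂ _+_ (List.length-map U∷_ (lift p)) (List.length-map H∷_ (ups p)))) (paths 0 n))
      (total-lift+ups (paths 0 n)))))

  edgeCount-suc : ∀ h n → edgeCount (suc h) (suc n) ≡
    edgeCount (suc (suc h)) n + (liftCount (suc h) n + edgeCount (suc h) n + (liftCount h n + edgeCount h n))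
  edgeCount-suc h n = trans (total-paths {suc h} {n} (length ∘ ups)) (cong₂ _+_
    (total-cong (λ p → List.length-map U∷_ (ups p)) (paths (suc (suc h)) n))
    (cong₂ _+_
      (trans (total-cong (λ p → trans (List.length-++ (map U∷_ (lift p)))
          (cong₂ _+_ (List.length-map U∷_ (lift p)) (List.length-map H∷_ (ups p)))) (paths (suc h) n))
        (total-lift+ups (paths (suc h) n)))
      (trans (total-map (length ∘ ups) D∷_ (paths h n)) (trans (total-cong (λ p → trans (List.length-++ (map H∷_ (lift p)))
          (cong₂ _+_ (List.length-map H∷_ (lift p)) (List.length-map D∷_ (ups p)))) (paths h n))
        (total-lift+ups (paths h n))))))

  -- This is `n * (N h (n - 1) + N h n)`; the case split avoids the length -1 at `n = 0`.
  edgeSum : ℕ → ℕ → ℕ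
  edgeSum zero    h = 0
  edgeSum (suc n) h = suc n * (N h n + N h (suc n))

  edgeSum-zero : ∀ n → edgeSum n 1 + edgeSum n 0 ≡ n * (N 0 n + N 0 (suc n))
  edgeSum-zero zero    = refl
  edgeSum-zero (suc n) rewrite N-zero (suc n) | N-zero n = lemma n (N 1 n) (N 1 (suc n)) (N 0 n)
    where
    lemma : ∀ n a b c → suc n * (a + b) + suc n * (c + (a + c)) ≡ suc n * (a + c + (b + (a + c)))
    lemma = solve-∀

  edgeSum-suc : ∀ n h → edgeSum n (suc (suc h)) + (edgeSum n (suc h) + edgeSum n h) ≡
    n * (N (suc h) n + N (suc h) (suc n))
  edgeSum-suc zero    h = refl
  edgeSum-suc (suc n) h rewrite N-suc h (suc n) | N-suc h n =
    lemma n (N (suc (suc h)) n) (N (suc (suc h)) (suc n)) (N (suc h) n) (N h n) (N h (suc n))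
    where
    lemma : ∀ n a b c d e → suc n * (a + b) + (suc n * (c + (a + (c + d))) + suc n * (d + e)) ≡
      suc n * (a + (c + d) + (b + (a + (c + d) + e)))
    lemma = solve-∀

  -- Merging the two steps that meet at the raised vertex leaves a path of length `n` with a marked
  -- step. A marked up or down step arises in one way (from HU or DH), a marked level step from HH
  -- and, at positive height only, also from DU. This gives `n * N h n`, plus `n * N h (n - 1)` for
  -- a second kind of marked level step, less the marks of that kind at height 0. Raising the part
  -- before such a mark by one and turning the mark into a down step gives a path from `suc h`, the
  -- mark being its first arrival at 0; hence the term `N (suc h) n`. The formula is verified here
  -- by induction on `n`.
  edgeCount+N : ∀ n h → edgeCount h (suc n) + N (suc h) n ≡ edgeSum n h
  edgeCount+N zero    zero    = refl
  edgeCount+N zero    (suc zero) = refl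
  edgeCount+N zero    (suc (suc h)) = refl
  edgeCount+N (suc n) zero    = begin
    edgeCount 0 (suc (suc n)) + N 1 (suc n)
      ≡⟨ cong₂ _+_ (edgeCount-zero (suc n)) (N-suc 0 n) ⟩
    edgeCount 1 (suc n) + (liftCount 0 (suc n) + edgeCount 0 (suc n)) + (N 2 n + (N 1 n + N 0 n))
      ≡⟨ lemma (edgeCount 1 (suc n)) (liftCount 0 (suc n)) (edgeCount 0 (suc n)) (N 2 n) (N 1 n) (N 0 n) ⟩
    edgeCount 1 (suc n) + N 2 n + (edgeCount 0 (suc n) + N 1 n) + (N 0 n + liftCount 0 (suc n))
      ≡⟨ cong₂ _+_ (cong₂ _+_ (edgeCount+N n 1) (edgeCount+N n 0))
                   (cong (N 0 n +_) (trans (liftCount-suc 0 n) (sym (N-zero n)))) ⟩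
    edgeSum n 1 + edgeSum n 0 + (N 0 n + N 0 (suc n))
      ≡⟨ cong (_+ (N 0 n + N 0 (suc n))) (edgeSum-zero n) ⟩
    n * (N 0 n + N 0 (suc n)) + (N 0 n + N 0 (suc n))
      ≡⟨ ℕ.+-comm (n * _) _ ⟩
    suc n * (N 0 n + N 0 (suc n)) ∎
    where
    open ≡-Reasoning
    lemma : ∀ a b c d e f → a + (b + c) + (d + (e + f)) ≡ a + d + (c + e) + (f + b)
    lemma = solve-∀
  edgeCount+N (suc n) (suc h) = begin
    edgeCount (suc h) (suc (suc n)) + N (suc (suc h)) (suc n)
      ≡⟨ cong₂ _+_ (edgeCount-suc h (suc n)) (N-suc (suc h) n) ⟩
    e₂ + (l₁ + e₁ + (l₀ + e₀)) + (N (suc (suc (suc h))) n + (N (suc (suc h)) n + N (suc h) n))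
      ≡⟨ cong₂ (λ x y → e₂ + (x + e₁ + (y + e₀)) + (N (suc (suc (suc h))) n + (N (suc (suc h)) n + N (suc h) n)))
               (liftCount-suc (suc h) n) (liftCount-suc h n) ⟩
    e₂ + (N (suc (suc h)) n + N (suc h) n + e₁ + (N (suc h) n + N h n + e₀)) + (N (suc (suc (suc h))) n + (N (suc (suc h)) n + N (suc h) n))
      ≡⟨ lemma e₂ e₁ e₀ (N (suc (suc (suc h))) n) (N (suc (suc h)) n) (N (suc h) n) (N h n) ⟩
    e₂ + N (suc (suc (suc h))) n + (e₁ + N (suc (suc h)) n + (e₀ + N (suc h) n))
      + (N (suc h) n + (N (suc (suc h)) n + (N (suc h) n + N h n)))
      ≡⟨ cong₂ _+_ (cong₂ _+_ (edgeCount+N n (suc (suc h))) (cong₂ _+_ (edgeCount+N n (suc h)) (edgeCount+N n h)))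
                   (cong (N (suc h) n +_) (sym (N-suc h n))) ⟩
    edgeSum n (suc (suc h)) + (edgeSum n (suc h) + edgeSum n h) + (N (suc h) n + N (suc h) (suc n))
      ≡⟨ cong (_+ (N (suc h) n + N (suc h) (suc n))) (edgeSum-suc n h) ⟩
    n * (N (suc h) n + N (suc h) (suc n)) + (N (suc h) n + N (suc h) (suc n))
      ≡⟨ ℕ.+-comm (n * _) _ ⟩
    suc n * (N (suc h) n + N (suc h) (suc n)) ∎
    where
    open ≡-Reasoning
    e₂ = edgeCount (suc (suc h)) (suc n)
    e₁ = edgeCount (suc h) (suc n)
    e₀ = edgeCount h (suc n)
    l₁ = liftCount (suc h) (suc n)
    l₀ = liftCount h (suc n)
    lemma : ∀ a b c d e f g → a + (e + f + b + (f + g + c)) + (d + (e + f)) ≡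
      a + d + (b + e + (c + f)) + (f + (e + (f + g)))
    lemma = solve-∀

-- Trinomial coefficients: ballot identity, edge numbers and the recurrence of `e`.

module Trinomials where
  open import Data.Nat.Base using (_+_; _*_)
  open Covers using (N; N-zero; N-suc; edgeCount; edgeCount+N)

  -- τ n j is the coefficient of x^j in (x⁻¹ + 1 + x)^n, which is even in j.
  τ : ℕ → ℕ → ℕ
  τ zero    zero    = 1
  τ zero    (suc j) = 0
  τ (suc n) zero    = τ n 0 + (τ n 1 + τ n 1)
  τ (suc n) (suc j) = τ n j + (τ n (suc j) + τ n (suc (suc j)))

  -- the reflection principle
  N+τ : ∀ n h → N h n + τ n (suc (suc h)) ≡ τ n h
  N+τ zero    zero    = refl
  N+τ zero    (suc h) = refl
  N+τ (suc n) zero    = begin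
    N 0 (suc n) + (τ n 1 + (τ n 2 + τ n 3))    ≡⟨ cong (_+ (τ n 1 + (τ n 2 + τ n 3))) (N-zero n) ⟩
    N 1 n + N 0 n + (τ n 1 + (τ n 2 + τ n 3))  ≡⟨ lemma (N 1 n) (N 0 n) (τ n 1) (τ n 2) (τ n 3) ⟩
    N 0 n + τ n 2 + (N 1 n + τ n 3 + τ n 1)    ≡⟨ cong₂ (λ x y → x + (y + τ n 1)) (N+τ n 0) (N+τ n 1) ⟩
    τ n 0 + (τ n 1 + τ n 1)                    ∎
    where
    open ≡-Reasoning
    lemma : ∀ a b c d e → a + b + (c + (d + e)) ≡ b + d + (a + e + c)
    lemma = solve-∀
  N+τ (suc n) (suc h) = begin
    N (suc h) (suc n) + (τ n (2 + h) + (τ n (3 + h) + τ n (4 + h)))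
      ≡⟨ cong (_+ (τ n (2 + h) + (τ n (3 + h) + τ n (4 + h)))) (N-suc h n) ⟩
    N (2 + h) n + (N (1 + h) n + N h n) + (τ n (2 + h) + (τ n (3 + h) + τ n (4 + h)))
      ≡⟨ lemma (N (2 + h) n) (N (1 + h) n) (N h n) (τ n (2 + h)) (τ n (3 + h)) (τ n (4 + h)) ⟩
    N h n + τ n (2 + h) + (N (1 + h) n + τ n (3 + h) + (N (2 + h) n + τ n (4 + h)))
      ≡⟨ cong₂ _+_ (N+τ n h) (cong₂ _+_ (N+τ n (suc h)) (N+τ n (2 + h))) ⟩
    τ n h + (τ n (suc h) + τ n (2 + h)) ∎
    where
    open ≡-Reasoning
    lemma : ∀ a b c d e f → a + (b + c) + (d + (e + f)) ≡ c + d + (b + e + (a + f))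
    lemma = solve-∀

  -- The cycle lemma: of the `suc n` rotations of a step sequence with sum -(h + 1), exactly `suc h`
  -- reach that sum for the first time at their last step, and deleting this down step leaves the
  -- paths counted by `N h n`. The induction needs only the reflection principle and the recursions
  -- of `τ` and `N`.
  ballot : ∀ n h → suc h * τ (suc n) (suc h) ≡ suc n * N h n
  ballot zero    zero    = refl
  ballot zero    (suc h) = ℕ.*-zeroʳ (suc (suc h))
  ballot (suc n) zero    = begin
    1 * (τ (suc n) 0 + (τ (suc n) 1 + τ (suc n) 2))
      ≡⟨ cong (λ x → 1 * (x + (τ (suc n) 1 + τ (suc n) 2))) (N+τ (suc n) 0) ⟨
    1 * (N 0 (suc n) + τ (suc n) 2 + (τ (suc n) 1 + τ (suc n) 2))
      ≡⟨ lemma (N 0 (suc n)) (τ (suc n) 1) (τ (suc n) 2) ⟩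
    N 0 (suc n) + (2 * τ (suc n) 2 + 1 * τ (suc n) 1)
      ≡⟨ cong (N 0 (suc n) +_) (cong₂ _+_ (ballot n 1) (ballot n 0)) ⟩
    N 0 (suc n) + (suc n * N 1 n + suc n * N 0 n)
      ≡⟨ cong (N 0 (suc n) +_) (trans (cong (suc n *_) (N-zero n)) (ℕ.*-distribˡ-+ (suc n) (N 1 n) (N 0 n))) ⟨
    suc (suc n) * N 0 (suc n) ∎
    where
    open ≡-Reasoning
    lemma : ∀ a b c → 1 * (a + c + (b + c)) ≡ a + (2 * c + 1 * b)
    lemma = solve-∀
  ballot (suc n) (suc h) = begin
    (2 + h) * (t₀ + (t₁ + t₂))
      -- The induction hypotheses want the weights 1 + h, 2 + h, 3 + h on `t₀`, `t₁`, `t₂`. Moving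
      -- one unit of weight from `t₀` to `t₂` costs `t₀` - `t₂`, which is `N (suc h) (suc n)` by
      -- reflection.
      ≡⟨ cong (λ x → (2 + h) * (x + (t₁ + t₂))) (N+τ (suc n) (suc h)) ⟨
    (2 + h) * (N (suc h) (suc n) + τ (suc n) (3 + h) + (t₁ + t₂))
      ≡⟨ lemma h (N (suc h) (suc n)) t₁ t₂ ⟩
    N (suc h) (suc n) + ((3 + h) * t₂ + ((2 + h) * t₁ + (1 + h) * (N (suc h) (suc n) + τ (suc n) (3 + h))))
      ≡⟨ cong (λ x → N (suc h) (suc n) + ((3 + h) * t₂ + ((2 + h) * t₁ + (1 + h) * x))) (N+τ (suc n) (suc h)) ⟩
    N (suc h) (suc n) + ((3 + h) * t₂ + ((2 + h) * t₁ + (1 + h) * t₀))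
      ≡⟨ cong (N (suc h) (suc n) +_) (cong₂ _+_ (ballot n (2 + h)) (cong₂ _+_ (ballot n (suc h)) (ballot n h))) ⟩
    N (suc h) (suc n) + (suc n * N (2 + h) n + (suc n * N (suc h) n + suc n * N h n))
      ≡⟨ cong (N (suc h) (suc n) +_) (trans (cong (suc n *_) (N-suc h n)) (distrib (suc n) (N (2 + h) n) (N (suc h) n) (N h n))) ⟨
    suc (suc n) * N (suc h) (suc n) ∎
    where
    open ≡-Reasoning
    t₀ = τ (suc n) (1 + h)
    t₁ = τ (suc n) (2 + h)
    t₂ = τ (suc n) (3 + h)
    lemma : ∀ h a b c → (2 + h) * (a + c + (b + c)) ≡ a + ((3 + h) * c + ((2 + h) * b + (1 + h) * (a + c)))
    lemma = solve-∀
    distrib : ∀ m a b c → m * (a + (b + c)) ≡ m * a + (m * b + m * c)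
    distrib = solve-∀

  ballot₀ : ∀ n → τ (suc n) 1 ≡ suc n * N 0 n
  ballot₀ n = trans (sym (ℕ.*-identityˡ _)) (ballot n 0)

  -- The ballot identity at height 0 absorbs the factors in `edgeCount+N` into trinomial
  -- coefficients. The quantity added to both sides is `τ (suc (suc n)) 0`, split by reflection and
  -- by the first step.
  edgeCount≡τ : ∀ n → edgeCount 0 (suc n) ≡ τ (suc n) 2 + τ n 2
  edgeCount≡τ zero    = refl
  edgeCount≡τ (suc n) = ℕ.+-cancelʳ-≡ (N 1 (suc n) + N 0 (suc n) + t) _ _ (begin
    c + (N 1 (suc n) + N 0 (suc n) + t)
      ≡⟨ lemma₁ c (N 1 (suc n)) (N 0 (suc n)) t ⟩
    c + N 1 (suc n) + N 0 (suc n) + t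
      ≡⟨ cong (λ x → x + N 0 (suc n) + t) (edgeCount+N (suc n) 0) ⟩
    suc n * (N 0 n + N 0 (suc n)) + N 0 (suc n) + t
      ≡⟨ lemma₂ (suc n) (N 0 n) (N 0 (suc n)) t ⟩
    suc n * N 0 n + suc (suc n) * N 0 (suc n) + t
      ≡⟨ cong₂ (λ x y → x + y + t) (ballot₀ n) (ballot₀ (suc n)) ⟨
    t₁ + (t₀ + (t₁ + t₂)) + t
      ≡⟨ lemma₃ t₀ t₁ t₂ t ⟩
    t + t₂ + τ (suc (suc n)) 0
      ≡⟨ cong (t + t₂ +_) (trans (sym (N+τ (suc (suc n)) 0)) (cong (_+ t) (N-zero (suc n)))) ⟩
    t + t₂ + (N 1 (suc n) + N 0 (suc n) + t) ∎)
    where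
    open ≡-Reasoning
    c = edgeCount 0 (suc (suc n))
    t = τ (suc (suc n)) 2
    t₀ = τ (suc n) 0
    t₁ = τ (suc n) 1
    t₂ = τ (suc n) 2
    lemma₁ : ∀ a b c d → a + (b + c + d) ≡ a + b + c + d
    lemma₁ = solve-∀
    lemma₂ : ∀ n a b c → n * (a + b) + b + c ≡ n * a + (suc n) * b + c
    lemma₂ = solve-∀
    lemma₃ : ∀ a b c d → b + (a + (b + c)) + d ≡ d + c + (a + (b + b))
    lemma₃ = solve-∀

  e : ℕ → ℕ
  e zero    = 1
  e (suc n) = τ (suc n) 0 + τ n 0

  -- A coefficient of (1 - 3x) ∑ e(n) x^n = 1 - x - 2x² ∑ M_n x^n, where both sides are √(1 - 2x -
  -- 3x²).
  2N+e : ∀ n → 2 * N 0 n + e (2 + n) ≡ 3 * e (1 + n)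
  2N+e n = lemma (N 0 n) (τ n 1) (τ n 2) (N+τ n 0)
    where
    lemma : ∀ m t₁ t₂ {t₀} → m + t₂ ≡ t₀ →
      2 * m + (t₀ + (t₁ + t₁) + (t₀ + (t₁ + t₂) + (t₀ + (t₁ + t₂))) + (t₀ + (t₁ + t₁))) ≡ 3 * (t₀ + (t₁ + t₁) + t₀)
    lemma m t₁ t₂ refl = expanded m t₁ t₂
      where
      expanded : ∀ m t₁ t₂ → let t₀ = m + t₂ in
        2 * m + (t₀ + (t₁ + t₁) + (t₀ + (t₁ + t₂) + (t₀ + (t₁ + t₂))) + (t₀ + (t₁ + t₁))) ≡ 3 * (t₀ + (t₁ + t₁) + t₀)
      expanded = solve-∀

  -- Coefficientwise, the differential equation (1 + x) (1 - 3x) y′ = 2y of y = √((1 + x) / (1 -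
  -- 3x)). It follows from `2N+e` at two consecutive lengths, with the Motzkin numbers eliminated by
  -- `e-diff`.
  e-rec : ∀ n → (2 + n) * e (2 + n) ≡ 2 * (2 + n) * e (1 + n) + 3 * n * e n
  e-rec zero    = refl
  e-rec (suc n) = ℕ.+-cancelʳ-≡ (e (2 + n) + (suc n * (2 * N 0 n) + (2 + n) * (2 * N 0 (suc n)) + suc n * e (2 + n))) _ _ (begin
    (3 + n) * e (3 + n) + (e (2 + n) + (suc n * (2 * m₀) + (2 + n) * (2 * m₁) + suc n * e (2 + n)))
      ≡⟨ lemma₁ n (e (3 + n)) (e (2 + n)) m₀ m₁ ⟩
    (2 + n) * (2 * m₁ + e (3 + n)) + suc n * (2 * m₀ + e (2 + n)) + (e (3 + n) + e (2 + n))
      ≡⟨ cong₂ (λ x y → (2 + n) * x + suc n * y + (e (3 + n) + e (2 + n))) (2N+e (suc n)) (2N+e n) ⟩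
    (2 + n) * (3 * e (2 + n)) + suc n * (3 * e (1 + n)) + (e (3 + n) + e (2 + n))
      ≡⟨ cong (λ x → (2 + n) * (3 * e (2 + n)) + suc n * (3 * e (1 + n)) + (x + e (2 + n))) e-diff ⟩
    (2 + n) * (3 * e (2 + n)) + suc n * (3 * e (1 + n)) + (e (2 + n) + 2 * (suc n * m₀) + 2 * (suc (suc n) * m₁) + e (2 + n))
      ≡⟨ lemma₂ n (e (2 + n)) (e (1 + n)) m₀ m₁ ⟩
    2 * (3 + n) * e (2 + n) + 3 * suc n * e (suc n) + (e (2 + n) + (suc n * (2 * m₀) + (2 + n) * (2 * m₁) + suc n * e (2 + n))) ∎)
    where
    open ≡-Reasoning
    m₀ = N 0 n
    m₁ = N 0 (suc n)
    e-diff : e (3 + n) ≡ e (2 + n) + 2 * (suc n * m₀) + 2 * (suc (suc n) * m₁)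
    e-diff = trans (lemma (τ (suc n) 0) (τ (suc n) 1) (τ (suc n) 2))
      (cong₂ (λ x y → e (2 + n) + 2 * x + 2 * y) (ballot₀ n) (ballot₀ (suc n)))
      where
      lemma : ∀ t₀ t₁ t₂ → t₀ + (t₁ + t₁) + (t₀ + (t₁ + t₂) + (t₀ + (t₁ + t₂))) + (t₀ + (t₁ + t₁)) ≡
        t₀ + (t₁ + t₁) + t₀ + 2 * t₁ + 2 * (t₀ + (t₁ + t₂))
      lemma = solve-∀
    lemma₁ : ∀ n e₃ e₂ m₀ m₁ → (3 + n) * e₃ + (e₂ + (suc n * (2 * m₀) + (2 + n) * (2 * m₁) + suc n * e₂)) ≡
      (2 + n) * (2 * m₁ + e₃) + suc n * (2 * m₀ + e₂) + (e₃ + e₂)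
    lemma₁ = solve-∀
    lemma₂ : ∀ n e₂ e₁ m₀ m₁ → (2 + n) * (3 * e₂) + suc n * (3 * e₁) + (e₂ + 2 * (suc n * m₀) + 2 * (suc (suc n) * m₁) + e₂) ≡
      2 * (3 + n) * e₂ + 3 * suc n * e₁ + (e₂ + (suc n * (2 * m₀) + (2 + n) * (2 * m₁) + suc n * e₂))
    lemma₂ = solve-∀

-- Convolution of counting sequences and the first-passage decomposition.

module Convolution where
  open import Data.Nat.Base using (_+_; _*_; _∸_)
  open Covers using (N; N-zero; N-suc)

  conv : (ℕ → ℕ) → (ℕ → ℕ) → ℕ → ℕ
  conv f g zero    = f 0 * g 0
  conv f g (suc n) = f 0 * g (suc n) + conv (f ∘ suc) g n

  conv-congˡ : ∀ {f f′} g n → f ≗ f′ → conv f g n ≡ conv f′ g n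
  conv-congˡ g zero    f≗ = cong (_* g 0) (f≗ 0)
  conv-congˡ g (suc n) f≗ = cong₂ _+_ (cong (_* g (suc n)) (f≗ 0)) (conv-congˡ g n (f≗ ∘ suc))

  conv-distribʳ : ∀ f f′ g n → conv (λ k → f k + f′ k) g n ≡ conv f g n + conv f′ g n
  conv-distribʳ f f′ g zero    = ℕ.*-distribʳ-+ (g 0) (f 0) (f′ 0)
  conv-distribʳ f f′ g (suc n) =
    trans (cong ((f 0 + f′ 0) * g (suc n) +_) (conv-distribʳ (f ∘ suc) (f′ ∘ suc) g n))
          (lemma (f 0) (f′ 0) (g (suc n)) (conv (f ∘ suc) g n) (conv (f′ ∘ suc) g n))
    where
    lemma : ∀ a b c x y → (a + b) * c + (x + y) ≡ a * c + x + (b * c + y)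
    lemma = solve-∀

  conv-sum : ∀ f g n → conv f g n ≡ ∑< (suc n) (λ k → f k * g (n ∸ k))
  conv-sum f g zero    = sym (ℕ.+-identityʳ _)
  conv-sum f g (suc n) = cong (f 0 * g (suc n) +_) (conv-sum (f ∘ suc) g n)

  -- Paths from height h + 1 are cut at their first visit to height 0.
  first-passage : ∀ m h → conv (N h) (N 0) m ≡ N (suc h) (suc m)
  first-passage zero    zero    = refl
  first-passage zero    (suc h) = refl
  first-passage (suc m) zero    = begin
    N 0 (suc m) + 0 + conv (N 0 ∘ suc) (N 0) m
      ≡⟨ cong (N 0 (suc m) + 0 +_) (trans (conv-congˡ (N 0) m N-zero) (conv-distribʳ (N 1) (N 0) (N 0) m)) ⟩
    N 0 (suc m) + 0 + (conv (N 1) (N 0) m + conv (N 0) (N 0) m)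
      ≡⟨ cong₂ (λ x y → N 0 (suc m) + 0 + (x + y)) (first-passage m 1) (first-passage m 0) ⟩
    N 0 (suc m) + 0 + (N 2 (suc m) + N 1 (suc m))
      ≡⟨ lemma (N 0 (suc m)) (N 1 (suc m)) (N 2 (suc m)) ⟩
    N 2 (suc m) + (N 1 (suc m) + N 0 (suc m))
      ≡⟨ N-suc 0 (suc m) ⟨
    N 1 (suc (suc m)) ∎
    where
    open ≡-Reasoning
    lemma : ∀ a b c → a + 0 + (c + b) ≡ c + (b + a)
    lemma = solve-∀
  first-passage (suc m) (suc h) = begin
    conv (N (suc h) ∘ suc) (N 0) m
      ≡⟨ conv-congˡ (N 0) m (N-suc h) ⟩
    conv (λ k → N (2 + h) k + (N (1 + h) k + N h k)) (N 0) m
      ≡⟨ trans (conv-distribʳ (N (2 + h)) (λ k → N (1 + h) k + N h k) (N 0) m)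
               (cong (conv (N (2 + h)) (N 0) m +_) (conv-distribʳ (N (1 + h)) (N h) (N 0) m)) ⟩
    conv (N (2 + h)) (N 0) m + (conv (N (1 + h)) (N 0) m + conv (N h) (N 0) m)
      ≡⟨ cong₂ _+_ (first-passage m (2 + h)) (cong₂ _+_ (first-passage m (1 + h)) (first-passage m h)) ⟩
    N (3 + h) (suc m) + (N (2 + h) (suc m) + N (1 + h) (suc m))
      ≡⟨ N-suc (suc h) (suc m) ⟨
    N (2 + h) (2 + m) ∎
    where open ≡-Reasoning

-- Trinomial coefficients as sums of products of binomial coefficients.

module Binomials where
  open import Data.Nat.Combinatorics using (_C_)
  open import Data.Nat.Base using (_!; _+_; _*_; _∸_; _<_)
  open Trinomials using (τ)

  ∑<-distrib-+ : ∀ n f g → ∑< n (λ k → f k + g k) ≡ ∑< n f + ∑< n g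
  ∑<-distrib-+ zero    f g = refl
  ∑<-distrib-+ (suc n) f g = trans (cong (f 0 + g 0 +_) (∑<-distrib-+ n (f ∘ suc) (g ∘ suc)))
    (lemma (f 0) (g 0) (∑< n (f ∘ suc)) (∑< n (g ∘ suc)))
    where
    lemma : ∀ a b c d → a + b + (c + d) ≡ a + c + (b + d)
    lemma = solve-∀

  ∑<-zero : ∀ n {f} → (∀ k → f k ≡ 0) → ∑< n f ≡ 0
  ∑<-zero zero    f≡0 = refl
  ∑<-zero (suc n) f≡0 = cong₂ _+_ (f≡0 0) (∑<-zero n (f≡0 ∘ suc))

  -- A multinomial coefficient: choose the `s` steps that are not level, then the `d` of them that
  -- go down.
  term : ℕ → ℕ → ℕ → ℕ
  term n s d = (n C s) * (s C d)

  -- The three summands correspond to a last step that is level, up or down.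
  pascal : ∀ n s d → term (suc n) (suc s) (suc d) ≡
    term n (suc s) (suc d) + ((n C s) * (s C suc d) + term n s d)
  pascal n s d = begin
    (suc n C suc s) * (suc s C suc d)
      ≡⟨ cong (_* (suc s C suc d)) (nCk+nC[k+1]≡[n+1]C[k+1] n s) ⟨
    (n C s + n C suc s) * (suc s C suc d)
      ≡⟨ lemma (n C s) (n C suc s) (suc s C suc d) ⟩
    term n (suc s) (suc d) + (n C s) * (suc s C suc d)
      ≡⟨ cong (λ x → term n (suc s) (suc d) + (n C s) * x) (nCk+nC[k+1]≡[n+1]C[k+1] s d) ⟨
    term n (suc s) (suc d) + (n C s) * (s C d + s C suc d)
      ≡⟨ cong (term n (suc s) (suc d) +_) (lemma′ (n C s) (s C d) (s C suc d)) ⟩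
    term n (suc s) (suc d) + ((n C s) * (s C suc d) + term n s d) ∎
    where
    open ≡-Reasoning
    lemma : ∀ a b c → (a + b) * c ≡ b * c + a * c
    lemma = solve-∀
    lemma′ : ∀ a b c → a * (b + c) ≡ a * c + a * b
    lemma′ = solve-∀

  -- the number of sequences of d down, d + j up and n - 2 d - j level steps
  multi : ℕ → ℕ → ℕ → ℕ
  multi n j d = term n (d + (d + j)) d

  double-suc : ∀ d j → d + (d + suc j) ≡ suc (d + (d + j))
  double-suc d j = trans (cong (d +_) (ℕ.+-suc d j)) (ℕ.+-suc d (d + j))

  suc-double : ∀ d j → suc d + (suc d + j) ≡ suc (suc (d + (d + j)))
  suc-double d j = cong suc (ℕ.+-suc d (d + j))

  τ≡0 : ∀ n j → n < j → τ n j ≡ 0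
  τ≡0 zero    (suc j) _         = refl
  τ≡0 (suc n) (suc j) (s≤s n<j) = cong₂ _+_ (τ≡0 n j n<j)
    (cong₂ _+_ (τ≡0 n (suc j) (ℕ.m<n⇒m<1+n n<j)) (τ≡0 n (suc (suc j)) (ℕ.m<n⇒m<1+n (ℕ.m<n⇒m<1+n n<j))))

  -- `τ (suc n) 0` receives `τ n 1` twice, once from either side; this symmetry identifies the two
  -- contributions, which `pascal` tells apart as up and down.
  central-sym : ∀ d → suc (d + (d + 0)) C suc d ≡ suc (d + (d + 0)) C d
  central-sym d = trans (nCk≡nC[n∸k] (s≤s (ℕ.m≤m+n d (d + 0))))
    (cong (suc (d + (d + 0)) C_) (trans (ℕ.m+n∸m≡n d (d + 0)) (ℕ.+-identityʳ d)))

  -- The hypothesis ensures that all omitted summands vanish. A free cutoff `D` lets the induction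
  -- lower it by one where the last step is down and one down step fewer remains.
  τ≡∑ : ∀ n j D → n < D + (D + j) → τ n j ≡ ∑< D (multi n j)
  τ≡∑ zero    zero    (suc D) _ = sym (cong suc (∑<-zero D λ d →
    cong (_* ((suc d + (suc d + 0)) C suc d)) (k>n⇒nCk≡0 {0} {suc d + (suc d + 0)} (s≤s z≤n))))
  τ≡∑ zero    (suc j) D       _ = sym (∑<-zero D λ d →
    cong (_* ((d + (d + suc j)) C d)) (k>n⇒nCk≡0 (subst (0 <_) (sym (double-suc d j)) (s≤s z≤n))))
  τ≡∑ (suc n) j       zero    n<j = τ≡0 (suc n) j n<j
  τ≡∑ (suc n) zero    (suc D) n<D = begin
    τ n 0 + (τ n 1 + τ n 1)
      ≡⟨ cong₂ (λ x y → x + (y + y)) (τ≡∑ n 0 (suc D) (ℕ.<-trans (ℕ.n<1+n n) n<D))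
           (τ≡∑ n 1 D (subst (n <_) (sym (double-suc D 0)) (ℕ.≤-pred (subst (suc n <_) (suc-double D 0) n<D)))) ⟩
    1 + ∑< D (multi n 0 ∘ suc) + (∑< D (multi n 1) + ∑< D (multi n 1))
      ≡⟨ cong (1 + ∑< D (multi n 0 ∘ suc) +_) (∑<-distrib-+ D (multi n 1) (multi n 1)) ⟨
    1 + (∑< D (multi n 0 ∘ suc) + ∑< D (λ d → multi n 1 d + multi n 1 d))
      ≡⟨ cong (1 +_) (∑<-distrib-+ D (multi n 0 ∘ suc) (λ d → multi n 1 d + multi n 1 d)) ⟨
    1 + ∑< D (λ d → multi n 0 (suc d) + (multi n 1 d + multi n 1 d))
      ≡⟨ cong (1 +_) (∑<-cong D (λ d _ → step d)) ⟨
    1 + ∑< D (multi (suc n) 0 ∘ suc) ∎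
    where
    open ≡-Reasoning
    step : ∀ d → multi (suc n) 0 (suc d) ≡ multi n 0 (suc d) + (multi n 1 d + multi n 1 d)
    step d = begin
      term (suc n) (suc d + (suc d + 0)) (suc d)
        ≡⟨ cong (λ s → term (suc n) s (suc d)) (suc-double d 0) ⟩
      term (suc n) (suc (suc (d + (d + 0)))) (suc d)
        ≡⟨ pascal n (suc (d + (d + 0))) d ⟩
      term n (suc (suc (d + (d + 0)))) (suc d) + ((n C suc (d + (d + 0))) * (suc (d + (d + 0)) C suc d) + term n (suc (d + (d + 0))) d)
        ≡⟨ cong (λ x → term n (suc (suc (d + (d + 0)))) (suc d) + ((n C suc (d + (d + 0))) * x + term n (suc (d + (d + 0))) d)) (central-sym d) ⟩
      term n (suc (suc (d + (d + 0)))) (suc d) + (term n (suc (d + (d + 0))) d + term n (suc (d + (d + 0))) d)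
        ≡⟨ cong₂ (λ s s′ → term n s (suc d) + (term n s′ d + term n s′ d)) (suc-double d 0) (double-suc d 0) ⟨
      multi n 0 (suc d) + (multi n 1 d + multi n 1 d) ∎
  τ≡∑ (suc n) (suc j) (suc D) n<D = begin
    τ n j + (τ n (suc j) + τ n (suc (suc j)))
      ≡⟨ cong₂ _+_ (τ≡∑ n j (suc D) n<D+D+j) (cong₂ _+_ (τ≡∑ n (suc j) (suc D) (ℕ.<-trans (ℕ.n<1+n n) n<D))
           (τ≡∑ n (2 + j) D (subst (n <_) (trans (suc-double D j) (sym (trans (double-suc D (suc j)) (cong suc (double-suc D j))))) n<D+D+j))) ⟩
    multi n j 0 + ∑< D (multi n j ∘ suc) + (multi n (suc j) 0 + ∑< D (multi n (suc j) ∘ suc) + ∑< D (multi n (2 + j)))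
      ≡⟨ lemma (multi n j 0) (∑< D (multi n j ∘ suc)) (multi n (suc j) 0) (∑< D (multi n (suc j) ∘ suc)) (∑< D (multi n (2 + j))) ⟩
    multi n j 0 + multi n (suc j) 0 + (∑< D (multi n j ∘ suc) + (∑< D (multi n (suc j) ∘ suc) + ∑< D (multi n (2 + j))))
      ≡⟨ cong₂ _+_ (sym step₀) (sym (trans (∑<-distrib-+ D (multi n j ∘ suc) _)
           (cong (∑< D (multi n j ∘ suc) +_) (∑<-distrib-+ D (multi n (suc j) ∘ suc) (multi n (2 + j)))))) ⟩
    multi (suc n) (suc j) 0 + ∑< D (λ d → multi n j (suc d) + (multi n (suc j) (suc d) + multi n (2 + j) d))
      ≡⟨ cong (multi (suc n) (suc j) 0 +_) (∑<-cong D (λ d _ → step d)) ⟨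
    multi (suc n) (suc j) 0 + ∑< D (multi (suc n) (suc j) ∘ suc) ∎
    where
    open ≡-Reasoning
    n<D+D+j : n < suc D + (suc D + j)
    n<D+D+j = ℕ.≤-pred (subst (suc n <_) (double-suc (suc D) j) n<D)
    lemma : ∀ a b c d e → a + b + (c + d + e) ≡ a + c + (b + (d + e))
    lemma = solve-∀
    step₀ : multi (suc n) (suc j) 0 ≡ multi n j 0 + multi n (suc j) 0
    step₀ = trans (cong (_* 1) (sym (nCk+nC[k+1]≡[n+1]C[k+1] n j))) (ℕ.*-distribʳ-+ 1 (n C j) (n C suc j))
    step : ∀ d → multi (suc n) (suc j) (suc d) ≡ multi n j (suc d) + (multi n (suc j) (suc d) + multi n (2 + j) d)
    step d = begin
      term (suc n) (suc d + (suc d + suc j)) (suc d)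
        ≡⟨ cong (λ s → term (suc n) s (suc d)) (double-suc (suc d) j) ⟩
      term (suc n) (suc (suc d + (suc d + j))) (suc d)
        ≡⟨ pascal n (suc d + (suc d + j)) d ⟩
      term n (suc (suc d + (suc d + j))) (suc d) + (multi n j (suc d) + term n (suc d + (suc d + j)) d)
        ≡⟨ cong₂ (λ s s′ → term n s (suc d) + (multi n j (suc d) + term n s′ d)) (sym (double-suc (suc d) j))
             (trans (suc-double d j) (sym (trans (double-suc d (suc j)) (cong suc (double-suc d j))))) ⟩
      multi n (suc j) (suc d) + (multi n j (suc d) + multi n (2 + j) d)
        ≡⟨ lem (multi n (suc j) (suc d)) (multi n j (suc d)) _ ⟩
      multi n j (suc d) + (multi n (suc j) (suc d) + multi n (2 + j) d) ∎
      where
      lem : ∀ a b c → a + (b + c) ≡ b + (a + c)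
      lem = solve-∀

  C-! : ∀ a b → ((a + b) C a) * (a ! * b !) ≡ (a + b) !
  C-! a b = subst (λ c → ((a + b) C a) * (a ! * c !) ≡ (a + b) !) (ℕ.m+n∸m≡n a b)
    (trans (cong (_* (a ! * (a + b ∸ a) !)) (nCk≡n!/k![n-k]! (ℕ.m≤m+n a b)))
           (ℕ.m/n*n≡m (k![n∸k]!∣n! (ℕ.m≤m+n a b))))
    where instance _ = ℕ._!*_!≢0 a (a + b ∸ a)

  absorption : ∀ n k → suc k * (suc n C suc k) ≡ suc n * (n C k)
  absorption zero    zero    = refl
  absorption zero    (suc k) = ℕ.*-zeroʳ (suc (suc k))
  absorption (suc n) zero    = begin
    1 * (suc (suc n) C 1)      ≡⟨ cong (1 *_) (nCk+nC[k+1]≡[n+1]C[k+1] (suc n) 0) ⟨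
    1 * (1 + suc n C 1)        ≡⟨ ℕ.*-distribˡ-+ 1 1 (suc n C 1) ⟩
    1 + 1 * (suc n C 1)        ≡⟨ cong (1 +_) (absorption n 0) ⟩
    suc (suc n) * 1            ∎
    where open ≡-Reasoning
  absorption (suc n) (suc k) = begin
    (2 + k) * (suc (suc n) C (2 + k))
      ≡⟨ cong ((2 + k) *_) (nCk+nC[k+1]≡[n+1]C[k+1] (suc n) (suc k)) ⟨
    (2 + k) * (suc n C suc k + suc n C (2 + k))
      ≡⟨ lemma₁ k (suc n C suc k) (suc n C (2 + k)) ⟩
    suc n C suc k + (suc k * (suc n C suc k) + (2 + k) * (suc n C (2 + k)))
      ≡⟨ cong (suc n C suc k +_) (cong₂ _+_ (absorption n k) (absorption n (suc k))) ⟩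
    suc n C suc k + (suc n * (n C k) + suc n * (n C suc k))
      ≡⟨ cong (suc n C suc k +_) (trans (sym (ℕ.*-distribˡ-+ (suc n) (n C k) _))
           (cong (suc n *_) (nCk+nC[k+1]≡[n+1]C[k+1] n k))) ⟩
    suc (suc n) * (suc n C suc k) ∎
    where
    open ≡-Reasoning
    lemma₁ : ∀ k a b → (2 + k) * (a + b) ≡ a + (suc k * a + (2 + k) * b)
    lemma₁ = solve-∀

  drop-one : ∀ n k → suc n * (n C suc k) + suc k * (suc n C suc k) ≡ suc n * (suc n C suc k)
  drop-one n k = begin
    suc n * (n C suc k) + suc k * (suc n C suc k)  ≡⟨ cong (suc n * (n C suc k) +_) (absorption n k) ⟩
    suc n * (n C suc k) + suc n * (n C k)          ≡⟨ ℕ.+-comm (suc n * (n C suc k)) _ ⟩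
    suc n * (n C k) + suc n * (n C suc k)          ≡⟨ ℕ.*-distribˡ-+ (suc n) (n C k) _ ⟨
    suc n * (n C k + n C suc k)                    ≡⟨ cong (suc n *_) (nCk+nC[k+1]≡[n+1]C[k+1] n k) ⟩
    suc n * (suc n C suc k)                        ∎
    where open ≡-Reasoning

  -- With k = d + 1 and r = n - 2k, the sides contain the multinomials n! / (d! (d + 2)! r!) and n!
  -- / (k! k! r!), whose quotient is (d + 1) / (d + 2). For n < 2k both sides vanish.
  multi-C : ∀ n d → (2 + d) * multi n 2 d ≡ suc d * ((n C suc d) * ((n ∸ suc d) C suc d))
  multi-C n d with ℕ.<-≤-connex n (suc d + suc d)
  ... | inj₁ n<2k = trans (cong (λ x → (2 + d) * (x * ((d + (d + 2)) C d)))
                            (k>n⇒nCk≡0 (subst (n <_) (double d) n<2k)))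
    (trans (ℕ.*-zeroʳ (2 + d)) (sym (trans (cong (λ x → suc d * ((n C suc d) * x))
      (k>n⇒nCk≡0 {n ∸ suc d} {suc d} n∸k<k)) (trans (cong (suc d *_) (ℕ.*-zeroʳ (n C suc d))) (ℕ.*-zeroʳ (suc d))))))
    where
    double : ∀ d → suc d + suc d ≡ d + (d + 2)
    double = solve-∀
    n∸k<k : n ∸ suc d < suc d
    n∸k<k = ℕ.≤-trans (s≤s (ℕ.∸-monoˡ-≤ (suc d) (ℕ.≤-pred n<2k)))
      (ℕ.≤-reflexive (cong suc (ℕ.m+n∸n≡m d (suc d))))
  ... | inj₂ 2k≤n = subst (λ n → (2 + d) * multi n 2 d ≡ suc d * ((n C suc d) * ((n ∸ suc d) C suc d)))
                          (ℕ.m+[n∸m]≡n 2k≤n) (main (n ∸ (suc d + suc d)))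
    where
    main : ∀ r → (2 + d) * multi (suc d + suc d + r) 2 d ≡
      suc d * (((suc d + suc d + r) C suc d) * ((suc d + suc d + r ∸ suc d) C suc d))
    main r = ℕ.*-cancelʳ-≡ _ _ (d ! * suc d ! * r !) {{ℕ.m*n≢0 (d ! * suc d !) (r !) {{ℕ._!*_!≢0 d (suc d)}} {{r ℕ.!≢0}}}} (begin
      (2 + d) * ((m C s) * (s C d)) * (d ! * suc d ! * r !)
        ≡⟨ lemma₁ (2 + d) (m C s) (s C d) (d !) (suc d !) (r !) ⟩
      (m C s) * ((s C d) * (d ! * ((2 + d) * suc d !)) * r !)
        ≡⟨ cong (λ x → (m C s) * (x * r !)) (C-!′ s d (2 + d) (d+2+d d)) ⟩
      (m C s) * (s ! * r !)
        ≡⟨ C-!′ m s r (cong (_+ r) (double d)) ⟩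
      m !
        ≡⟨ C-!′ m (suc d) (suc d + r) (ℕ.+-assoc (suc d) (suc d) r) ⟨
      (m C suc d) * (suc d ! * (suc d + r) !)
        ≡⟨ cong (λ x → (m C suc d) * (suc d ! * x)) (C-! (suc d) r) ⟨
      (m C suc d) * (suc d ! * (((suc d + r) C suc d) * (suc d ! * r !)))
        ≡⟨ lemma₂ d (m C suc d) ((suc d + r) C suc d) (d !) (suc d !) (r !) ⟩
      suc d * ((m C suc d) * ((suc d + r) C suc d)) * (d ! * suc d ! * r !)
        ≡⟨ cong (λ x → suc d * ((m C suc d) * (x C suc d)) * (d ! * suc d ! * r !))
             (sym (trans (cong (_∸ suc d) (ℕ.+-assoc (suc d) (suc d) r)) (ℕ.m+n∸m≡n (suc d) (suc d + r)))) ⟩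
      suc d * ((m C suc d) * ((m ∸ suc d) C suc d)) * (d ! * suc d ! * r !) ∎)
      where
      open ≡-Reasoning
      m = suc d + suc d + r
      s = d + (d + 2)
      double : ∀ d → suc d + suc d ≡ d + (d + 2)
      double = solve-∀
      d+2+d : ∀ d → d + (d + 2) ≡ d + (2 + d)
      d+2+d = solve-∀
      C-!′ : ∀ n a b → n ≡ a + b → (n C a) * (a ! * b !) ≡ n !
      C-!′ _ a b refl = C-! a b
      lemma₁ : ∀ k a b x y z → k * (a * b) * (x * y * z) ≡ a * (b * (x * (k * y)) * z)
      lemma₁ = solve-∀
      lemma₂ : ∀ d a b x y z → a * ((suc d * x) * (b * (y * z))) ≡ suc d * (a * b) * (x * y * z)
      lemma₂ = solve-∀

  -- With s = 2d + 2 steps that are not level, (n + 1) C(n, s) = (n + 1 - s) C(n + 1, s), and the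
  -- weights n + 1 and n + 1 - s add up to 2 (n - d). For n < d both sides vanish, which makes the
  -- truncated subtraction harmless.
  multi-pred : ∀ n d → suc n * (multi (suc n) 2 d + multi n 2 d) ≡ 2 * ((n ∸ d) * multi (suc n) 2 d)
  multi-pred n d with ℕ.<-≤-connex n d
  ... | inj₁ n<d = trans (cong₂ (λ x y → suc n * (x * c + y * c)) C≡0₁ C≡0₂)
                   (trans (ℕ.*-zeroʳ (suc n)) (sym (trans (cong (λ x → 2 * ((n ∸ d) * (x * c))) C≡0₁)
                     (cong (2 *_) (ℕ.*-zeroʳ (n ∸ d))))))
    where
    c = (d + (d + 2)) C d
    n<s : suc n < d + (d + 2)
    n<s = ℕ.≤-trans (s≤s n<d) (ℕ.≤-trans (ℕ.m≤m+n (suc d) (suc d)) (ℕ.≤-reflexive (double d)))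
      where
      double : ∀ d → suc d + suc d ≡ d + (d + 2)
      double = solve-∀
    C≡0₁ : suc n C (d + (d + 2)) ≡ 0
    C≡0₁ = k>n⇒nCk≡0 n<s
    C≡0₂ : n C (d + (d + 2)) ≡ 0
    C≡0₂ = k>n⇒nCk≡0 (ℕ.<-trans (ℕ.n<1+n n) n<s)
  ... | inj₂ d≤n = subst (λ n → suc n * (multi (suc n) 2 d + multi n 2 d) ≡ 2 * ((n ∸ d) * multi (suc n) 2 d))
                         (ℕ.m+[n∸m]≡n d≤n) (main (n ∸ d))
    where
    main : ∀ r → suc (d + r) * (multi (suc (d + r)) 2 d + multi (d + r) 2 d) ≡ 2 * ((d + r ∸ d) * multi (suc (d + r)) 2 d)
    main r = trans
      (cong (λ s → suc (d + r) * (term (suc (d + r)) s d + term (d + r) s d)) double)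
      (trans (ℕ.+-cancelʳ-≡ (suc (suc (d + d)) * x * c) _ _ (begin
        suc (d + r) * (x * c + y * c) + suc (suc (d + d)) * x * c
          ≡⟨ lemma₁ (suc (d + r)) (suc (suc (d + d))) x y c ⟩
        (suc (d + r) * y + suc (suc (d + d)) * x) * c + suc (d + r) * (x * c)
          ≡⟨ cong (λ z → z * c + suc (d + r) * (x * c)) (drop-one (d + r) (suc (d + d))) ⟩
        suc (d + r) * x * c + suc (d + r) * (x * c)
          ≡⟨ lemma₂ d r x c ⟩
        2 * (r * (x * c)) + suc (suc (d + d)) * x * c ∎))
      (cong₂ (λ k s → 2 * (k * term (suc (d + r)) s d)) (sym (ℕ.m+n∸m≡n d r)) (sym double)))
      where
      open ≡-Reasoning
      x = suc (d + r) C suc (suc (d + d))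
      y = (d + r) C suc (suc (d + d))
      c = suc (suc (d + d)) C d
      double : d + (d + 2) ≡ suc (suc (d + d))
      double = trans (cong (d +_) (ℕ.+-comm d 2)) (trans (ℕ.+-suc d (suc d)) (cong suc (ℕ.+-suc d d)))
      lemma₁ : ∀ m k x y c → m * (x * c + y * c) + k * x * c ≡ (m * y + k * x) * c + m * (x * c)
      lemma₁ = solve-∀
      lemma₂ : ∀ d r x c → suc (d + r) * x * c + suc (d + r) * (x * c) ≡ 2 * (r * (x * c)) + suc (suc (d + d)) * x * c
      lemma₂ = solve-∀

  n<2+n/2+n/2 : ∀ n → n < ⌊ n /2⌋ + (⌊ n /2⌋ + 2)
  n<2+n/2+n/2 zero          = s≤s z≤n
  n<2+n/2+n/2 (suc zero)    = s≤s (s≤s z≤n)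
  n<2+n/2+n/2 (suc (suc n)) = subst (suc (suc n) <_) (sym (suc-double ⌊ n /2⌋ 2)) (s≤s (s≤s (n<2+n/2+n/2 n)))

  τ-sum : ∀ n → suc n * (τ (suc n) 2 + τ n 2) ≡ 2 * ∑< ⌊ suc n /2⌋ (λ d → (n ∸ d) * multi (suc n) 2 d)
  τ-sum n = begin
    suc n * (τ (suc n) 2 + τ n 2)
      ≡⟨ cong (suc n *_) (cong₂ _+_ (τ≡∑ (suc n) 2 D (n<2+n/2+n/2 (suc n))) (τ≡∑ n 2 D (ℕ.<-trans (ℕ.n<1+n n) (n<2+n/2+n/2 (suc n))))) ⟩
    suc n * (∑< D (multi (suc n) 2) + ∑< D (multi n 2))
      ≡⟨ cong (suc n *_) (∑<-distrib-+ D (multi (suc n) 2) (multi n 2)) ⟨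
    suc n * ∑< D (λ d → multi (suc n) 2 d + multi n 2 d)
      ≡⟨ ∑<-* D (suc n) _ ⟨
    ∑< D (λ d → suc n * (multi (suc n) 2 d + multi n 2 d))
      ≡⟨ ∑<-cong D (λ d _ → multi-pred n d) ⟩
    ∑< D (λ d → 2 * ((n ∸ d) * multi (suc n) 2 d))
      ≡⟨ ∑<-* D 2 _ ⟩
    2 * ∑< D (λ d → (n ∸ d) * multi (suc n) 2 d) ∎
    where
    open ≡-Reasoning
    D = ⌊ suc n /2⌋

-- The embedding of ℕ in ℚ.

module Embedding where
  open import Data.Rational.Base using (_+_; _*_; _≤_; _<_)

  ι-+ : ∀ m n → ι (m ℕ.+ n) ≡ ι m + ι n
  ι-+ m n = ℚ.toℚᵘ-injective (ℚᵘ.≃-trans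
    (ℚᵘ.*≡* (cong (ℤ._* ℤ.+ 1) (trans (ℤ.pos-+ m n) (sym (cong₂ ℤ._+_ (ℤ.*-identityʳ (ℤ.+ m)) (ℤ.*-identityʳ (ℤ.+ n)))))))
    (ℚᵘ.≃-sym (ℚ.toℚᵘ-homo-+ (ι m) (ι n))))

  ι-* : ∀ m n → ι (m ℕ.* n) ≡ ι m * ι n
  ι-* m n = ℚ.toℚᵘ-injective (ℚᵘ.≃-trans
    (ℚᵘ.*≡* (cong (ℤ._* ℤ.+ 1) (ℤ.pos-* m n)))
    (ℚᵘ.≃-sym (ℚ.toℚᵘ-homo-* (ι m) (ι n))))

  ι-mono-≤ : ∀ {m n} → m ℕ.≤ n → ι m ≤ ι n
  ι-mono-≤ {m} {n} m≤n = ℚ.*≤* (subst₂ ℤ._≤_ (sym (ℤ.*-identityʳ (ℤ.+ m))) (sym (ℤ.*-identityʳ (ℤ.+ n))) (ℤ.+≤+ m≤n))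

  ι-mono-< : ∀ {m n} → m ℕ.< n → ι m < ι n
  ι-mono-< {m} {n} m<n = ℚ.*<* (subst₂ ℤ._<_ (sym (ℤ.*-identityʳ (ℤ.+ m))) (sym (ℤ.*-identityʳ (ℤ.+ n))) (ℤ.+<+ m<n))

  ι-injective : ∀ {m n} → ι m ≡ ι n → m ≡ n
  ι-injective eq = ℤ.+-injective (cong ℚ.ℚ.numerator eq)

-- The commutative ring of formal power series and uniqueness of square roots.

module PowerSeries where
  open import Data.Rational.Base using (_+_; _*_; -_)
  open +-*-Solver using (solve; _:=_; _:+_; _:*_; con)

  0ˢ : FPS
  0ˢ n = 0ℚ

  -ˢ_ : FPS → FPS
  (-ˢ f) n = - f n

  tail : FPS → FPS
  tail f = f ∘ suc

  *ˢ-zero : ∀ f g → (f *ˢ g) 0 ≡ f 0 * g 0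
  *ˢ-zero f g = ℚ.+-identityʳ (f 0 * g 0)

  *ˢ-sucʳ : ∀ f g n → (f *ˢ g) (suc n) ≡ (f *ˢ tail g) n + f (suc n) * g 0
  *ˢ-sucʳ f g zero    = solve 2 (λ a b → a :+ (b :+ con 0ℚ) := a :+ con 0ℚ :+ b) refl (f 0 * g 1) (f 1 * g 0)
  *ˢ-sucʳ f g (suc n) = trans (cong ((f 0 * g (suc (suc n))) +_) (*ˢ-sucʳ (tail f) g n)) 
    (sym (ℚ.+-assoc (f 0 * g (suc (suc n))) ((tail f *ˢ tail g) n) (f (suc (suc n)) * g 0)))

  *ˢ-cong-≤ : ∀ {f f′} g n → (∀ k → k ℕ.≤ n → f k ≡ f′ k) → (f *ˢ g) n ≡ (f′ *ˢ g) n
  *ˢ-cong-≤ g zero    f≡ = cong (λ x → x * g 0 + 0ℚ) (f≡ 0 z≤n)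
  *ˢ-cong-≤ g (suc n) f≡ = cong₂ (λ x y → x * g (suc n) + y) (f≡ 0 z≤n) (*ˢ-cong-≤ g n (λ k k≤n → f≡ (suc k) (s≤s k≤n)))

  *ˢ-congˡ : ∀ {f f′} g → f ≗ f′ → f *ˢ g ≗ f′ *ˢ g
  *ˢ-congˡ g f≗ n = *ˢ-cong-≤ g n (λ k _ → f≗ k)

  *ˢ-comm : ∀ f g → f *ˢ g ≗ g *ˢ f
  *ˢ-comm f g zero    = cong (_+ 0ℚ) (ℚ.*-comm (f 0) (g 0))
  *ˢ-comm f g (suc n) = begin
    f 0 * g (suc n) + (tail f *ˢ g) n  ≡⟨ cong₂ _+_ (ℚ.*-comm (f 0) (g (suc n))) (*ˢ-comm (tail f) g n) ⟩
    g (suc n) * f 0 + (g *ˢ tail f) n  ≡⟨ ℚ.+-comm (g (suc n) * f 0) _ ⟩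
    (g *ˢ tail f) n + g (suc n) * f 0  ≡⟨ *ˢ-sucʳ g f n ⟨
    (g *ˢ f) (suc n)                   ∎
    where open ≡-Reasoning

  *ˢ-cong : ∀ {f f′ g g′} → f ≗ f′ → g ≗ g′ → f *ˢ g ≗ f′ *ˢ g′
  *ˢ-cong {f} {f′} {g} {g′} f≗ g≗ n = trans (*ˢ-congˡ g f≗ n)
    (trans (*ˢ-comm f′ g n) (trans (*ˢ-congˡ f′ g≗ n) (*ˢ-comm g′ f′ n)))

  *ˢ-distribʳ : ∀ g f f′ → (f +ˢ f′) *ˢ g ≗ f *ˢ g +ˢ f′ *ˢ g
  *ˢ-distribʳ g f f′ zero    = solve 3 (λ a b c → (a :+ b) :* c :+ con 0ℚ := a :* c :+ con 0ℚ :+ (b :* c :+ con 0ℚ)) refl (f 0) (f′ 0) (g 0)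
  *ˢ-distribʳ g f f′ (suc n) = trans (cong (((f 0 + f′ 0) * g (suc n)) +_) (*ˢ-distribʳ g (tail f) (tail f′) n))
    (solve 5 (λ a b c x y → (a :+ b) :* c :+ (x :+ y) := a :* c :+ x :+ (b :* c :+ y)) refl
      (f 0) (f′ 0) (g (suc n)) ((tail f *ˢ g) n) ((tail f′ *ˢ g) n))

  *ˢ-distribˡ : ∀ g f f′ → g *ˢ (f +ˢ f′) ≗ g *ˢ f +ˢ g *ˢ f′
  *ˢ-distribˡ g f f′ n = trans (*ˢ-comm g (f +ˢ f′) n)
    (trans (*ˢ-distribʳ g f f′ n) (cong₂ _+_ (*ˢ-comm f g n) (*ˢ-comm f′ g n)))

  ·ˢ-*ˢ : ∀ c f g → (c ·ˢ f) *ˢ g ≗ c ·ˢ (f *ˢ g)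
  ·ˢ-*ˢ c f g zero    = solve 3 (λ c a b → c :* a :* b :+ con 0ℚ := c :* (a :* b :+ con 0ℚ)) refl c (f 0) (g 0)
  ·ˢ-*ˢ c f g (suc n) = trans (cong ((c * f 0 * g (suc n)) +_) (·ˢ-*ˢ c (tail f) g n))
    (solve 4 (λ c a b x → c :* a :* b :+ c :* x := c :* (a :* b :+ x)) refl c (f 0) (g (suc n)) ((tail f *ˢ g) n))

  *ˢ-assoc : ∀ f g h → (f *ˢ g) *ˢ h ≗ f *ˢ (g *ˢ h)
  *ˢ-assoc f g h zero    = solve 3 (λ a b c → (a :* b :+ con 0ℚ) :* c :+ con 0ℚ := a :* (b :* c :+ con 0ℚ) :+ con 0ℚ) refl (f 0) (g 0) (h 0)
  *ˢ-assoc f g h (suc n) = begin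
    (f *ˢ g) 0 * h (suc n) + ((f 0 ·ˢ tail g +ˢ tail f *ˢ g) *ˢ h) n
      ≡⟨ cong₂ (λ x y → x * h (suc n) + y) (*ˢ-zero f g) (*ˢ-distribʳ h (f 0 ·ˢ tail g) (tail f *ˢ g) n) ⟩
    f 0 * g 0 * h (suc n) + (((f 0 ·ˢ tail g) *ˢ h) n + ((tail f *ˢ g) *ˢ h) n)
      ≡⟨ cong₂ (λ x y → f 0 * g 0 * h (suc n) + (x + y)) (·ˢ-*ˢ (f 0) (tail g) h n) (*ˢ-assoc (tail f) g h n) ⟩
    f 0 * g 0 * h (suc n) + (f 0 * (tail g *ˢ h) n + (tail f *ˢ (g *ˢ h)) n)
      ≡⟨ solve 5 (λ a b c x y → a :* b :* c :+ (a :* x :+ y) := a :* (b :* c :+ x) :+ y) refl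
           (f 0) (g 0) (h (suc n)) ((tail g *ˢ h) n) ((tail f *ˢ (g *ˢ h)) n) ⟩
    f 0 * (g *ˢ h) (suc n) + (tail f *ˢ (g *ˢ h)) n ∎
    where open ≡-Reasoning

  *ˢ-zeroˡ : ∀ f → 0ˢ *ˢ f ≗ 0ˢ
  *ˢ-zeroˡ f zero    = cong (_+ 0ℚ) (ℚ.*-zeroˡ (f 0))
  *ˢ-zeroˡ f (suc n) = cong₂ _+_ (ℚ.*-zeroˡ (f (suc n))) (*ˢ-zeroˡ f n)

  *ˢ-identityˡ : ∀ f → 1ˢ *ˢ f ≗ f
  *ˢ-identityˡ f zero    = trans (ℚ.+-identityʳ _) (ℚ.*-identityˡ (f 0))
  *ˢ-identityˡ f (suc n) = trans (cong₂ _+_ (ℚ.*-identityˡ (f (suc n))) (*ˢ-zeroˡ f n)) (ℚ.+-identityʳ _)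

  ≗-isEquivalence : IsEquivalence {A = FPS} _≗_
  ≗-isEquivalence = record { refl = λ _ → refl ; sym = λ f≗ n → sym (f≗ n) ; trans = λ f≗ g≗ n → trans (f≗ n) (g≗ n) }

  +ˢ-*ˢ-isCommutativeRing : IsCommutativeRing _≗_ _+ˢ_ _*ˢ_ -ˢ_ 0ˢ 1ˢ
  +ˢ-*ˢ-isCommutativeRing = record
    { isRing = record
      { +-isAbelianGroup = record
        { isGroup = record
          { isMonoid = record
            { isSemigroup = record
              { isMagma = record { isEquivalence = ≗-isEquivalence ; ∙-cong = λ f≗ g≗ n → cong₂ _+_ (f≗ n) (g≗ n) }
              ; assoc   = λ f g h n → ℚ.+-assoc (f n) (g n) (h n)
              }
            ; identity = (λ f n → ℚ.+-identityˡ (f n)) , (λ f n → ℚ.+-identityʳ (f n))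
            }
          ; inverse = (λ f n → ℚ.+-inverseˡ (f n)) , (λ f n → ℚ.+-inverseʳ (f n))
          ; ⁻¹-cong = λ f≗ n → cong -_ (f≗ n)
          }
        ; comm = λ f g n → ℚ.+-comm (f n) (g n)
        }
      ; *-cong     = *ˢ-cong
      ; *-assoc    = *ˢ-assoc
      ; *-identity = *ˢ-identityˡ , (λ f n → trans (*ˢ-comm f 1ˢ n) (*ˢ-identityˡ f n))
      ; distrib    = *ˢ-distribˡ , *ˢ-distribʳ
      }
    ; *-comm = *ˢ-comm
    }

  +ˢ-*ˢ-commutativeRing : CommutativeRing 0ℓ 0ℓ
  +ˢ-*ˢ-commutativeRing = record { isCommutativeRing = +ˢ-*ˢ-isCommutativeRing }

  const : ℚ → FPS
  const c zero    = c
  const c (suc n) = 0ℚ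

  1ˢ≗const : 1ˢ ≗ const 1ℚ
  1ˢ≗const zero    = refl
  1ˢ≗const (suc n) = refl

  ·ˢ≗const : ∀ c f → c ·ˢ f ≗ const c *ˢ f
  ·ˢ≗const c f zero    = sym (ℚ.+-identityʳ _)
  ·ˢ≗const c f (suc n) = sym (trans (cong ((c * f (suc n)) +_) (*ˢ-zeroˡ f n)) (ℚ.+-identityʳ _))

  -- The ring solver takes its coefficients from ℚ through this homomorphism, because equality of
  -- rationals is decidable and equality of series is not.
  const-homo : ACR._-Raw-AlmostCommutative⟶_ (CommutativeRing.rawRing ℚ.+-*-commutativeRing)
                 (ACR.fromCommutativeRing +ˢ-*ˢ-commutativeRing)
  const-homo = record
    { ⟦_⟧    = const
    ; +-homo = λ { c d zero → refl ; c d (suc n) → refl }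
    ; *-homo = λ { c d n → trans (sym (c*const c d n)) (·ˢ≗const c (const d) n) }
    ; -‿homo = λ { c zero → refl ; c (suc n) → refl }
    ; 0-homo = λ { zero → refl ; (suc n) → refl }
    ; 1-homo = λ n → sym (1ˢ≗const n)
    }
    where
    c*const : ∀ c d → c ·ˢ const d ≗ const (c * d)
    c*const c d zero    = refl
    c*const c d (suc n) = ℚ.*-zeroʳ c

  const≟ : ∀ c d → Maybe (const c ≗ const d)
  const≟ c d with c ℚ.≟ d
  ... | yes refl = just (λ _ → refl)
  ... | no  _    = nothing

  module Solver = RingSolver (CommutativeRing.rawRing ℚ.+-*-commutativeRing)
    (ACR.fromCommutativeRing +ˢ-*ˢ-commutativeRing) const-homo const≟

  X*-suc : ∀ f n → (X *ˢ f) (suc n) ≡ f n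
  X*-suc f n = trans (cong (_+ (1ˢ *ˢ f) n) (ℚ.*-zeroˡ (f (suc n))))
    (trans (ℚ.+-identityˡ _) (*ˢ-identityˡ f n))

  X*-zero : ∀ f → (X *ˢ f) 0 ≡ 0ℚ
  X*-zero f = trans (*ˢ-zero X f) (ℚ.*-zeroˡ (f 0))

  -- A coefficient of the product involves all earlier coefficients of the factor, so the induction
  -- carries equality of every coefficient up to `n`; the constant term 1 then isolates the next
  -- one.
  *ˢ-cancelʳ : ∀ f {g h} → f 0 ≡ 1ℚ → g *ˢ f ≗ h *ˢ f → g ≗ h
  *ˢ-cancelʳ f {g} {h} f0≡1 gf≗hf n = upTo n n ℕ.≤-refl
    where
    open ≡-Reasoning
    upTo : ∀ n k → k ℕ.≤ n → g k ≡ h k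
    upTo zero zero z≤n = begin
      g 0               ≡⟨ trans (cong (g 0 *_) f0≡1) (ℚ.*-identityʳ (g 0)) ⟨
      g 0 * f 0         ≡⟨ *ˢ-zero g f ⟨
      (g *ˢ f) 0        ≡⟨ gf≗hf 0 ⟩
      (h *ˢ f) 0        ≡⟨ *ˢ-zero h f ⟩
      h 0 * f 0         ≡⟨ trans (cong (h 0 *_) f0≡1) (ℚ.*-identityʳ (h 0)) ⟩
      h 0               ∎
    upTo (suc n) k k≤1+n with ℕ.m≤n⇒m<n∨m≡n k≤1+n
    ... | inj₁ (s≤s k≤n) = upTo n k k≤n
    ... | inj₂ refl = GroupProperties.∙-cancelˡ ℚ.+-0-group ((g *ˢ tail f) n) _ _ (begin
      (g *ˢ tail f) n + g (suc n)        ≡⟨ cong ((g *ˢ tail f) n +_) (trans (cong (g (suc n) *_) f0≡1) (ℚ.*-identityʳ (g (suc n)))) ⟨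
      (g *ˢ tail f) n + g (suc n) * f 0  ≡⟨ *ˢ-sucʳ g f n ⟨
      (g *ˢ f) (suc n)                   ≡⟨ gf≗hf (suc n) ⟩
      (h *ˢ f) (suc n)                   ≡⟨ *ˢ-sucʳ h f n ⟩
      (h *ˢ tail f) n + h (suc n) * f 0  ≡⟨ cong₂ _+_ (*ˢ-cong-≤ (tail f) n (upTo n)) (sym (trans (cong (h (suc n) *_) f0≡1) (ℚ.*-identityʳ (h (suc n))))) ⟨
      (g *ˢ tail f) n + h (suc n)        ∎)

  -- Two roots r and s satisfy r (r + s) = s (r + s), since r² = s². Halving r + s gives constant
  -- term 1, so it can be cancelled.
  √ˢ-unique : ∀ {f s} → f 0 ≡ 1ℚ → s 0 ≡ 1ℚ → s *ˢ s ≗ f → √ˢ f ≗ s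
  √ˢ-unique {f} {s} f0≡1 s0≡1 s²≗f = *ˢ-cancelʳ h h0≡1 λ n → begin
    (r *ˢ h) n                             ≡⟨ Solver.solve 2 (λ r s → r S.:* (S.con ½ S.:* (r S.:+ s)) S.:= S.con ½ S.:* (r S.:* r S.:+ r S.:* s)) (λ _ → refl) r s n ⟩
    (const ½ *ˢ (r *ˢ r +ˢ r *ˢ s)) n      ≡⟨ *ˢ-cong {const ½} (λ _ → refl) (λ k → cong (_+ (r *ˢ s) k) (trans (√ˢ-square f f0≡1 k) (sym (s²≗f k)))) n ⟩
    (const ½ *ˢ (s *ˢ s +ˢ r *ˢ s)) n      ≡⟨ Solver.solve 2 (λ r s → S.con ½ S.:* (s S.:* s S.:+ r S.:* s) S.:= s S.:* (S.con ½ S.:* (r S.:+ s))) (λ _ → refl) r s n ⟩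
    (s *ˢ h) n                             ∎
    where
    module S = Solver
    open ≡-Reasoning
    r = √ˢ f
    h = const ½ *ˢ (r +ˢ s)
    h0≡1 : h 0 ≡ 1ℚ
    h0≡1 = cong (λ x → ½ * (1ℚ + x) + 0ℚ) s0≡1

-- Edge numbers in terms of `τ` and `e`.

module EdgeCounts where
  open import Data.Nat.Base using (_+_)
  open Covers using (N; ℓ≡edgeCount)
  open Trinomials using (τ; N+τ; edgeCount≡τ; e)

  ℓ≡τ : ∀ n → ℓ (𝓜 (suc n)) ≡ τ (suc n) 2 + τ n 2
  ℓ≡τ n = trans (ℓ≡edgeCount (suc n)) (edgeCount≡τ n)

  ℓ+N : ∀ n → ℓ (𝓜 (suc n)) + (N 0 (suc n) + N 0 n) ≡ e (suc n)
  ℓ+N n = begin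
    ℓ (𝓜 (suc n)) + (N 0 (suc n) + N 0 n)             ≡⟨ cong (_+ (N 0 (suc n) + N 0 n)) (ℓ≡τ n) ⟩
    τ (suc n) 2 + τ n 2 + (N 0 (suc n) + N 0 n)       ≡⟨ lemma (τ (suc n) 2) (τ n 2) (N 0 (suc n)) (N 0 n) ⟩
    N 0 (suc n) + τ (suc n) 2 + (N 0 n + τ n 2)       ≡⟨ cong₂ _+_ (N+τ (suc n) 0) (N+τ n 0) ⟩
    e (suc n)                                         ∎
    where
    open ≡-Reasoning
    lemma : ∀ a b c d → a + b + (c + d) ≡ c + a + (d + b)
    lemma = solve-∀

-- Coefficients of the powers of 1 + x + x².

module TrinomialPowers where
  open import Data.Nat.Base using (∣_-_∣)
  open import Data.Rational.Base using (_+_)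
  open Embedding
  open PowerSeries
  open Trinomials using (τ)
  open Binomials using (τ≡0)

  -- The defining recursion of `τ`, which distinguishes j = 0 from j > 0, becomes uniform for the
  -- even extension to all integers.
  τ-distance : ∀ n i k → τ (suc n) ∣ suc k - i ∣ ≡
    τ n ∣ suc (suc k) - i ∣ ℕ.+ (τ n ∣ suc k - i ∣ ℕ.+ τ n ∣ k - i ∣)
  τ-distance n zero          k       = trans (lemma (τ n k) (τ n (suc k)) (τ n (suc (suc k))))
    (cong (λ j → τ n (suc (suc k)) ℕ.+ (τ n (suc k) ℕ.+ τ n j)) (sym (ℕ.∣-∣-identityʳ k)))
    where
    lemma : ∀ a b c → a ℕ.+ (b ℕ.+ c) ≡ c ℕ.+ (b ℕ.+ a)
    lemma = solve-∀
  τ-distance n (suc zero)    zero    = lemma (τ n 0) (τ n 1)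
    where
    lemma : ∀ a b → a ℕ.+ (b ℕ.+ b) ≡ b ℕ.+ (a ℕ.+ b)
    lemma = solve-∀
  τ-distance n (suc (suc i)) zero    = refl
  τ-distance n (suc i)       (suc k) = τ-distance n i k

  1+X+X²*-zero : ∀ f → (1+X+X² *ˢ f) 0 ≡ f 0
  1+X+X²*-zero f = trans (*ˢ-zero 1+X+X² f) (ℚ.*-identityˡ (f 0))

  expand : ∀ f → 1+X+X² *ˢ f ≗ f +ˢ (X *ˢ f +ˢ X *ˢ (X *ˢ f))
  expand f n = trans (*ˢ-congˡ f (λ k → cong (λ x → 1ˢ k + X k + x) (*ˢ-cong {X} (λ _ → refl) (λ j → trans (*ˢ-comm X 1ˢ j) (*ˢ-identityˡ X j)) k)) n)
    (trans (*ˢ-congˡ f (λ k → cong (λ x → x + X k + (X *ˢ X) k) (1ˢ≗const k)) n)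
      (solve 2 (λ x f → (con 1ℚ :+ x :+ x :* x) :* f := f :+ (x :* f :+ x :* (x :* f))) (λ _ → refl) X f n))
    where open Solver

  -- Since (1 + x + x²)^n = x^n (x⁻¹ + 1 + x)^n, the index is only shifted by `n`. For k < 2 the
  -- missing neighbours lie beyond the support of `τ n`.
  [1+X+X²]^ : ∀ n k → (1+X+X² ^ˢ n) k ≡ ι (τ n ∣ k - n ∣)
  [1+X+X²]^ zero    zero          = refl
  [1+X+X²]^ zero    (suc k)       = refl
  [1+X+X²]^ (suc n) zero          = trans (1+X+X²*-zero (1+X+X² ^ˢ n)) (trans ([1+X+X²]^ n 0) (cong ι (sym (begin
    τ n n ℕ.+ (τ n (suc n) ℕ.+ τ n (suc (suc n)))  ≡⟨ cong₂ (λ x y → τ n n ℕ.+ (x ℕ.+ y)) (τ≡0 n (suc n) ℕ.≤-refl) (τ≡0 n (suc (suc n)) (ℕ.n≤1+n (suc n))) ⟩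
    τ n n ℕ.+ 0                                    ≡⟨ ℕ.+-identityʳ (τ n n) ⟩
    τ n n                                          ∎))))
    where open ≡-Reasoning
  [1+X+X²]^ (suc n) (suc zero)    = begin
    (1+X+X² *ˢ P) 1                                ≡⟨ expand P 1 ⟩
    P 1 + ((X *ˢ P) 1 + (X *ˢ (X *ˢ P)) 1)         ≡⟨ cong₂ (λ x y → P 1 + (x + y)) (X*-suc P 0) (trans (X*-suc (X *ˢ P) 0) (X*-zero P)) ⟩
    P 1 + (P 0 + 0ℚ)                               ≡⟨ cong (P 1 +_) (ℚ.+-identityʳ (P 0)) ⟩
    P 1 + P 0                                      ≡⟨ cong₂ _+_ ([1+X+X²]^ n 1) ([1+X+X²]^ n 0) ⟩
    ι (τ n ∣ 1 - n ∣) + ι (τ n n)                  ≡⟨ ι-+ (τ n ∣ 1 - n ∣) (τ n n) ⟨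
    ι (τ n ∣ 1 - n ∣ ℕ.+ τ n n)                    ≡⟨ cong ι (edge n) ⟨
    ι (τ (suc n) n)                                ∎
    where
    open ≡-Reasoning
    P = 1+X+X² ^ˢ n
    edge : ∀ n → τ (suc n) n ≡ τ n ∣ 1 - n ∣ ℕ.+ τ n n
    edge zero    = refl
    edge (suc n) = cong (τ (suc n) n ℕ.+_) (trans (cong (τ (suc n) (suc n) ℕ.+_) (τ≡0 (suc n) (suc (suc n)) ℕ.≤-refl)) (ℕ.+-identityʳ _))
  [1+X+X²]^ (suc n) (suc (suc k)) = begin
    (1+X+X² *ˢ P) (suc (suc k))
      ≡⟨ expand P (suc (suc k)) ⟩
    P (suc (suc k)) + ((X *ˢ P) (suc (suc k)) + (X *ˢ (X *ˢ P)) (suc (suc k)))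
      ≡⟨ cong₂ (λ x y → P (suc (suc k)) + (x + y)) (X*-suc P (suc k)) (trans (X*-suc (X *ˢ P) (suc k)) (X*-suc P k)) ⟩
    P (suc (suc k)) + (P (suc k) + P k)
      ≡⟨ cong₂ _+_ ([1+X+X²]^ n (suc (suc k))) (cong₂ _+_ ([1+X+X²]^ n (suc k)) ([1+X+X²]^ n k)) ⟩
    ι a + (ι b + ι c)
      ≡⟨ trans (ι-+ a (b ℕ.+ c)) (cong (ι a +_) (ι-+ b c)) ⟨
    ι (a ℕ.+ (b ℕ.+ c))
      ≡⟨ cong ι (τ-distance n n k) ⟨
    ι (τ (suc n) ∣ suc k - n ∣) ∎
    where
    open ≡-Reasoning
    P = 1+X+X² ^ˢ n
    a = τ n ∣ suc (suc k) - n ∣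
    b = τ n ∣ suc k - n ∣
    c = τ n ∣ k - n ∣

  T≡τ : ∀ n → T n ≡ ι (τ n 0)
  T≡τ n = trans ([1+X+X²]^ n n) (cong (λ k → ι (τ n k)) (ℕ.∣n-n∣≡0 n))

  [1+X+X²]^[n-2] : ∀ n → (1+X+X² ^ˢ suc (suc n)) n ≡ ι (τ (suc (suc n)) 2)
  [1+X+X²]^[n-2] n = trans ([1+X+X²]^ (suc (suc n)) n) (cong (λ k → ι (τ (suc (suc n)) k))
    (trans (cong (∣ n -_∣) (ℕ.+-comm 2 n)) (ℕ.∣m-m+n∣≡n n 2)))

-- Edge numbers from Motzkin numbers and as coefficients of trinomial powers.

module Identities where
  open import Data.Rational.Base using (_+_; _-_)
  open Embedding
  open Covers using (N)
  open Trinomials using (τ)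
  open EdgeCounts
  open TrinomialPowers

  edges-trinomial-motzkin : ∀ n → ι (ℓ (𝓜 (suc n))) ≡ T (suc n) - M (suc n) + T n - M n
  edges-trinomial-motzkin n = begin
    ι l
      ≡⟨ solve 3 (λ l m m′ → l := (l :+ (m :+ m′)) :- m :- m′) refl (ι l) (ι (N 0 (suc n))) (ι (N 0 n)) ⟩
    ι l + (ι (N 0 (suc n)) + ι (N 0 n)) - ι (N 0 (suc n)) - ι (N 0 n)
      ≡⟨ cong (λ x → x - ι (N 0 (suc n)) - ι (N 0 n)) (trans (sym (trans (ι-+ l _) (cong (ι l +_) (ι-+ (N 0 (suc n)) (N 0 n)))))
           (trans (cong ι (ℓ+N n)) (ι-+ (τ (suc n) 0) (τ n 0)))) ⟩
    ι (τ (suc n) 0) + ι (τ n 0) - ι (N 0 (suc n)) - ι (N 0 n)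
      ≡⟨ solve 4 (λ a b c d → a :+ b :- c :- d := a :- c :+ b :- d) refl (ι (τ (suc n) 0)) (ι (τ n 0)) (ι (N 0 (suc n))) (ι (N 0 n)) ⟩
    ι (τ (suc n) 0) - ι (N 0 (suc n)) + ι (τ n 0) - ι (N 0 n)
      ≡⟨ cong₂ (λ x y → x - ι (N 0 (suc n)) + y - ι (N 0 n)) (T≡τ (suc n)) (T≡τ n) ⟨
    T (suc n) - M (suc n) + T n - M n ∎
    where
    open ≡-Reasoning
    open +-*-Solver
    l = ℓ (𝓜 (suc n))

  edges-coefficients : ∀ n → ι (ℓ (𝓜 (suc (suc (suc n))))) ≡ (1+X+X² ^ˢ suc (suc (suc n))) (suc n) + (1+X+X² ^ˢ suc (suc n)) n
  edges-coefficients n = trans (cong ι (ℓ≡τ (suc (suc n)))) (trans (ι-+ (τ (suc (suc (suc n))) 2) (τ (suc (suc n)) 2))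
    (sym (cong₂ _+_ ([1+X+X²]^[n-2] (suc n)) ([1+X+X²]^[n-2] n))))

-- The edge generating function.

module Series where
  open import Data.Rational.Base using (_+_; _*_)
  open Embedding
  open PowerSeries
  open Covers using (N; N-zero)
  open Trinomials using (e; 2N+e)
  open Convolution using (conv; first-passage)
  open EdgeCounts using (ℓ+N)
  open Solver
  open import Relation.Binary.Reasoning.Setoid (CommutativeRing.setoid +ˢ-*ˢ-commutativeRing)

  *ˢ-ι : ∀ f g n → ((ι ∘ f) *ˢ (ι ∘ g)) n ≡ ι (conv f g n)
  *ˢ-ι f g zero    = trans (ℚ.+-identityʳ _) (sym (ι-* (f 0) (g 0)))
  *ˢ-ι f g (suc n) = trans (cong₂ _+_ (sym (ι-* (f 0) (g (suc n)))) (*ˢ-ι (f ∘ suc) g n))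
    (sym (ι-+ (f 0 ℕ.* g (suc n)) (conv (f ∘ suc) g n)))

  XX*-suc : ∀ f n → (X *ˢ (X *ˢ f)) (suc (suc n)) ≡ f n
  XX*-suc f n = trans (X*-suc (X *ˢ f) (suc n)) (X*-suc f n)

  +ˢ-cong : ∀ {f f′ g g′} → f ≗ f′ → g ≗ g′ → f +ˢ g ≗ f′ +ˢ g′
  +ˢ-cong f≗ g≗ n = cong₂ _+_ (f≗ n) (g≗ n)

  ≗-refl : ∀ {f : FPS} → f ≗ f
  ≗-refl n = refl

  mˢ eˢ gˢ Eˢ : FPS
  mˢ n = ι (N 0 n)
  eˢ n = ι (e n)
  gˢ n = ι (suc n ℕ.* e (suc n))
  Eˢ n = ι (ℓ (𝓜 n))

  k : ℕ → FPS
  k n = const (ι n)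

  -- The first step is level or up; after an up step, the path from height 1 splits at its first
  -- visit to 0, which is `first-passage` at height 0.
  motzkin-equation : mˢ ≗ k 1 +ˢ (X *ˢ mˢ +ˢ X *ˢ (X *ˢ (mˢ *ˢ mˢ)))
  motzkin-equation zero          = refl
  motzkin-equation (suc zero)    = refl
  motzkin-equation (suc (suc n)) = sym (trans (ℚ.+-identityˡ _)
    (trans (cong₂ _+_ (X*-suc mˢ (suc n)) (trans (XX*-suc (mˢ *ˢ mˢ) n) (trans (*ˢ-ι (N 0) (N 0) n) (cong ι (first-passage n 0)))))
      (trans (sym (ι-+ (N 0 (suc n)) (N 1 (suc n)))) (cong ι (trans (ℕ.+-comm (N 0 (suc n)) _) (sym (N-zero (suc n))))))))

  e-motzkin : eˢ +ˢ (X +ˢ X *ˢ (X *ˢ (mˢ +ˢ mˢ))) ≗ k 1 +ˢ (X *ˢ eˢ +ˢ (X *ˢ eˢ +ˢ X *ˢ eˢ))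
  e-motzkin zero          = refl
  e-motzkin (suc zero)    = refl
  e-motzkin (suc (suc n)) = ≡.begin
    eˢ (2 ℕ.+ n) + (0ℚ + (X *ˢ (X *ˢ (mˢ +ˢ mˢ))) (2 ℕ.+ n))
      ≡.≡⟨ cong (eˢ (2 ℕ.+ n) +_) (trans (ℚ.+-identityˡ _) (XX*-suc (mˢ +ˢ mˢ) n)) ⟩
    ι (e (2 ℕ.+ n)) + (ι (N 0 n) + ι (N 0 n))
      ≡.≡⟨ trans (ι-+ (e (2 ℕ.+ n)) _) (cong (ι (e (2 ℕ.+ n)) +_) (ι-+ (N 0 n) (N 0 n))) ⟨
    ι (e (2 ℕ.+ n) ℕ.+ (N 0 n ℕ.+ N 0 n))
      ≡.≡⟨ cong ι (trans (lemma (e (2 ℕ.+ n)) (N 0 n)) (trans (2N+e n) (lemma′ (e (suc n))))) ⟩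
    ι (e (suc n) ℕ.+ (e (suc n) ℕ.+ e (suc n)))
      ≡.≡⟨ trans (ι-+ (e (suc n)) _) (cong (ι (e (suc n)) +_) (ι-+ (e (suc n)) (e (suc n)))) ⟩
    eˢ (suc n) + (eˢ (suc n) + eˢ (suc n))
      ≡.≡⟨ trans (ℚ.+-identityˡ _) (cong (λ x → x + (x + x)) (X*-suc eˢ (suc n))) ⟨
    0ℚ + ((X *ˢ eˢ) (2 ℕ.+ n) + ((X *ˢ eˢ) (2 ℕ.+ n) + (X *ˢ eˢ) (2 ℕ.+ n))) ≡.∎
    where
    module ≡ = ≡-Reasoning
    lemma : ∀ a b → a ℕ.+ (b ℕ.+ b) ≡ 2 ℕ.* b ℕ.+ a
    lemma = solve-∀
    lemma′ : ∀ a → 3 ℕ.* a ≡ a ℕ.+ (a ℕ.+ a)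
    lemma′ = solve-∀

  E+m : Eˢ +ˢ (mˢ +ˢ X *ˢ mˢ) ≗ eˢ
  E+m zero    = refl
  E+m (suc n) = trans (cong (λ x → Eˢ (suc n) + (mˢ (suc n) + x)) (X*-suc mˢ n))
    (trans (sym (trans (ι-+ (ℓ (𝓜 (suc n))) _) (cong (Eˢ (suc n) +_) (ι-+ (N 0 (suc n)) (N 0 n))))) (cong ι (ℓ+N n)))

  -- s is the square root of 1 - 2 x - 3 x².
  s Q P : FPS
  P = k 1 -ˢ k 3 *ˢ X
  s = P *ˢ eˢ
  Q = k 1 -ˢ k 2 *ˢ X -ˢ k 3 *ˢ (X *ˢ X)

  s-motzkin : s ≗ k 1 -ˢ (X +ˢ X *ˢ (X *ˢ (mˢ +ˢ mˢ)))
  s-motzkin = begin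
    P *ˢ eˢ
      ≈⟨ solve 3 (λ x e y → (con (ι 1) :- con (ι 3) :* x) :* e := e :+ y :- y :- (x :* e :+ (x :* e :+ x :* e))) ≗-refl X eˢ y ⟩
    eˢ +ˢ y -ˢ y -ˢ (X *ˢ eˢ +ˢ (X *ˢ eˢ +ˢ X *ˢ eˢ))
      ≈⟨ (λ n → cong (λ z → z ℚ.- y n ℚ.- (X *ˢ eˢ +ˢ (X *ˢ eˢ +ˢ X *ˢ eˢ)) n) (e-motzkin n)) ⟩
    k 1 +ˢ (X *ˢ eˢ +ˢ (X *ˢ eˢ +ˢ X *ˢ eˢ)) -ˢ y -ˢ (X *ˢ eˢ +ˢ (X *ˢ eˢ +ˢ X *ˢ eˢ))
      ≈⟨ solve 2 (λ t y → con (ι 1) :+ t :- y :- t := con (ι 1) :- y) ≗-refl (X *ˢ eˢ +ˢ (X *ˢ eˢ +ˢ X *ˢ eˢ)) y ⟩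
    k 1 -ˢ y ∎
    where y = X +ˢ X *ˢ (X *ˢ (mˢ +ˢ mˢ))

  -- Completing the square in the equation of m: (1 - x - 2x²m)² = (1 - x)² - 4x² (m - xm - x²m²),
  -- and the last bracket is 1.
  s² : s *ˢ s ≗ Q
  s² = begin
    s *ˢ s
      ≈⟨ *ˢ-cong s-motzkin s-motzkin ⟩
    (k 1 -ˢ (X +ˢ X *ˢ (X *ˢ (mˢ +ˢ mˢ)))) *ˢ (k 1 -ˢ (X +ˢ X *ˢ (X *ˢ (mˢ +ˢ mˢ))))
      ≈⟨ solve 2 (λ x m → (con (ι 1) :- (x :+ x :* (x :* (m :+ m)))) :* (con (ι 1) :- (x :+ x :* (x :* (m :+ m)))) :=
           (con (ι 1) :- x) :* (con (ι 1) :- x) :- con (ι 4) :* (x :* x) :* (m :- (x :* m :+ x :* (x :* (m :* m))))) ≗-refl X mˢ ⟩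
    (k 1 -ˢ X) *ˢ (k 1 -ˢ X) -ˢ k 4 *ˢ (X *ˢ X) *ˢ (mˢ -ˢ y)
      ≈⟨ (λ n → cong (λ z → ((k 1 -ˢ X) *ˢ (k 1 -ˢ X)) n ℚ.- z) (*ˢ-cong {k 4 *ˢ (X *ˢ X)} ≗-refl (λ i → cong (ℚ._- y i) (motzkin-equation i)) n)) ⟩
    (k 1 -ˢ X) *ˢ (k 1 -ˢ X) -ˢ k 4 *ˢ (X *ˢ X) *ˢ (k 1 +ˢ y -ˢ y)
      ≈⟨ solve 2 (λ x y → (con (ι 1) :- x) :* (con (ι 1) :- x) :- con (ι 4) :* (x :* x) :* (con (ι 1) :+ y :- y) :=
           con (ι 1) :- con (ι 2) :* x :- con (ι 3) :* (x :* x)) ≗-refl X y ⟩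
    Q ∎
    where y = X *ˢ mˢ +ˢ X *ˢ (X *ˢ (mˢ *ˢ mˢ))

  -- Multiplied by P = 1 - 3x, the left side becomes s² because s = P e, and Q = (1 + x) P.
  se : s *ˢ eˢ ≗ k 1 +ˢ X
  se = *ˢ-cancelʳ P refl (begin
    (s *ˢ eˢ) *ˢ P      ≈⟨ solve 2 (λ e p → p :* e :* e :* p := (p :* e) :* (p :* e)) ≗-refl eˢ P ⟩
    s *ˢ s              ≈⟨ s² ⟩
    Q                   ≈⟨ solve 1 (λ x → con (ι 1) :- con (ι 2) :* x :- con (ι 3) :* (x :* x) :=
                             (con (ι 1) :+ x) :* (con (ι 1) :- con (ι 3) :* x)) ≗-refl X ⟩
    (k 1 +ˢ X) *ˢ P     ∎)

  X²≗X*X : X ^ˢ 2 ≗ X *ˢ X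
  X²≗X*X = *ˢ-cong {X} ≗-refl (λ n → trans (*ˢ-comm X 1ˢ n) (*ˢ-identityˡ X n))

  1-2X-3X²≗Q : 1-2X-3X² ≗ Q
  1-2X-3X²≗Q n = cong₂ (λ x y → x ℚ.- y) (cong₂ (λ x y → x ℚ.- y) (1ˢ≗const n) (·ˢ≗const (ι 2) X n))
    (trans (·ˢ≗const (ι 3) (X ^ˢ 2) n) (*ˢ-cong {k 3} ≗-refl X²≗X*X n))

  √≗s : √ˢ 1-2X-3X² ≗ s
  √≗s = √ˢ-unique refl refl (λ n → trans (s² n) (sym (1-2X-3X²≗Q n)))

  -- Write the edge series as e - (1 + x) m. Then s e = 1 + x removes e, and -2x²m = s - (1 - x)
  -- removes m; only s and s² = Q remain.
  generating-function : ι 2 ·ˢ X ^ˢ 2 *ˢ √ˢ 1-2X-3X² *ˢ Eˢ ≗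
    (1ˢ +ˢ X) *ˢ (1ˢ -ˢ ι 2 ·ˢ X -ˢ X ^ˢ 2 -ˢ (1ˢ -ˢ X) *ˢ √ˢ 1-2X-3X²)
  generating-function = begin
    ι 2 ·ˢ X ^ˢ 2 *ˢ √ˢ 1-2X-3X² *ˢ Eˢ
      ≈⟨ *ˢ-cong (*ˢ-cong (λ n → trans (·ˢ≗const (ι 2) (X ^ˢ 2) n) (*ˢ-cong {k 2} ≗-refl X²≗X*X n)) √≗s)
           (λ n → trans (+-minus (Eˢ n) ((mˢ +ˢ X *ˢ mˢ) n)) (cong (ℚ._- (mˢ +ˢ X *ˢ mˢ) n) (E+m n))) ⟩
    k 2 *ˢ (X *ˢ X) *ˢ s *ˢ (eˢ -ˢ (mˢ +ˢ X *ˢ mˢ))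
      ≈⟨ solve 4 (λ x s e m → con (ι 2) :* (x :* x) :* s :* (e :- (m :+ x :* m)) :=
           con (ι 2) :* (x :* x) :* (s :* e) :+ (con (ι 1) :+ x) :* s :* ((con (ι 1) :- (x :+ x :* (x :* (m :+ m)))) :- (con (ι 1) :- x)))
           ≗-refl X s eˢ mˢ ⟩
    k 2 *ˢ (X *ˢ X) *ˢ (s *ˢ eˢ) +ˢ (k 1 +ˢ X) *ˢ s *ˢ ((k 1 -ˢ (X +ˢ X *ˢ (X *ˢ (mˢ +ˢ mˢ)))) -ˢ (k 1 -ˢ X))
      ≈⟨ +ˢ-cong (*ˢ-cong {k 2 *ˢ (X *ˢ X)} ≗-refl se)
           (*ˢ-cong {(k 1 +ˢ X) *ˢ s} ≗-refl (λ n → cong (ℚ._- (k 1 -ˢ X) n) (sym (s-motzkin n)))) ⟩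
    k 2 *ˢ (X *ˢ X) *ˢ (k 1 +ˢ X) +ˢ (k 1 +ˢ X) *ˢ s *ˢ (s -ˢ (k 1 -ˢ X))
      ≈⟨ solve 2 (λ x s → con (ι 2) :* (x :* x) :* (con (ι 1) :+ x) :+ (con (ι 1) :+ x) :* s :* (s :- (con (ι 1) :- x)) :=
           (con (ι 1) :+ x) :* (con (ι 2) :* (x :* x) :+ s :* s :- (con (ι 1) :- x) :* s)) ≗-refl X s ⟩
    (k 1 +ˢ X) *ˢ (k 2 *ˢ (X *ˢ X) +ˢ s *ˢ s -ˢ (k 1 -ˢ X) *ˢ s)
      ≈⟨ *ˢ-cong {k 1 +ˢ X} ≗-refl (λ n → cong (λ z → (k 2 *ˢ (X *ˢ X)) n + z ℚ.- ((k 1 -ˢ X) *ˢ s) n) (s² n)) ⟩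
    (k 1 +ˢ X) *ˢ (k 2 *ˢ (X *ˢ X) +ˢ Q -ˢ (k 1 -ˢ X) *ˢ s)
      ≈⟨ solve 2 (λ x s → (con (ι 1) :+ x) :* (con (ι 2) :* (x :* x) :+ (con (ι 1) :- con (ι 2) :* x :- con (ι 3) :* (x :* x)) :- (con (ι 1) :- x) :* s) :=
           (con (ι 1) :+ x) :* (con (ι 1) :- con (ι 2) :* x :- x :* x :- (con (ι 1) :- x) :* s)) ≗-refl X s ⟩
    (k 1 +ˢ X) *ˢ (k 1 -ˢ k 2 *ˢ X -ˢ X *ˢ X -ˢ (k 1 -ˢ X) *ˢ s)
      ≈⟨ *ˢ-cong (λ n → cong (_+ X n) (sym (1ˢ≗const n)))
           (λ n → cong₂ (λ x y → x ℚ.- y)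
             (cong₂ (λ x y → x ℚ.- y) (cong₂ (λ x y → x ℚ.- y) (sym (1ˢ≗const n)) (sym (·ˢ≗const (ι 2) X n))) (sym (X²≗X*X n)))
             (*ˢ-cong (λ i → cong (ℚ._- X i) (sym (1ˢ≗const i))) (λ i → sym (√≗s i)) n)) ⟩
    (1ˢ +ˢ X) *ˢ (1ˢ -ˢ ι 2 ·ˢ X -ˢ X ^ˢ 2 -ˢ (1ˢ -ˢ X) *ˢ √ˢ 1-2X-3X²) ∎
    where
    +-minus : ∀ a b → a ≡ a + b ℚ.- b
    +-minus = ℚS.solve 2 (λ a b → a ℚS.:= a ℚS.:+ b ℚS.:- b) refl
      where module ℚS = +-*-Solver

-- The square of the derivative of the series of `e`.

module DerivativeSquare where
  open import Data.Rational.Base using (_+_; _*_)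
  open Embedding
  open PowerSeries
  open Trinomials using (e; e-rec)
  open Convolution using (conv)
  open Series
  open Solver
  open import Relation.Binary.Reasoning.Setoid (CommutativeRing.setoid +ˢ-*ˢ-commutativeRing)

  g : ℕ → ℕ
  g n = suc n ℕ.* e (suc n)

  2e+ : gˢ ≗ X *ˢ gˢ +ˢ X *ˢ gˢ +ˢ X *ˢ (X *ˢ (gˢ +ˢ (gˢ +ˢ gˢ))) +ˢ (eˢ +ˢ eˢ)
  2e+ zero          = refl
  2e+ (suc zero)    = refl
  2e+ (suc (suc n)) = sym (≡.begin
    (X *ˢ gˢ) (2 ℕ.+ n) + (X *ˢ gˢ) (2 ℕ.+ n) + (X *ˢ (X *ˢ (gˢ +ˢ (gˢ +ˢ gˢ)))) (2 ℕ.+ n) + (eˢ (2 ℕ.+ n) + eˢ (2 ℕ.+ n))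
      ≡.≡⟨ cong₂ (λ x y → x + x + y + (eˢ (2 ℕ.+ n) + eˢ (2 ℕ.+ n))) (X*-suc gˢ (suc n)) (XX*-suc (gˢ +ˢ (gˢ +ˢ gˢ)) n) ⟩
    ι a + ι a + (ι b + (ι b + ι b)) + (ι c + ι c)
      ≡.≡⟨ cong₂ (λ x y → x + y + (ι c + ι c)) (ι-+ a a) (trans (ι-+ b (b ℕ.+ b)) (cong (ι b +_) (ι-+ b b))) ⟨
    ι (a ℕ.+ a) + ι (b ℕ.+ (b ℕ.+ b)) + (ι c + ι c)
      ≡.≡⟨ trans (ι-+ (a ℕ.+ a ℕ.+ (b ℕ.+ (b ℕ.+ b))) (c ℕ.+ c)) (cong₂ _+_ (ι-+ (a ℕ.+ a) _) (ι-+ c c)) ⟨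
    ι (a ℕ.+ a ℕ.+ (b ℕ.+ (b ℕ.+ b)) ℕ.+ (c ℕ.+ c))
      ≡.≡⟨ cong ι (trans (lemma n (e (2 ℕ.+ n)) (e (1 ℕ.+ n))) (sym (e-rec (suc n)))) ⟩
    gˢ (2 ℕ.+ n) ≡.∎)
    where
    module ≡ = ≡-Reasoning
    a = (2 ℕ.+ n) ℕ.* e (2 ℕ.+ n)
    b = (1 ℕ.+ n) ℕ.* e (1 ℕ.+ n)
    c = e (2 ℕ.+ n)
    lemma : ∀ n e₂ e₁ → let a = (2 ℕ.+ n) ℕ.* e₂; b = (1 ℕ.+ n) ℕ.* e₁ in
      a ℕ.+ a ℕ.+ (b ℕ.+ (b ℕ.+ b)) ℕ.+ (e₂ ℕ.+ e₂) ≡ 2 ℕ.* (2 ℕ.+ suc n) ℕ.* e₂ ℕ.+ 3 ℕ.* suc n ℕ.* e₁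
    lemma = solve-∀

  -- g is the derivative of e, so that (1 - 3 x) (1 + x) g = 2 e.
  derivative : P *ˢ (k 1 +ˢ X) *ˢ gˢ ≗ eˢ +ˢ eˢ
  derivative = begin
    P *ˢ (k 1 +ˢ X) *ˢ gˢ
      ≈⟨ solve 2 (λ x g → (con (ι 1) :- con (ι 3) :* x) :* (con (ι 1) :+ x) :* g :=
           g :- (x :* g :+ x :* g :+ x :* (x :* (g :+ (g :+ g))))) ≗-refl X gˢ ⟩
    gˢ -ˢ y
      ≈⟨ (λ n → cong (ℚ._- y n) (2e+ n)) ⟩
    y +ˢ (eˢ +ˢ eˢ) -ˢ y
      ≈⟨ solve 2 (λ y e → y :+ (e :+ e) :- y := e :+ e) ≗-refl y eˢ ⟩
    eˢ +ˢ eˢ ∎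
    where y = X *ˢ gˢ +ˢ X *ˢ gˢ +ˢ X *ˢ (X *ˢ (gˢ +ˢ (gˢ +ˢ gˢ)))

  -- The coefficients of 4 / (1 - 3x)^k for k = 0, 1, 2, 3.
  z₀ z₁ z₂ z₃ : ℕ → ℕ
  z₀ zero    = 4
  z₀ (suc n) = 0
  z₁ n = 4 ℕ.* 3 ^ n
  z₂ n = 4 ℕ.* suc n ℕ.* 3 ^ n
  z₃ n = 2 ℕ.* (suc n ℕ.* suc (suc n)) ℕ.* 3 ^ n

  geometric : ∀ (f h : ℕ → ℕ) → f 0 ≡ h 0 → (∀ n → f (suc n) ≡ h (suc n) ℕ.+ 3 ℕ.* f n) →
    P *ˢ (ι ∘ f) ≗ ι ∘ h
  geometric f h f₀ f₊ = begin
    P *ˢ (ι ∘ f)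
      ≈⟨ solve 2 (λ x f → (con (ι 1) :- con (ι 3) :* x) :* f := f :- con (ι 3) :* (x :* f)) ≗-refl X (ι ∘ f) ⟩
    (ι ∘ f) -ˢ k 3 *ˢ (X *ˢ (ι ∘ f))
      ≈⟨ (λ n → cong (ℚ._- (k 3 *ˢ (X *ˢ (ι ∘ f))) n) (recurrence n)) ⟩
    (ι ∘ h) +ˢ k 3 *ˢ (X *ˢ (ι ∘ f)) -ˢ k 3 *ˢ (X *ˢ (ι ∘ f))
      ≈⟨ solve 2 (λ h y → h :+ y :- y := h) ≗-refl (ι ∘ h) (k 3 *ˢ (X *ˢ (ι ∘ f))) ⟩
    ι ∘ h ∎
    where
    recurrence : ι ∘ f ≗ (ι ∘ h) +ˢ k 3 *ˢ (X *ˢ (ι ∘ f))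
    recurrence zero    = trans (cong ι f₀) (sym (trans (cong (ι (h 0) +_) (trans (sym (·ˢ≗const (ι 3) (X *ˢ (ι ∘ f)) 0))
      (trans (cong (ι 3 *_) (X*-zero (ι ∘ f))) (ℚ.*-zeroʳ (ι 3))))) (ℚ.+-identityʳ (ι (h 0)))))
    recurrence (suc n) = trans (cong ι (f₊ n)) (trans (ι-+ (h (suc n)) (3 ℕ.* f n))
      (cong (ι (h (suc n)) +_) (trans (ι-* 3 (f n)) (sym (trans (sym (·ˢ≗const (ι 3) (X *ˢ (ι ∘ f)) (suc n)))
        (cong (ι 3 *_) (X*-suc (ι ∘ f) n)))))))

  Pz₁ : P *ˢ (ι ∘ z₁) ≗ k 4
  Pz₁ n = trans (geometric z₁ z₀ refl (λ n → lemma (3 ^ n)) n) (z₀≗4 n)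
    where
    lemma : ∀ p → 4 ℕ.* (3 ℕ.* p) ≡ 3 ℕ.* (4 ℕ.* p)
    lemma = solve-∀
    z₀≗4 : ∀ n → ι (z₀ n) ≡ k 4 n
    z₀≗4 zero    = refl
    z₀≗4 (suc n) = refl

  Pz₂ : P *ˢ (ι ∘ z₂) ≗ ι ∘ z₁
  Pz₂ = geometric z₂ z₁ refl (λ n → lemma n (3 ^ n))
    where
    lemma : ∀ n p → 4 ℕ.* (2 ℕ.+ n) ℕ.* (3 ℕ.* p) ≡ 4 ℕ.* (3 ℕ.* p) ℕ.+ 3 ℕ.* (4 ℕ.* (1 ℕ.+ n) ℕ.* p)
    lemma = solve-∀

  Pz₃ : P *ˢ (ι ∘ z₃) ≗ ι ∘ z₂
  Pz₃ = geometric z₃ z₂ refl (λ n → lemma n (3 ^ n))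
    where
    lemma : ∀ n p → 2 ℕ.* ((2 ℕ.+ n) ℕ.* (3 ℕ.+ n)) ℕ.* (3 ℕ.* p) ≡
      4 ℕ.* (2 ℕ.+ n) ℕ.* (3 ℕ.* p) ℕ.+ 3 ℕ.* (2 ℕ.* ((1 ℕ.+ n) ℕ.* (2 ℕ.+ n)) ℕ.* p)
    lemma = solve-∀

  -- By `derivative`, (P (1 + x) g)² = 4e², and one more factor P turns P e e into s e = 1 + x.
  -- Keeping 1 + x on the left avoids the alternating part of a partial fraction expansion.
  square : (k 1 +ˢ X) *ˢ (gˢ *ˢ gˢ) ≗ ι ∘ z₃
  square = *ˢ-cancelʳ (P *ˢ P *ˢ P *ˢ (k 1 +ˢ X)) refl (begin
    (k 1 +ˢ X) *ˢ (gˢ *ˢ gˢ) *ˢ (P *ˢ P *ˢ P *ˢ (k 1 +ˢ X))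
      ≈⟨ solve 3 (λ x g p → (con (ι 1) :+ x) :* (g :* g) :* (p :* p :* p :* (con (ι 1) :+ x)) :=
           p :* ((p :* (con (ι 1) :+ x) :* g) :* (p :* (con (ι 1) :+ x) :* g))) ≗-refl X gˢ P ⟩
    P *ˢ ((P *ˢ (k 1 +ˢ X) *ˢ gˢ) *ˢ (P *ˢ (k 1 +ˢ X) *ˢ gˢ))
      ≈⟨ *ˢ-cong {P} ≗-refl (*ˢ-cong derivative derivative) ⟩
    P *ˢ ((eˢ +ˢ eˢ) *ˢ (eˢ +ˢ eˢ))
      ≈⟨ solve 2 (λ p e → p :* ((e :+ e) :* (e :+ e)) := con (ι 4) :* (p :* e :* e)) ≗-refl P eˢ ⟩
    k 4 *ˢ (s *ˢ eˢ)
      ≈⟨ *ˢ-cong (λ n → sym (cubed n)) se ⟩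
    (P *ˢ (P *ˢ (P *ˢ (ι ∘ z₃)))) *ˢ (k 1 +ˢ X)
      ≈⟨ solve 3 (λ x p z → p :* (p :* (p :* z)) :* (con (ι 1) :+ x) := z :* (p :* p :* p :* (con (ι 1) :+ x))) ≗-refl X P (ι ∘ z₃) ⟩
    (ι ∘ z₃) *ˢ (P *ˢ P *ˢ P *ˢ (k 1 +ˢ X)) ∎)
    where
    cubed : P *ˢ (P *ˢ (P *ˢ (ι ∘ z₃))) ≗ k 4
    cubed = begin
      P *ˢ (P *ˢ (P *ˢ (ι ∘ z₃)))  ≈⟨ *ˢ-cong {P} ≗-refl (*ˢ-cong {P} ≗-refl Pz₃) ⟩
      P *ˢ (P *ˢ (ι ∘ z₂))         ≈⟨ *ˢ-cong {P} ≗-refl Pz₂ ⟩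
      P *ˢ (ι ∘ z₁)                ≈⟨ Pz₁ ⟩
      k 4                          ∎

  W : ℕ → ℕ
  W = conv g g

  W-recurrence : ∀ n → W (suc n) ℕ.+ W n ≡ z₃ (suc n)
  W-recurrence n = ι-injective (trans (ι-+ (W (suc n)) (W n)) (trans
    (sym (trans (solve 2 (λ x y → (con (ι 1) :+ x) :* y := y :+ x :* y) ≗-refl X (gˢ *ˢ gˢ) (suc n))
      (cong₂ _+_ (*ˢ-ι g g (suc n)) (trans (X*-suc (gˢ *ˢ gˢ) n) (*ˢ-ι g g n)))))
    (square (suc n))))


-- Bounds for the convolution `W` by perfect squares.

module SquareBounds where
  open import Data.Nat.Base using (_+_; _*_; _≤_)
  open DerivativeSquare using (W; z₃; W-recurrence)

  -- As W n + W (n + 1) is known exactly, each bound at n gives the other one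
  -- at n + 1.
  W-bounds : ∀ n → 3 ^ suc n * (suc n * suc n) ≤ 2 * W n × 2 * W n ≤ 3 ^ suc n * ((2 + n) * (2 + n))
  -- The two squares bracket (1 + n) (2 + n), the factor that the triple pole at 1/3 contributes to
  -- `2 * W n` beside 3^(n + 1).
  W-bounds zero    = ℕ.≤ᵇ⇒≤ 3 8 _ , ℕ.≤ᵇ⇒≤ 8 12 _
  W-bounds (suc n) with W-bounds n
  ... | lower , upper =
    ℕ.+-cancelʳ-≤ (2 * W n) _ _ (begin
      3 * (3 * p) * ((2 + n) * (2 + n)) + 2 * W n
        ≤⟨ ℕ.+-monoʳ-≤ (3 * (3 * p) * ((2 + n) * (2 + n))) upper ⟩
      3 * (3 * p) * ((2 + n) * (2 + n)) + 3 * p * ((2 + n) * (2 + n))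
        ≤⟨ ℕ.m≤m+n _ _ ⟩
      3 * (3 * p) * ((2 + n) * (2 + n)) + 3 * p * ((2 + n) * (2 + n)) + 12 * ((2 + n) * p)
        ≡⟨ lemma₁ n p ⟩
      2 * z₃ (suc n)
        ≡⟨ W+W ⟨
      2 * W (suc n) + 2 * W n ∎) ,
    ℕ.+-cancelʳ-≤ (2 * W n) _ _ (begin
      2 * W (suc n) + 2 * W n
        ≡⟨ W+W ⟩
      2 * z₃ (suc n)
        ≤⟨ ℕ.m≤m+n _ _ ⟩
      2 * z₃ (suc n) + 12 * p
        ≡⟨ lemma₂ n p ⟩
      3 * (3 * p) * ((3 + n) * (3 + n)) + 3 * p * ((1 + n) * (1 + n))
        ≤⟨ ℕ.+-monoʳ-≤ (3 * (3 * p) * ((3 + n) * (3 + n))) lower ⟩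
      3 * (3 * p) * ((3 + n) * (3 + n)) + 2 * W n ∎)
    where
    open ℕ.≤-Reasoning
    p = 3 ^ n
    W+W : 2 * W (suc n) + 2 * W n ≡ 2 * z₃ (suc n)
    W+W = trans (sym (ℕ.*-distribˡ-+ 2 (W (suc n)) (W n))) (cong (2 *_) (W-recurrence n))
    lemma₁ : ∀ n p → 3 * (3 * p) * ((2 + n) * (2 + n)) + 3 * p * ((2 + n) * (2 + n)) + 12 * ((2 + n) * p) ≡
      2 * (2 * ((2 + n) * (3 + n)) * (3 * p))
    lemma₁ = solve-∀
    lemma₂ : ∀ n p → 2 * (2 * ((2 + n) * (3 + n)) * (3 * p)) + 12 * p ≡
      3 * (3 * p) * ((3 + n) * (3 + n)) + 3 * p * ((1 + n) * (1 + n))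
    lemma₂ = solve-∀

-- Two-sided control of the growth of `e`, without limits.

module Growth where
  open import Data.Nat.Base using (_+_; _*_; _∸_; _≤_)
  open Trinomials using (e; e-rec)
  open ℕ.≤-Reasoning

  -- Both bounds on e(n + 1) / e(n) agree with 3 (1 - 1 / (2n)) to first order. They suffice for the
  -- monotonicity below, since (n + 1) (4n + 1)² exceeds n (4n + 3)² by 1 and (n + 1) (2n + 2)²
  -- exceeds (n + 2) (2n + 1)² by 3n + 2.
  Lower Upper : ℕ → Set
  Lower n = 3 * (4 * n + 1) * e n ≤ (4 * n + 3) * e (suc n)
  Upper n = (2 * n + 2) * e (suc n) ≤ 3 * (2 * n + 1) * e n

  -- The recurrence turns an upper bound on e (n + 1) / e n into a lower bound
  -- on e (n + 2) / e (n + 1), and conversely.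
  lower-step : ∀ k x y z → let n = 3 + k in (2 + n) * z ≡ 2 * (2 + n) * y + 3 * n * x →
    (2 * n + 2) * y ≤ 3 * (2 * n + 1) * x → 3 * (4 * suc n + 1) * y ≤ (4 * suc n + 3) * z
  lower-step k x y z rec upper = ℕ.*-cancelˡ-≤ ((2 + n) * (2 * n + 1)) (begin
    (2 + n) * (2 * n + 1) * (3 * (4 * suc n + 1) * y)
      ≤⟨ ℕ.m≤m+n _ (suc k * y) ⟩
    (2 + n) * (2 * n + 1) * (3 * (4 * suc n + 1) * y) + suc k * y
      ≡⟨ lemma₁ k y ⟩
    (4 * suc n + 3) * (2 * ((2 * n + 1) * (2 + n)) * y + n * ((2 * n + 2) * y))
      ≤⟨ ℕ.*-monoʳ-≤ (4 * suc n + 3) (ℕ.+-monoʳ-≤ (2 * ((2 * n + 1) * (2 + n)) * y) (ℕ.*-monoʳ-≤ n upper)) ⟩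
    (4 * suc n + 3) * (2 * ((2 * n + 1) * (2 + n)) * y + n * (3 * (2 * n + 1) * x))
      ≡⟨ lemma₂ k x y ⟩
    (4 * suc n + 3) * (2 * n + 1) * (2 * (2 + n) * y + 3 * n * x)
      ≡⟨ cong ((4 * suc n + 3) * (2 * n + 1) *_) rec ⟨
    (4 * suc n + 3) * (2 * n + 1) * ((2 + n) * z)
      ≡⟨ lemma₃ k z ⟩
    (2 + n) * (2 * n + 1) * ((4 * suc n + 3) * z) ∎)
    where
    n = 3 + k
    lemma₁ : ∀ k y → (2 + (3 + k)) * (2 * (3 + k) + 1) * (3 * (4 * (4 + k) + 1) * y) + (1 + k) * y ≡
      (4 * (4 + k) + 3) * (2 * ((2 * (3 + k) + 1) * (2 + (3 + k))) * y + (3 + k) * ((2 * (3 + k) + 2) * y))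
    lemma₁ = solve-∀
    lemma₂ : ∀ k x y → (4 * (4 + k) + 3) * (2 * ((2 * (3 + k) + 1) * (2 + (3 + k))) * y + (3 + k) * (3 * (2 * (3 + k) + 1) * x)) ≡
      (4 * (4 + k) + 3) * (2 * (3 + k) + 1) * (2 * (2 + (3 + k)) * y + 3 * (3 + k) * x)
    lemma₂ = solve-∀
    lemma₃ : ∀ k z → (4 * (4 + k) + 3) * (2 * (3 + k) + 1) * ((2 + (3 + k)) * z) ≡ (2 + (3 + k)) * (2 * (3 + k) + 1) * ((4 * (4 + k) + 3) * z)
    lemma₃ = solve-∀

  upper-step : ∀ k x y z → let n = 3 + k in (2 + n) * z ≡ 2 * (2 + n) * y + 3 * n * x →
    3 * (4 * n + 1) * x ≤ (4 * n + 3) * y → (2 * suc n + 2) * z ≤ 3 * (2 * suc n + 1) * y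
  upper-step k x y z rec lower = ℕ.*-cancelˡ-≤ ((2 + n) * (4 * n + 1)) (begin
    (2 + n) * (4 * n + 1) * ((2 * suc n + 2) * z)
      ≡⟨ lemma₁ k z ⟩
    (2 * suc n + 2) * (4 * n + 1) * ((2 + n) * z)
      ≡⟨ cong ((2 * suc n + 2) * (4 * n + 1) *_) rec ⟩
    (2 * suc n + 2) * (4 * n + 1) * (2 * (2 + n) * y + 3 * n * x)
      ≡⟨ lemma₂ k x y ⟩
    (2 * suc n + 2) * (2 * ((4 * n + 1) * (2 + n)) * y + n * (3 * (4 * n + 1) * x))
      ≤⟨ ℕ.*-monoʳ-≤ (2 * suc n + 2) (ℕ.+-monoʳ-≤ (2 * ((4 * n + 1) * (2 + n)) * y) (ℕ.*-monoʳ-≤ n lower)) ⟩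
    (2 * suc n + 2) * (2 * ((4 * n + 1) * (2 + n)) * y + n * ((4 * n + 3) * y))
      ≤⟨ ℕ.m≤m+n _ ((5 + k) * y) ⟩
    (2 * suc n + 2) * (2 * ((4 * n + 1) * (2 + n)) * y + n * ((4 * n + 3) * y)) + (5 + k) * y
      ≡⟨ lemma₃ k y ⟩
    (2 + n) * (4 * n + 1) * (3 * (2 * suc n + 1) * y) ∎)
    where
    n = 3 + k
    lemma₁ : ∀ k z → (2 + (3 + k)) * (4 * (3 + k) + 1) * ((2 * (4 + k) + 2) * z) ≡ (2 * (4 + k) + 2) * (4 * (3 + k) + 1) * ((2 + (3 + k)) * z)
    lemma₁ = solve-∀
    lemma₂ : ∀ k x y → (2 * (4 + k) + 2) * (4 * (3 + k) + 1) * (2 * (2 + (3 + k)) * y + 3 * (3 + k) * x) ≡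
      (2 * (4 + k) + 2) * (2 * ((4 * (3 + k) + 1) * (2 + (3 + k))) * y + (3 + k) * (3 * (4 * (3 + k) + 1) * x))
    lemma₂ = solve-∀
    lemma₃ : ∀ k y → (2 * (4 + k) + 2) * (2 * ((4 * (3 + k) + 1) * (2 + (3 + k))) * y + (3 + k) * ((4 * (3 + k) + 3) * y)) + (5 + k) * y ≡
      (2 + (3 + k)) * (4 * (3 + k) + 1) * (3 * (2 * (4 + k) + 1) * y)
    lemma₃ = solve-∀

  ratio-bounds : ∀ k → Lower (3 + k) × Upper (3 + k)
  -- The values are e(3) = 10 and e(4) = 26.
  ratio-bounds zero    = ℕ.≤ᵇ⇒≤ 390 390 _ , ℕ.≤ᵇ⇒≤ 208 210 _
  ratio-bounds (suc k) = let lower , upper = ratio-bounds k ; n = 3 + k in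
    lower-step k (e n) (e (suc n)) (e (2 + n)) (e-rec n) upper ,
    upper-step k (e n) (e (suc n)) (e (2 + n)) (e-rec n) lower

  sq : ℕ → ℕ
  sq n = n * n

  sq-mono : ∀ {m n} → m ≤ n → sq m ≤ sq n
  sq-mono m≤n = ℕ.*-mono-≤ m≤n m≤n

  sq-cancel : ∀ m n → sq m ≤ sq n → m ≤ n
  sq-cancel m n m²≤n² = ℕ.≮⇒≥ λ n<m → ℕ.<⇒≱ (ℕ.*-mono-< n<m n<m) m²≤n²

  E : ℕ → ℕ
  E k = e (3 + k)

  increase : ∀ k → 9 * ((3 + k) * sq (E k)) ≤ (4 + k) * sq (E (suc k))
  increase k = ℕ.*-cancelˡ-≤ (sq (4 * n + 3)) (begin
    sq (4 * n + 3) * (9 * (n * sq x))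
      ≤⟨ ℕ.m≤m+n _ (9 * sq x) ⟩
    sq (4 * n + 3) * (9 * (n * sq x)) + 9 * sq x
      ≡⟨ lemma₁ n x ⟩
    suc n * sq (3 * (4 * n + 1) * x)
      ≤⟨ ℕ.*-monoʳ-≤ (suc n) (sq-mono (proj₁ (ratio-bounds k))) ⟩
    suc n * sq ((4 * n + 3) * y)
      ≡⟨ lemma₂ n y ⟩
    sq (4 * n + 3) * (suc n * sq y) ∎)
    where
    n = 3 + k
    x = E k
    y = E (suc k)
    lemma₁ : ∀ n x → (4 * n + 3) * (4 * n + 3) * (9 * (n * (x * x))) + 9 * (x * x) ≡ suc n * (3 * (4 * n + 1) * x * (3 * (4 * n + 1) * x))
    lemma₁ = solve-∀
    lemma₂ : ∀ n y → suc n * ((4 * n + 3) * y * ((4 * n + 3) * y)) ≡ (4 * n + 3) * (4 * n + 3) * (suc n * (y * y))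
    lemma₂ = solve-∀

  decrease : ∀ k → (5 + k) * sq (E (suc k)) ≤ 9 * ((4 + k) * sq (E k))
  decrease k = ℕ.*-cancelˡ-≤ (sq (2 * n + 2)) (begin
    sq (2 * n + 2) * ((2 + n) * sq y)
      ≡⟨ lemma₁ n y ⟩
    (2 + n) * sq ((2 * n + 2) * y)
      ≤⟨ ℕ.*-monoʳ-≤ (2 + n) (sq-mono (proj₂ (ratio-bounds k))) ⟩
    (2 + n) * sq (3 * (2 * n + 1) * x)
      ≤⟨ ℕ.m≤m+n _ (9 * ((3 * n + 2) * sq x)) ⟩
    (2 + n) * sq (3 * (2 * n + 1) * x) + 9 * ((3 * n + 2) * sq x)
      ≡⟨ lemma₂ n x ⟩
    sq (2 * n + 2) * (9 * (suc n * sq x)) ∎)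
    where
    n = 3 + k
    x = E k
    y = E (suc k)
    lemma₁ : ∀ n y → (2 * n + 2) * (2 * n + 2) * ((2 + n) * (y * y)) ≡ (2 + n) * ((2 * n + 2) * y * ((2 * n + 2) * y))
    lemma₁ = solve-∀
    lemma₂ : ∀ n x → (2 + n) * (3 * (2 * n + 1) * x * (3 * (2 * n + 1) * x)) + 9 * ((3 * n + 2) * (x * x)) ≡
      (2 * n + 2) * (2 * n + 2) * (9 * (suc n * (x * x)))
    lemma₂ = solve-∀

  increasing : ∀ k d → (3 + k) * sq (E k) * 9 ^ d ≤ (3 + (d + k)) * sq (E (d + k))
  increasing k zero    = ℕ.≤-reflexive (ℕ.*-identityʳ _)
  increasing k (suc d) = begin
    (3 + k) * sq (E k) * (9 * 9 ^ d)       ≡⟨ lemma ((3 + k) * sq (E k)) (9 ^ d) ⟩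
    9 * ((3 + k) * sq (E k) * 9 ^ d)       ≤⟨ ℕ.*-monoʳ-≤ 9 (increasing k d) ⟩
    9 * ((3 + (d + k)) * sq (E (d + k)))   ≤⟨ increase (d + k) ⟩
    (4 + (d + k)) * sq (E (suc (d + k)))   ∎
    where
    lemma : ∀ a b → a * (9 * b) ≡ 9 * (a * b)
    lemma = solve-∀

  decreasing : ∀ k d → (4 + (d + k)) * sq (E (d + k)) ≤ (4 + k) * sq (E k) * 9 ^ d
  decreasing k zero    = ℕ.≤-reflexive (sym (ℕ.*-identityʳ _))
  decreasing k (suc d) = begin
    (5 + (d + k)) * sq (E (suc (d + k)))   ≤⟨ decrease (d + k) ⟩
    9 * ((4 + (d + k)) * sq (E (d + k)))   ≤⟨ ℕ.*-monoʳ-≤ 9 (decreasing k d) ⟩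
    9 * ((4 + k) * sq (E k) * 9 ^ d)       ≡⟨ lemma ((4 + k) * sq (E k)) (9 ^ d) ⟩
    (4 + k) * sq (E k) * (9 * 9 ^ d)       ∎
    where
    lemma : ∀ a b → 9 * (a * b) ≡ a * (9 * b)
    lemma = solve-∀

  -- n e² / 9^n increases and (n + 1) e² / 9^n decreases (from n = 3 on), so
  -- every value of the former is below every value of the latter.
  separated : ∀ k j → (3 + k) * sq (E k) * 9 ^ j ≤ (4 + j) * sq (E j) * 9 ^ k
  separated k j with ℕ.≤-total k j
  ... | inj₁ k≤j = subst (λ j → (3 + k) * sq (E k) * 9 ^ j ≤ (4 + j) * sq (E j) * 9 ^ k) (ℕ.m∸n+n≡m k≤j) (above (j ∸ k))
    where
    above : ∀ d → (3 + k) * sq (E k) * 9 ^ (d + k) ≤ (4 + (d + k)) * sq (E (d + k)) * 9 ^ k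
    above d = begin
      (3 + k) * sq (E k) * 9 ^ (d + k)           ≡⟨ cong ((3 + k) * sq (E k) *_) (ℕ.^-distribˡ-+-* 9 d k) ⟩
      (3 + k) * sq (E k) * (9 ^ d * 9 ^ k)       ≡⟨ ℕ.*-assoc ((3 + k) * sq (E k)) (9 ^ d) (9 ^ k) ⟨
      (3 + k) * sq (E k) * 9 ^ d * 9 ^ k         ≤⟨ ℕ.*-monoˡ-≤ (9 ^ k) (increasing k d) ⟩
      (3 + (d + k)) * sq (E (d + k)) * 9 ^ k     ≤⟨ ℕ.*-monoˡ-≤ (9 ^ k) (ℕ.*-monoˡ-≤ (sq (E (d + k))) (ℕ.n≤1+n (3 + (d + k)))) ⟩
      (4 + (d + k)) * sq (E (d + k)) * 9 ^ k     ∎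
  ... | inj₂ j≤k = subst (λ k → (3 + k) * sq (E k) * 9 ^ j ≤ (4 + j) * sq (E j) * 9 ^ k) (ℕ.m∸n+n≡m j≤k) (below (k ∸ j))
    where
    below : ∀ d → (3 + (d + j)) * sq (E (d + j)) * 9 ^ j ≤ (4 + j) * sq (E j) * 9 ^ (d + j)
    below d = begin
      (3 + (d + j)) * sq (E (d + j)) * 9 ^ j     ≤⟨ ℕ.*-monoˡ-≤ (9 ^ j) (ℕ.*-monoˡ-≤ (sq (E (d + j))) (ℕ.n≤1+n (3 + (d + j)))) ⟩
      (4 + (d + j)) * sq (E (d + j)) * 9 ^ j     ≤⟨ ℕ.*-monoˡ-≤ (9 ^ j) (decreasing j d) ⟩
      (4 + j) * sq (E j) * 9 ^ d * 9 ^ j         ≡⟨ ℕ.*-assoc ((4 + j) * sq (E j)) (9 ^ d) (9 ^ j) ⟩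
      (4 + j) * sq (E j) * (9 ^ d * 9 ^ j)       ≡⟨ cong ((4 + j) * sq (E j) *_) (ℕ.^-distribˡ-+-* 9 d j) ⟨
      (4 + j) * sq (E j) * 9 ^ (d + j)           ∎

  open DerivativeSquare using (g)

  module _ (j : ℕ) where
    m c C : ℕ
    m = 3 + j
    c = m * sq (E j)
    C = suc m * sq (E j)

    9^[3+n] : ∀ n → 9 ^ (3 + n) ≡ 729 * 9 ^ n
    9^[3+n] = ℕ.^-distribˡ-+-* 9 3

    a*9^m : ∀ a → a * 9 ^ m ≡ a * 729 * 9 ^ j
    a*9^m a = trans (cong (a *_) (9^[3+n] j)) (sym (ℕ.*-assoc a 729 (9 ^ j)))

    swap : ∀ a b C → a * b * C ≡ a * C * b
    swap = solve-∀

    -- Here g(i)² is i + 1 times (i + 1) e(i + 1)², to which `separated` applies once i ≥ 2. The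
    -- weaker factor `2 + i` admits the small indices too: at i = 0 the factor 1 would be too small.
    -- There `separated` enters with E(0) = 10, whence the 300.
    g-upper : ∀ i → sq (g i) * 9 ^ m ≤ (2 + i) * C * 9 ^ suc i
    g-upper zero          = begin
      4 * 9 ^ m              ≡⟨ a*9^m 4 ⟩
      2916 * 9 ^ j           ≤⟨ ℕ.*-monoˡ-≤ (9 ^ j) (ℕ.≤ᵇ⇒≤ 2916 5400 _) ⟩
      5400 * 9 ^ j           ≡⟨ ℕ.*-assoc 18 300 (9 ^ j) ⟩
      18 * (300 * 9 ^ j)     ≤⟨ ℕ.*-monoʳ-≤ 18 (separated 0 j) ⟩
      18 * (C * 1)           ≡⟨ cong (18 *_) (ℕ.*-identityʳ C) ⟩
      2 * 9 * C              ≡⟨ swap 2 9 C ⟩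
      2 * C * 9              ∎
    g-upper (suc zero)    = begin
      64 * 9 ^ m             ≡⟨ a*9^m 64 ⟩
      46656 * 9 ^ j          ≤⟨ ℕ.*-monoˡ-≤ (9 ^ j) (ℕ.≤ᵇ⇒≤ 46656 72900 _) ⟩
      72900 * 9 ^ j          ≡⟨ ℕ.*-assoc 243 300 (9 ^ j) ⟩
      243 * (300 * 9 ^ j)    ≤⟨ ℕ.*-monoʳ-≤ 243 (separated 0 j) ⟩
      243 * (C * 1)          ≡⟨ cong (243 *_) (ℕ.*-identityʳ C) ⟩
      3 * 81 * C             ≡⟨ swap 3 81 C ⟩
      3 * C * 81             ∎
    g-upper (suc (suc k)) = begin
      sq ((3 + k) * E k) * 9 ^ m                    ≡⟨ cong (sq ((3 + k) * E k) *_) (9^[3+n] j) ⟩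
      sq ((3 + k) * E k) * (729 * 9 ^ j)            ≡⟨ lemma₁ k (E k) 729 (9 ^ j) ⟩
      (3 + k) * 729 * ((3 + k) * sq (E k) * 9 ^ j)  ≤⟨ ℕ.*-monoʳ-≤ ((3 + k) * 729) (separated k j) ⟩
      (3 + k) * 729 * (C * 9 ^ k)                   ≤⟨ ℕ.*-monoˡ-≤ (C * 9 ^ k) (ℕ.*-monoˡ-≤ 729 (ℕ.n≤1+n (3 + k))) ⟩
      (4 + k) * 729 * (C * 9 ^ k)                   ≡⟨ lemma₂ (4 + k) 729 C (9 ^ k) ⟩
      (4 + k) * C * (729 * 9 ^ k)                   ≡⟨ cong ((4 + k) * C *_) (9^[3+n] k) ⟨
      (4 + k) * C * 9 ^ (3 + k)                     ∎
      where
      lemma₁ : ∀ k x q p → (3 + k) * x * ((3 + k) * x) * (q * p) ≡ (3 + k) * q * ((3 + k) * (x * x) * p)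
      lemma₁ = solve-∀
      lemma₂ : ∀ a q C p → a * q * (C * p) ≡ a * C * (q * p)
      lemma₂ = solve-∀

    -- For i ≥ 2 this rests on (i + 1)² = i (i + 2) + 1, as `separated` bounds (i + 2) e(i + 1)²
    -- from below.
    g-lower : ∀ i → i * c * 9 ^ suc i ≤ sq (g i) * 9 ^ m
    g-lower zero          = z≤n
    g-lower (suc zero)    = begin
      1 * c * 81             ≡⟨ swap 1 81 c ⟨
      81 * c                 ≡⟨ cong (81 *_) (ℕ.*-identityʳ c) ⟨
      81 * (c * 1)           ≤⟨ ℕ.*-monoʳ-≤ 81 (separated j 0) ⟩
      81 * (400 * 9 ^ j)     ≡⟨ ℕ.*-assoc 81 400 (9 ^ j) ⟨
      32400 * 9 ^ j          ≤⟨ ℕ.*-monoˡ-≤ (9 ^ j) (ℕ.≤ᵇ⇒≤ 32400 46656 _) ⟩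
      46656 * 9 ^ j          ≡⟨ a*9^m 64 ⟨
      64 * 9 ^ m             ∎
    g-lower (suc (suc k)) = begin
      (2 + k) * c * 9 ^ (3 + k)                         ≡⟨ cong ((2 + k) * c *_) (9^[3+n] k) ⟩
      (2 + k) * c * (729 * 9 ^ k)                       ≡⟨ lemma₁ (2 + k) 729 c (9 ^ k) ⟨
      (2 + k) * 729 * (c * 9 ^ k)                       ≤⟨ ℕ.*-monoʳ-≤ ((2 + k) * 729) (separated j k) ⟩
      (2 + k) * 729 * ((4 + k) * sq (E k) * 9 ^ j)      ≤⟨ ℕ.m≤m+n _ (729 * (sq (E k) * 9 ^ j)) ⟩
      (2 + k) * 729 * ((4 + k) * sq (E k) * 9 ^ j) + 729 * (sq (E k) * 9 ^ j)
                                                        ≡⟨ lemma₂ k (E k) 729 (9 ^ j) ⟩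
      sq ((3 + k) * E k) * (729 * 9 ^ j)                ≡⟨ cong (sq ((3 + k) * E k) *_) (9^[3+n] j) ⟨
      sq ((3 + k) * E k) * 9 ^ m                        ∎
      where
      lemma₁ : ∀ a q C p → a * q * (C * p) ≡ a * C * (q * p)
      lemma₁ = solve-∀
      lemma₂ : ∀ k x q p → (2 + k) * q * ((4 + k) * (x * x) * p) + q * (x * x * p) ≡ (3 + k) * x * ((3 + k) * x) * (q * p)
      lemma₂ = solve-∀

    powers : ∀ i i′ → 9 ^ suc i * 9 ^ suc i′ ≡ sq (3 ^ (2 + (i + i′)))
    powers i i′ = begin-equality
      9 ^ suc i * 9 ^ suc i′              ≡⟨ ℕ.^-distribˡ-+-* 9 (suc i) (suc i′) ⟨
      9 ^ (suc i + suc i′)                ≡⟨ cong (9 ^_) (cong suc (ℕ.+-suc i i′)) ⟩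
      9 ^ (2 + (i + i′))                  ≡⟨ 9^ (2 + (i + i′)) ⟩
      sq (3 ^ (2 + (i + i′)))             ∎
      where
      9^ : ∀ n → 9 ^ n ≡ sq (3 ^ n)
      9^ zero    = refl
      9^ (suc n) = trans (cong (9 *_) (9^ n)) (lemma (3 ^ n))
        where
        lemma : ∀ p → 9 * (p * p) ≡ 3 * p * (3 * p)
        lemma = solve-∀

    -- The geometric mean of the two bounds of `g-upper`, with an integer `s` in place of √((2 + i)
    -- (2 + i′)); comparing squares avoids the root.
    product-upper : ∀ i i′ s → (2 + i) * (2 + i′) ≤ sq s → g i * g i′ * 9 ^ m ≤ C * 3 ^ (2 + (i + i′)) * s
    product-upper i i′ s ii′≤s² = sq-cancel _ _ (begin
      sq (g i * g i′ * 9 ^ m)                                   ≡⟨ lemma₁ (g i) (g i′) (9 ^ m) ⟩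
      sq (g i) * 9 ^ m * (sq (g i′) * 9 ^ m)                    ≤⟨ ℕ.*-mono-≤ (g-upper i) (g-upper i′) ⟩
      (2 + i) * C * 9 ^ suc i * ((2 + i′) * C * 9 ^ suc i′)     ≡⟨ lemma₂ (2 + i) (2 + i′) C (9 ^ suc i) (9 ^ suc i′) ⟩
      sq C * (9 ^ suc i * 9 ^ suc i′) * ((2 + i) * (2 + i′))    ≤⟨ ℕ.*-monoʳ-≤ (sq C * (9 ^ suc i * 9 ^ suc i′)) ii′≤s² ⟩
      sq C * (9 ^ suc i * 9 ^ suc i′) * sq s                    ≡⟨ cong (λ p → sq C * p * sq s) (powers i i′) ⟩
      sq C * sq (3 ^ (2 + (i + i′))) * sq s                     ≡⟨ lemma₃ C (3 ^ (2 + (i + i′))) s ⟩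
      sq (C * 3 ^ (2 + (i + i′)) * s)                           ∎)
      where
      lemma₁ : ∀ a b p → a * b * p * (a * b * p) ≡ a * a * p * (b * b * p)
      lemma₁ = solve-∀
      lemma₂ : ∀ i i′ C p q → i * C * p * (i′ * C * q) ≡ C * C * (p * q) * (i * i′)
      lemma₂ = solve-∀
      lemma₃ : ∀ a b p → a * a * (b * b) * (p * p) ≡ a * b * p * (a * b * p)
      lemma₃ = solve-∀

    product-lower : ∀ i i′ s → sq s ≤ i * i′ → c * 3 ^ (2 + (i + i′)) * s ≤ g i * g i′ * 9 ^ m
    product-lower i i′ s s²≤ii′ = sq-cancel _ _ (begin
      sq (c * 3 ^ (2 + (i + i′)) * s)                           ≡⟨ lemma₃ c (3 ^ (2 + (i + i′))) s ⟨
      sq c * sq (3 ^ (2 + (i + i′))) * sq s                     ≡⟨ cong (λ p → sq c * p * sq s) (powers i i′) ⟨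
      sq c * (9 ^ suc i * 9 ^ suc i′) * sq s                    ≤⟨ ℕ.*-monoʳ-≤ (sq c * (9 ^ suc i * 9 ^ suc i′)) s²≤ii′ ⟩
      sq c * (9 ^ suc i * 9 ^ suc i′) * (i * i′)                ≡⟨ lemma₂ i i′ c (9 ^ suc i) (9 ^ suc i′) ⟨
      i * c * 9 ^ suc i * (i′ * c * 9 ^ suc i′)                 ≤⟨ ℕ.*-mono-≤ (g-lower i) (g-lower i′) ⟩
      sq (g i) * 9 ^ m * (sq (g i′) * 9 ^ m)                    ≡⟨ lemma₁ (g i) (g i′) (9 ^ m) ⟨
      sq (g i * g i′ * 9 ^ m)                                   ∎)
      where
      lemma₁ : ∀ a b p → a * b * p * (a * b * p) ≡ a * a * p * (b * b * p)
      lemma₁ = solve-∀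
      lemma₂ : ∀ i i′ C p q → i * C * p * (i′ * C * q) ≡ C * C * (p * q) * (i * i′)
      lemma₂ = solve-∀
      lemma₃ : ∀ a b p → a * a * (b * b) * (p * p) ≡ a * b * p * (a * b * p)
      lemma₃ = solve-∀

-- The convolution `W` against the lattice cells of a disc.

module Disc where
  open import Data.Nat.Base using (_+_; _*_; _∸_; _≤_; _<_)
  open Convolution using (conv-sum)
  open DerivativeSquare using (g; W)
  open SquareBounds using (W-bounds)
  open Growth using (sq; product-upper; product-lower)
  open ℕ.≤-Reasoning

  column : ℕ → (ℕ → Bool) → ℕ
  column n p = ∑< n (indicator ∘ p)

  -- The number of true indices is at most one more than the last of them, so a downward closed `Q`
  -- reaches it; `p` need not be monotone.
  column-induction-down : ∀ n p (Q : ℕ → Set) → (∀ {s} → Q (suc s) → Q s) → Q 0 →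
    (∀ b → p b ≡ true → Q (suc b)) → Q (column n p)
  column-induction-down zero    p Q down Q₀ Q₊ = Q₀
  column-induction-down (suc n) p Q down Q₀ Q₊ with p 0 in p₀
  ... | true  = column-induction-down n (p ∘ suc) (Q ∘ suc) down (Q₊ 0 p₀) (λ b → Q₊ (suc b))
  ... | false = column-induction-down n (p ∘ suc) Q down Q₀ (λ b → down ∘ Q₊ (suc b))

  -- Dually, the number of true indices is at least the first false one, or is `n` if there is none.
  column-induction-up : ∀ n p (Q : ℕ → Set) → (∀ {s} → Q s → Q (suc s)) → Q n →
    (∀ b → p b ≡ false → Q b) → Q (column n p)
  column-induction-up zero    p Q up Qₙ Q₋ = Qₙ
  column-induction-up (suc n) p Q up Qₙ Q₋ with p 0 in p₀
  ... | true  = column-induction-up n (p ∘ suc) (Q ∘ suc) up Qₙ (λ b → Q₋ (suc b))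
  ... | false = all (Q₋ 0 p₀) (column n (p ∘ suc))
    where
    all : Q 0 → ∀ s → Q s
    all Q₀ zero    = Q₀
    all Q₀ (suc s) = up (all Q₀ s)

  column-inner : ∀ k a → a < k → sq (suc a) + sq (column k (isInner k a)) ≤ sq k
  column-inner k a a<k = column-induction-down k (isInner k a) (λ s → sq (suc a) + sq s ≤ sq k)
    (λ {s} → ℕ.≤-trans (ℕ.+-monoʳ-≤ (sq (suc a)) (ℕ.*-mono-≤ (ℕ.n≤1+n s) (ℕ.n≤1+n s))))
    (ℕ.≤-trans (ℕ.≤-reflexive (ℕ.+-identityʳ _)) (ℕ.*-mono-≤ a<k a<k))
    (λ b p → ℕ.≤ᵇ⇒≤ (sq (suc a) + sq (suc b)) (sq k) (subst (IsTrue) (sym p) _))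

  column-outer : ∀ k a → sq k ≤ sq a + sq (column k (isOuter k a))
  column-outer k a = column-induction-up k (isOuter k a) (λ s → sq k ≤ sq a + sq s)
    (λ {s} h → ℕ.≤-trans h (ℕ.+-monoʳ-≤ (sq a) (ℕ.*-mono-≤ (ℕ.n≤1+n s) (ℕ.n≤1+n s))))
    (ℕ.m≤n+m (sq k) (sq a))
    (λ b p → ℕ.≮⇒≥ λ lt → subst IsTrue p (ℕ.<⇒<ᵇ lt))

  ∑<-snoc : ∀ n f → ∑< (suc n) f ≡ ∑< n f + f n
  ∑<-snoc zero    f = ℕ.+-identityʳ (f 0)
  ∑<-snoc (suc n) f = trans (cong (f 0 +_) (∑<-snoc n (f ∘ suc))) (sym (ℕ.+-assoc (f 0) _ _))

  ∑<-reverse : ∀ n f → ∑< n f ≡ ∑< n (λ a → f (n ∸ suc a))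
  ∑<-reverse zero    f = refl
  ∑<-reverse (suc n) f = trans (∑<-snoc n f) (trans (ℕ.+-comm (∑< n f) (f n)) (cong (f n +_) (∑<-reverse n f)))

  ∑<-centre : ∀ n f → ∑< (suc (n + n)) f ≡ ∑< n (λ a → f (n ∸ suc a)) + ∑< (suc n) (λ a → f (n + a))
  ∑<-centre n f = trans (cong (λ l → ∑< l f) (sym (ℕ.+-suc n n)))
    (trans (∑<-+ n (suc n) f) (cong (_+ ∑< (suc n) (λ a → f (n + a))) (∑<-reverse n f)))

  -- (n - a) (n + a) = n² - a² turns the terms of W (2 n) into half chords of a
  -- disc of radius n.
  pair : ℕ → ℕ → ℕ
  pair n a = g (n ∸ a) * g (n + a)

  W-centre : ∀ n → W (n + n) ≡ ∑< n (pair n ∘ suc) + ∑< (suc n) (pair n)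
  W-centre n = trans (conv-sum g g (n + n)) (trans (∑<-centre n (λ k → g k * g (n + n ∸ k)))
    (cong₂ _+_ (∑<-cong n λ a a<n → cong (λ k → g (n ∸ suc a) * g k) (left (suc a) a<n))
               (∑<-cong (suc n) λ a _ → trans (cong (λ k → g (n + a) * g k) (right a)) (ℕ.*-comm (g (n + a)) _))))
    where
    left : ∀ a → a ≤ n → n + n ∸ (n ∸ a) ≡ n + a
    left a a≤n = trans (ℕ.+-∸-assoc n (ℕ.m∸n≤m n a)) (cong (n +_) (ℕ.m∸[m∸n]≡n a≤n))
    right : ∀ a → n + n ∸ (n + a) ≡ n ∸ a
    right a = ℕ.[m+n]∸[m+o]≡n∸o n n a

  difference : ∀ n a → a ≤ n → (n ∸ a) * (n + a) + sq a ≡ sq n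
  difference n a a≤n = subst (λ n → (n ∸ a) * (n + a) + sq a ≡ sq n) (ℕ.m∸n+n≡m a≤n)
    (trans (cong (λ r → r * (n ∸ a + a + a) + sq a) (ℕ.m+n∸n≡m (n ∸ a) a)) (lemma (n ∸ a) a))
    where
    lemma : ∀ r a → r * (r + a + a) + a * a ≡ (r + a) * (r + a)
    lemma = solve-∀

  index-sum : ∀ n a → a ≤ n → n ∸ a + (n + a) ≡ n + n
  index-sum n a a≤n = trans (lemma (n ∸ a) n a) (cong (_+ n) (ℕ.m∸n+n≡m a≤n))
    where
    lemma : ∀ r n a → r + (n + a) ≡ r + a + n
    lemma = solve-∀

  module _ (j : ℕ) where
    private
      m c C : ℕ
      m = Growth.m j
      c = Growth.c j
      C = Growth.C j

    pair-lower : ∀ n a → a < n → c * 3 ^ (2 + (n + n)) * column n (isInner n a) ≤ 9 ^ m * pair n (suc a)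
    pair-lower n a a<n = begin
      c * 3 ^ (2 + (n + n)) * s                                ≡⟨ cong (λ l → c * 3 ^ (2 + l) * s) (index-sum n (suc a) a<n) ⟨
      c * 3 ^ (2 + (n ∸ suc a + (n + suc a))) * s              ≤⟨ product-lower j (n ∸ suc a) (n + suc a) s
                                                                    (ℕ.+-cancelʳ-≤ (sq (suc a)) _ _ (begin
                                                                      sq s + sq (suc a)   ≡⟨ ℕ.+-comm (sq s) _ ⟩
                                                                      sq (suc a) + sq s   ≤⟨ column-inner n a a<n ⟩
                                                                      sq n                ≡⟨ difference n (suc a) a<n ⟨
                                                                      (n ∸ suc a) * (n + suc a) + sq (suc a) ∎)) ⟩
      pair n (suc a) * 9 ^ m                                   ≡⟨ ℕ.*-comm _ (9 ^ m) ⟩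
      9 ^ m * pair n (suc a)                                   ∎
      where s = column n (isInner n a)

    -- `product-upper` shifts both indices by two, and (2 + n - a) (2 + n + a) = (2 + n)² - a²;
    -- hence the radius `2 + n`.
    pair-upper : ∀ n a → a ≤ n → 9 ^ m * pair n a ≤ C * 3 ^ (2 + (n + n)) * column (2 + n) (isOuter (2 + n) a)
    pair-upper n a a≤n = begin
      9 ^ m * pair n a                                         ≡⟨ ℕ.*-comm (9 ^ m) _ ⟩
      pair n a * 9 ^ m                                         ≤⟨ product-upper j (n ∸ a) (n + a) s
                                                                    (ℕ.+-cancelʳ-≤ (sq a) _ _ (begin
                                                                      (2 + (n ∸ a)) * (2 + (n + a)) + sq a
                                                                        ≡⟨ cong (λ r → r * (2 + (n + a)) + sq a) (ℕ.+-∸-assoc 2 a≤n) ⟨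
                                                                      (2 + n ∸ a) * (2 + n + a) + sq a
                                                                        ≡⟨ difference (2 + n) a (ℕ.m≤n⇒m≤o+n 2 a≤n) ⟩
                                                                      sq (2 + n)
                                                                        ≤⟨ column-outer (2 + n) a ⟩
                                                                      sq a + sq s
                                                                        ≡⟨ ℕ.+-comm (sq a) _ ⟩
                                                                      sq s + sq a ∎)) ⟩
      C * 3 ^ (2 + (n ∸ a + (n + a))) * s                      ≡⟨ cong (λ l → C * 3 ^ (2 + l) * s) (index-sum n a a≤n) ⟩
      C * 3 ^ (2 + (n + n)) * s                                ∎
      where s = column (2 + n) (isOuter (2 + n) a)

    ∑<-mono-< : ∀ n {f h} → (∀ a → a < n → f a ≤ h a) → ∑< n f ≤ ∑< n h
    ∑<-mono-< zero    f≤h = z≤n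
    ∑<-mono-< (suc n) f≤h = ℕ.+-mono-≤ (f≤h 0 (s≤s z≤n)) (∑<-mono-< n (λ a a<n → f≤h (suc a) (s≤s a<n)))

    -- `W (n + n)` contains every off-centre product twice; the central one is dropped.
    inner-bound : ∀ n → 3 * c * inner n ≤ 9 ^ m * sq (suc n)
    inner-bound n = ℕ.*-cancelˡ-≤ (4 * 3 ^ suc (n + n)) {{ℕ.m*n≢0 4 (3 ^ suc (n + n)) {{_}} {{ℕ.m^n≢0 3 (suc (n + n))}}}} (begin
      4 * p * (3 * c * inner n)
        ≡⟨ lemma₁ p c (inner n) ⟩
      2 * (2 * (c * (3 * p) * inner n))
        ≡⟨ cong (λ x → 2 * (2 * x)) (∑<-* n (c * (3 * p)) (λ a → column n (isInner n a))) ⟨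
      2 * (2 * ∑< n (λ a → c * (3 * p) * column n (isInner n a)))
        ≤⟨ ℕ.*-monoʳ-≤ 2 (ℕ.*-monoʳ-≤ 2 (∑<-mono-< n (pair-lower n))) ⟩
      2 * (2 * ∑< n (λ a → 9 ^ m * pair n (suc a)))
        ≡⟨ cong (λ x → 2 * (2 * x)) (∑<-* n (9 ^ m) (pair n ∘ suc)) ⟩
      2 * (2 * (9 ^ m * S))
        ≡⟨ lemma₂ (9 ^ m) S ⟩
      9 ^ m * (2 * (S + S))
        ≤⟨ ℕ.*-monoʳ-≤ (9 ^ m) (ℕ.*-monoʳ-≤ 2 (ℕ.+-monoʳ-≤ S (ℕ.m≤n+m S (pair n 0)))) ⟩
      9 ^ m * (2 * (S + ∑< (suc n) (pair n)))
        ≡⟨ cong (λ w → 9 ^ m * (2 * w)) (W-centre n) ⟨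
      9 ^ m * (2 * W (n + n))
        ≤⟨ ℕ.*-monoʳ-≤ (9 ^ m) (proj₂ (W-bounds (n + n))) ⟩
      9 ^ m * (p * ((2 + (n + n)) * (2 + (n + n))))
        ≡⟨ lemma₃ (9 ^ m) p n ⟩
      4 * p * (9 ^ m * sq (suc n)) ∎)
      where
      p = 3 ^ suc (n + n)
      S = ∑< n (pair n ∘ suc)
      lemma₁ : ∀ p c i → 4 * p * (3 * c * i) ≡ 2 * (2 * (c * (3 * p) * i))
      lemma₁ = solve-∀
      lemma₂ : ∀ q S → 2 * (2 * (q * S)) ≡ q * (2 * (S + S))
      lemma₂ = solve-∀
      lemma₃ : ∀ q p n → q * (p * ((2 + (n + n)) * (2 + (n + n)))) ≡ 4 * p * (q * ((1 + n) * (1 + n)))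
      lemma₃ = solve-∀

    -- Here the central product is counted twice instead of once, and one further column of cells is
    -- added to complete `outer (2 + n)`.
    outer-bound : ∀ n → 9 ^ m * sq (suc (n + n)) ≤ 12 * C * outer (2 + n)
    outer-bound n = ℕ.*-cancelˡ-≤ (3 ^ suc (n + n)) {{ℕ.m^n≢0 3 (suc (n + n))}} (begin
      p * (9 ^ m * sq (suc (n + n)))
        ≡⟨ lemma₁ p (9 ^ m) (sq (suc (n + n))) ⟩
      9 ^ m * (p * sq (suc (n + n)))
        ≤⟨ ℕ.*-monoʳ-≤ (9 ^ m) (proj₁ (W-bounds (n + n))) ⟩
      9 ^ m * (2 * W (n + n))
        ≡⟨ cong (λ w → 9 ^ m * (2 * w)) (W-centre n) ⟩
      9 ^ m * (2 * (∑< n (pair n ∘ suc) + S))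
        ≤⟨ ℕ.*-monoʳ-≤ (9 ^ m) (ℕ.*-monoʳ-≤ 2 (ℕ.+-monoˡ-≤ S (ℕ.m≤n+m (∑< n (pair n ∘ suc)) (pair n 0)))) ⟩
      9 ^ m * (2 * (S + S))
        ≡⟨ lemma₂ (9 ^ m) S ⟩
      4 * (9 ^ m * S)
        ≡⟨ cong (4 *_) (∑<-* (suc n) (9 ^ m) (pair n)) ⟨
      4 * ∑< (suc n) (λ a → 9 ^ m * pair n a)
        ≤⟨ ℕ.*-monoʳ-≤ 4 (∑<-mono-< (suc n) (λ a a<1+n → pair-upper n a (ℕ.≤-pred a<1+n))) ⟩
      4 * ∑< (suc n) (λ a → C * (3 * p) * column (2 + n) (isOuter (2 + n) a))
        ≡⟨ cong (4 *_) (∑<-* (suc n) (C * (3 * p)) (λ a → column (2 + n) (isOuter (2 + n) a))) ⟩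
      4 * (C * (3 * p) * ∑< (suc n) (λ a → column (2 + n) (isOuter (2 + n) a)))
        ≤⟨ ℕ.*-monoʳ-≤ 4 (ℕ.*-monoʳ-≤ (C * (3 * p)) (∑<-grow (suc n) (λ a → column (2 + n) (isOuter (2 + n) a)))) ⟩
      4 * (C * (3 * p) * outer (2 + n))
        ≡⟨ lemma₃ C p (outer (2 + n)) ⟩
      p * (12 * C * outer (2 + n)) ∎)
      where
      p = 3 ^ suc (n + n)
      S = ∑< (suc n) (pair n)
      lemma₁ : ∀ p q x → p * (q * x) ≡ q * (p * x)
      lemma₁ = solve-∀
      lemma₂ : ∀ q S → q * (2 * (S + S)) ≡ 4 * (q * S)
      lemma₂ = solve-∀
      lemma₃ : ∀ C p o → 4 * (C * (3 * p) * o) ≡ p * (12 * C * o)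
      lemma₃ = solve-∀

    -- The passage to the limit, done in ℕ: if A ≥ B + 1, the hypothesis fails at k = D + F, where
    -- the quadratic gap exceeds the linear remainder.
    compare-leading : ∀ A B D F → (∀ k → A * sq (suc k) ≤ B * sq (suc k) + (D * suc k + F)) → A ≤ B
    compare-leading A B D F h = ℕ.≮⇒≥ λ B<A → ℕ.1+n≰n (contra B<A)
      where
      k = D + F
      contra : B < A → suc k ≤ k
      contra B<A = ℕ.*-cancelʳ-≤ (suc k) k (suc k) (ℕ.+-cancelˡ-≤ (B * sq (suc k)) _ _ (begin
        B * sq (suc k) + sq (suc k)                ≡⟨ ℕ.+-comm (B * sq (suc k)) _ ⟩
        suc B * sq (suc k)                         ≤⟨ ℕ.*-monoˡ-≤ (sq (suc k)) B<A ⟩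
        A * sq (suc k)                             ≤⟨ h k ⟩
        B * sq (suc k) + (D * suc k + F)           ≤⟨ ℕ.+-monoʳ-≤ (B * sq (suc k)) (ℕ.+-monoʳ-≤ (D * suc k) (ℕ.m≤m*n F (suc k))) ⟩
        B * sq (suc k) + (D * suc k + F * suc k)   ≡⟨ cong (B * sq (suc k) +_) (ℕ.*-distribʳ-+ (suc k) D F) ⟨
        B * sq (suc k) + k * suc k                 ∎))

    -- `inner-bound` at radius R has an excess factor (R + 1)² / R². Comparing the inner area at R
    -- with the outer, then the inner area at a large radius costs terms linear in that radius,
    -- which `compare-leading` removes along with the excess.
    inner-limit : ∀ R .{{_ : ℕ.NonZero R}} → 3 * c * inner R ≤ 9 ^ m * sq R
    inner-limit R = compare-leading _ _ (2 * (9 ^ m * sq R) + 6 * c * sq R) (9 ^ m * sq R) λ k → begin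
      3 * c * inner R * sq (suc k)
        ≡⟨ ℕ.*-assoc (3 * c) (inner R) _ ⟩
      3 * c * (inner R * sq (suc k))
        ≤⟨ ℕ.*-monoʳ-≤ (3 * c) (inner≤outer R (suc k)) ⟩
      3 * c * (outer (suc k) * sq R)
        ≤⟨ ℕ.*-monoʳ-≤ (3 * c) (ℕ.*-monoˡ-≤ (sq R) (outer≤inner (suc k))) ⟩
      3 * c * ((inner (suc k) + (suc k + suc k)) * sq R)
        ≡⟨ lemma₁ c (inner (suc k)) (suc k) (sq R) ⟩
      (3 * c * inner (suc k) + 6 * c * suc k) * sq R
        ≤⟨ ℕ.*-monoˡ-≤ (sq R) (ℕ.+-monoˡ-≤ (6 * c * suc k) (inner-bound (suc k))) ⟩
      (9 ^ m * sq (2 + k) + 6 * c * suc k) * sq R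
        ≡⟨ lemma₂ (9 ^ m) c k (sq R) ⟩
      9 ^ m * sq R * sq (suc k) + ((2 * (9 ^ m * sq R) + 6 * c * sq R) * suc k + 9 ^ m * sq R) ∎
      where
      lemma₁ : ∀ c i k r → 3 * c * ((i + (k + k)) * r) ≡ (3 * c * i + 6 * c * k) * r
      lemma₁ = solve-∀
      lemma₂ : ∀ q c k r → (q * ((2 + k) * (2 + k)) + 6 * c * (1 + k)) * r ≡
        q * r * ((1 + k) * (1 + k)) + ((2 * (q * r) + 6 * c * r) * (1 + k) + q * r)
      lemma₂ = solve-∀

    outer-limit : ∀ R .{{_ : ℕ.NonZero R}} → 9 ^ m * sq R ≤ 3 * C * outer R
    outer-limit R = ℕ.*-cancelˡ-≤ 4 (compare-leading _ _ (48 * (C * outer R) + 24 * (C * sq R)) (48 * (C * outer R) + 48 * (C * sq R)) λ k → begin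
      4 * (9 ^ m * sq R) * sq (suc k)
        ≤⟨ ℕ.m≤m+n _ _ ⟩
      4 * (9 ^ m * sq R) * sq (suc k) + 9 ^ m * sq R * (4 * suc k + 1)
        ≡⟨ lemma₁ (9 ^ m) (sq R) k ⟩
      9 ^ m * sq (suc (suc k + suc k)) * sq R
        ≤⟨ ℕ.*-monoˡ-≤ (sq R) (outer-bound (suc k)) ⟩
      12 * C * outer (3 + k) * sq R
        ≤⟨ ℕ.*-monoˡ-≤ (sq R) (ℕ.*-monoʳ-≤ (12 * C) (outer≤inner (3 + k))) ⟩
      12 * C * (inner (3 + k) + (3 + k + (3 + k))) * sq R
        ≡⟨ lemma₂ C (inner (3 + k)) k (sq R) ⟩
      12 * C * (inner (3 + k) * sq R) + 24 * (C * sq R) * (3 + k)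
        ≤⟨ ℕ.+-monoˡ-≤ (24 * (C * sq R) * (3 + k)) (ℕ.*-monoʳ-≤ (12 * C) (inner≤outer (3 + k) R)) ⟩
      12 * C * (outer R * sq (3 + k)) + 24 * (C * sq R) * (3 + k)
        ≡⟨ lemma₃ C (outer R) (sq R) k ⟩
      4 * (3 * C * outer R) * sq (suc k) + ((48 * (C * outer R) + 24 * (C * sq R)) * suc k + (48 * (C * outer R) + 48 * (C * sq R))) ∎)
      where
      lemma₁ : ∀ q r k → 4 * (q * r) * ((1 + k) * (1 + k)) + q * r * (4 * (1 + k) + 1) ≡ q * ((1 + (1 + k + (1 + k))) * (1 + (1 + k + (1 + k)))) * r
      lemma₁ = solve-∀
      lemma₂ : ∀ C i k r → 12 * C * (i + (3 + k + (3 + k))) * r ≡ 12 * C * (i * r) + 24 * (C * r) * (3 + k)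
      lemma₂ = solve-∀
      lemma₃ : ∀ C o r k → 12 * C * (o * ((3 + k) * (3 + k))) + 24 * (C * r) * (3 + k) ≡
        4 * (3 * C * o) * ((1 + k) * (1 + k)) + ((48 * (C * o) + 24 * (C * r)) * (1 + k) + (48 * (C * o) + 48 * (C * r)))
      lemma₃ = solve-∀

-- Clearing rational denominators.

module Fractions where
  open import Data.Rational.Base using (_+_; _*_; _/_; _<_)
  open Embedding

  0<ι : ∀ n .{{_ : ℕ.NonZero n}} → 0ℚ < ι n
  0<ι n = ι-mono-< (ℕ.>-nonZero⁻¹ n)

  /-ι : ∀ a b .{{_ : ℕ.NonZero b}} → ℤ.+ a / b * ι b ≡ ι a
  /-ι a b@(suc b-1) = ℚ.toℚᵘ-injective (ℚᵘ.≃-trans (ℚ.toℚᵘ-homo-* (ℤ.+ a / b) (ι b))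
    (ℚᵘ.≃-trans (ℚᵘ.*-cong (ℚ.toℚᵘ-fromℚᵘ (ℚᵘ.mkℚᵘ (ℤ.+ a) b-1)) (ℚᵘ.≃-refl {ℚ.toℚᵘ (ι b)}))
      (ℚᵘ.*≡* (trans (ℤ.*-identityʳ (ℤ.+ a ℤ.* ℤ.+ b)) (cong (ℤ.+ a ℤ.*_) (cong ℤ.+_ (sym (ℕ.*-identityʳ b))))))))

  *-cancelʳ-≡ : ∀ r {p q} → 0ℚ < r → p * r ≡ q * r → p ≡ q
  *-cancelʳ-≡ r {p} {q} 0<r eq = ℚ.≤-antisym
    (ℚ.*-cancelʳ-≤-pos r {{ℚ.positive 0<r}} (ℚ.≤-reflexive eq))
    (ℚ.*-cancelʳ-≤-pos r {{ℚ.positive 0<r}} (ℚ.≤-reflexive (sym eq)))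

-- The edge numbers as a sum of binomial products.

module BinomialFormula where
  open import Data.Nat.Combinatorics using (_C_)
  open import Data.Rational.Base using (_+_; _*_; _/_)
  open Embedding
  open Fractions
  open Binomials using (multi; multi-C; τ-sum)
  open EdgeCounts using (ℓ≡τ)
  open ≡-Reasoning

  summand : ℕ → ℕ → ℚ
  summand n k = ι (n C k) * ι ((n ℕ.∸ k) C k) * (ℤ.+ (k ℕ.* (n ℕ.∸ k)) / suc k)

  -- For k = d + 1, the factor k / (k + 1) is what `multi-C` needs to merge the two binomials into
  -- one multinomial, an integer.
  summand-suc : ∀ n d → summand n (suc d) ≡ ι ((n ℕ.∸ suc d) ℕ.* multi n 2 d)
  summand-suc n d = *-cancelʳ-≡ (ι (2 ℕ.+ d)) (0<ι (2 ℕ.+ d)) (begin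
    ι a * ι b * f * ι (2 ℕ.+ d)
      ≡⟨ ℚ.*-assoc (ι a * ι b) f (ι (2 ℕ.+ d)) ⟩
    ι a * ι b * (f * ι (2 ℕ.+ d))
      ≡⟨ cong₂ _*_ (sym (ι-* a b)) (/-ι (suc d ℕ.* r) (2 ℕ.+ d)) ⟩
    ι (a ℕ.* b) * ι (suc d ℕ.* r)
      ≡⟨ ι-* (a ℕ.* b) (suc d ℕ.* r) ⟨
    ι (a ℕ.* b ℕ.* (suc d ℕ.* r))
      ≡⟨ cong ι (trans (lemma₁ a b (suc d) r) (trans (cong (r ℕ.*_) (sym (multi-C n d))) (lemma₂ r (2 ℕ.+ d) (multi n 2 d)))) ⟩
    ι (r ℕ.* multi n 2 d ℕ.* (2 ℕ.+ d))
      ≡⟨ ι-* (r ℕ.* multi n 2 d) (2 ℕ.+ d) ⟩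
    ι (r ℕ.* multi n 2 d) * ι (2 ℕ.+ d) ∎)
    where
    r = n ℕ.∸ suc d
    a = n C suc d
    b = r C suc d
    f = ℤ.+ (suc d ℕ.* r) / (2 ℕ.+ d)
    lemma₁ : ∀ a b d r → a ℕ.* b ℕ.* (d ℕ.* r) ≡ r ℕ.* (d ℕ.* (a ℕ.* b))
    lemma₁ = solve-∀
    lemma₂ : ∀ r d m → r ℕ.* (d ℕ.* m) ≡ r ℕ.* m ℕ.* d
    lemma₂ = solve-∀

  sum-ι : ∀ n f → ∑[ i < n ] ι (f (toℕ i)) ≡ ι (∑< n f)
  sum-ι zero    f = refl
  sum-ι (suc n) f = trans (cong (ι (f 0) +_) (sum-ι n (f ∘ suc))) (sym (ι-+ (f 0) (∑< n (f ∘ suc))))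

  binomial-formula : ∀ n → ι (ℓ (𝓜 (suc n))) ≡ ℤ.+ 2 / suc n * ∑[ k ≤ ⌊ suc n /2⌋ ] summand (suc n) (toℕ k)
  binomial-formula n = *-cancelʳ-≡ (ι (suc n)) (0<ι (suc n)) (begin
    ι (ℓ (𝓜 (suc n))) * ι (suc n)
      ≡⟨ ι-* (ℓ (𝓜 (suc n))) (suc n) ⟨
    ι (ℓ (𝓜 (suc n)) ℕ.* suc n)
      ≡⟨ cong ι (trans (ℕ.*-comm (ℓ (𝓜 (suc n))) (suc n)) (trans (cong (suc n ℕ.*_) (ℓ≡τ n)) (τ-sum n))) ⟩
    ι (2 ℕ.* S)
      ≡⟨ ι-* 2 S ⟩
    ι 2 * ι S
      ≡⟨ cong₂ _*_ (/-ι 2 (suc n)) (sum-ι D (λ d → (n ℕ.∸ d) ℕ.* multi (suc n) 2 d)) ⟨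
    ℤ.+ 2 / suc n * ι (suc n) * ∑[ d < D ] ι ((n ℕ.∸ toℕ d) ℕ.* multi (suc n) 2 (toℕ d))
      ≡⟨ cong (ℤ.+ 2 / suc n * ι (suc n) *_) (sum-cong-≗ {D} (λ d → summand-suc (suc n) (toℕ d))) ⟨
    ℤ.+ 2 / suc n * ι (suc n) * ∑[ d < D ] summand (suc n) (suc (toℕ d))
      -- The summand at k = 0 vanishes because of its factor k.
      ≡⟨ cong (ℤ.+ 2 / suc n * ι (suc n) *_) (trans (cong (_+ Σ′) (ℚ.*-zeroʳ (ι (suc n C 0) * ι (suc n C 0)))) (ℚ.+-identityˡ Σ′)) ⟨
    ℤ.+ 2 / suc n * ι (suc n) * ∑[ k ≤ D ] summand (suc n) (toℕ k)
      ≡⟨ lemma (ℤ.+ 2 / suc n) (ι (suc n)) _ ⟩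
    ℤ.+ 2 / suc n * ∑[ k ≤ D ] summand (suc n) (toℕ k) * ι (suc n) ∎)
    where
    D = ⌊ suc n /2⌋
    S = ∑< D (λ d → (n ℕ.∸ d) ℕ.* multi (suc n) 2 d)
    Σ′ = ∑[ d < D ] summand (suc n) (suc (toℕ d))
    lemma : ∀ a b c → a * b * c ≡ a * c * b
    lemma = solve 3 (λ a b c → a :* b :* c := a :* c :* b) refl
      where open +-*-Solver

-- Motzkin numbers and edge numbers against `e`.

module Estimates where
  open import Data.Nat.Base using (_+_; _*_; _≤_; _<_)
  open Covers using (N)
  open Trinomials using (e; 2N+e)
  open EdgeCounts using (ℓ+N)
  open Growth using (ratio-bounds)
  open ℕ.≤-Reasoning

  -- In 2 M_n = 3 e(n + 1) - e(n + 2), the lower ratio bound at n + 1 leaves at most 3 e(n + 1) (1 -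
  -- (4n + 5) / (4n + 7)).
  N≤e : ∀ k → let n = 2 + k in (4 * n + 7) * N 0 n ≤ 3 * e (suc n)
  N≤e k = ℕ.*-cancelˡ-≤ 2 (ℕ.+-cancelʳ-≤ (3 * (4 * suc n + 1) * y) _ _ (begin
    2 * ((4 * n + 7) * N 0 n) + 3 * (4 * suc n + 1) * y
      ≤⟨ ℕ.+-monoʳ-≤ (2 * ((4 * n + 7) * N 0 n)) (proj₁ (ratio-bounds k)) ⟩
    2 * ((4 * n + 7) * N 0 n) + (4 * suc n + 3) * e (2 + n)
      ≡⟨ lemma₁ n (N 0 n) (e (2 + n)) ⟩
    (4 * n + 7) * (2 * N 0 n + e (2 + n))
      ≡⟨ cong ((4 * n + 7) *_) (2N+e n) ⟩
    (4 * n + 7) * (3 * y)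
      ≡⟨ lemma₂ n y ⟩
    2 * (3 * y) + 3 * (4 * suc n + 1) * y ∎))
    where
    n = 2 + k
    y = e (suc n)
    lemma₁ : ∀ n a b → 2 * ((4 * n + 7) * a) + (4 * suc n + 3) * b ≡ (4 * n + 7) * (2 * a + b)
    lemma₁ = solve-∀
    lemma₂ : ∀ n y → (4 * n + 7) * (3 * y) ≡ 2 * (3 * y) + 3 * (4 * suc n + 1) * y
    lemma₂ = solve-∀

  e≤N : ∀ k → let n = 2 + k in 3 * e (suc n) ≤ 4 * (2 + n) * N 0 n
  e≤N k = ℕ.+-cancelʳ-≤ (3 * (2 * suc n + 1) * y) _ _ (begin
    3 * y + 3 * (2 * suc n + 1) * y
      ≡⟨ lemma₁ n y ⟩
    (2 * suc n + 2) * (3 * y)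
      ≡⟨ cong ((2 * suc n + 2) *_) (2N+e n) ⟨
    (2 * suc n + 2) * (2 * N 0 n + e (2 + n))
      ≡⟨ lemma₂ n (N 0 n) (e (2 + n)) ⟩
    4 * (2 + n) * N 0 n + (2 * suc n + 2) * e (2 + n)
      ≤⟨ ℕ.+-monoʳ-≤ (4 * (2 + n) * N 0 n) (proj₂ (ratio-bounds k)) ⟩
    4 * (2 + n) * N 0 n + 3 * (2 * suc n + 1) * y ∎)
    where
    n = 2 + k
    y = e (suc n)
    lemma₁ : ∀ n y → 3 * y + 3 * (2 * suc n + 1) * y ≡ (2 * suc n + 2) * (3 * y)
    lemma₁ = solve-∀
    lemma₂ : ∀ n a b → (2 * suc n + 2) * (2 * a + b) ≡ 4 * (2 + n) * a + (2 * suc n + 2) * b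
    lemma₂ = solve-∀

  module _ (j : ℕ) where
    n : ℕ
    n = 3 + j

    e₊≤3e : e (suc n) ≤ 3 * e n
    e₊≤3e = ℕ.*-cancelˡ-≤ {e (suc n)} {3 * e n} (2 * n + 2) (begin
      (2 * n + 2) * e (suc n)            ≤⟨ proj₂ (ratio-bounds j) ⟩
      3 * (2 * n + 1) * e n              ≤⟨ ℕ.m≤m+n _ (3 * e n) ⟩
      3 * (2 * n + 1) * e n + 3 * e n    ≡⟨ lemma n (e n) ⟩
      (2 * n + 2) * (3 * e n)            ∎)
      where
      lemma : ∀ n x → 3 * (2 * n + 1) * x + 3 * x ≡ (2 * n + 2) * (3 * x)
      lemma = solve-∀

    4nN≤9e : 4 * n * N 0 n ≤ 9 * e n
    4nN≤9e = begin
      4 * n * N 0 n          ≤⟨ ℕ.*-monoˡ-≤ (N 0 n) (ℕ.m≤m+n (4 * n) 7) ⟩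
      (4 * n + 7) * N 0 n    ≤⟨ N≤e (suc j) ⟩
      3 * e (suc n)          ≤⟨ ℕ.*-monoʳ-≤ 3 e₊≤3e ⟩
      3 * (3 * e n)          ≡⟨ lemma₂ (e n) ⟩
      9 * e n                ∎
      where
      lemma₂ : ∀ x → 3 * (3 * x) ≡ 9 * x
      lemma₂ = solve-∀

    -- With `4nN≤9e`, this confines e(n) / M_n between 4n / 9 and 4 (n + 3) / 9.
    9e≤4[n+3]N : 9 * e n ≤ 4 * (3 + n) * N 0 n
    9e≤4[n+3]N = ℕ.*-cancelˡ-≤ (4 * n + 1) (begin
      (4 * n + 1) * (9 * e n)                                  ≡⟨ lemma₁ n (e n) ⟩
      3 * (3 * (4 * n + 1) * e n)                              ≤⟨ ℕ.*-monoʳ-≤ 3 (proj₁ (ratio-bounds j)) ⟩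
      3 * ((4 * n + 3) * e (suc n))                            ≡⟨ lemma₂ n (e (suc n)) ⟩
      (4 * n + 3) * (3 * e (suc n))                            ≤⟨ ℕ.*-monoʳ-≤ (4 * n + 3) (e≤N (suc j)) ⟩
      (4 * n + 3) * (4 * (2 + n) * N 0 n)                      ≤⟨ ℕ.m≤m+n _ (4 * ((2 * j + 3) * N 0 n)) ⟩
      (4 * n + 3) * (4 * (2 + n) * N 0 n) + 4 * ((2 * j + 3) * N 0 n) ≡⟨ lemma₃ j (N 0 n) ⟩
      (4 * n + 1) * (4 * (3 + n) * N 0 n)                      ∎)
      where
      lemma₁ : ∀ n x → (4 * n + 1) * (9 * x) ≡ 3 * (3 * (4 * n + 1) * x)
      lemma₁ = solve-∀
      lemma₂ : ∀ n y → 3 * ((4 * n + 3) * y) ≡ (4 * n + 3) * (3 * y)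
      lemma₂ = solve-∀
      lemma₃ : ∀ j x → (4 * (3 + j) + 3) * (4 * (2 + (3 + j)) * x) + 4 * ((2 * j + 3) * x) ≡ (4 * (3 + j) + 1) * (4 * (3 + (3 + j)) * x)
      lemma₃ = solve-∀

    ℓ≤e : ℓ (𝓜 n) ≤ e n
    ℓ≤e = ℕ.≤-trans (ℕ.m≤m+n _ _) (ℕ.≤-reflexive (ℓ+N (2 + j)))

    -- The loss e(n) - ℓ is M_n + M_(n-1), and n times these terms is at most 9/4 and 3/4 of e(n).
    ne≤nℓ+3e : n * e n ≤ n * ℓ (𝓜 n) + 3 * e n
    ne≤nℓ+3e = begin
      n * e n                                        ≡⟨ cong (n *_) (ℓ+N (2 + j)) ⟨
      n * (ℓ (𝓜 n) + (N 0 n + N 0 (2 + j)))          ≡⟨ ℕ.*-distribˡ-+ n (ℓ (𝓜 n)) _ ⟩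
      n * ℓ (𝓜 n) + n * (N 0 n + N 0 (2 + j))        ≤⟨ ℕ.+-monoʳ-≤ (n * ℓ (𝓜 n)) (ℕ.*-cancelˡ-≤ {n * (N 0 n + N 0 (2 + j))} {3 * e n} 4 (begin
        4 * (n * (N 0 n + N 0 (2 + j)))                  ≡⟨ lemma₁ n (N 0 n) (N 0 (2 + j)) ⟩
        4 * n * N 0 n + 4 * n * N 0 (2 + j)              ≤⟨ ℕ.+-mono-≤ 4nN≤9e 4nN≤3e ⟩
        9 * e n + 3 * e n                                ≡⟨ lemma₂ (e n) ⟩
        4 * (3 * e n)                                    ∎)) ⟩
      n * ℓ (𝓜 n) + 3 * e n                          ∎
      where
      4nN≤3e : 4 * n * N 0 (2 + j) ≤ 3 * e n
      4nN≤3e = ℕ.≤-trans (ℕ.*-monoˡ-≤ (N 0 (2 + j)) (ℕ.≤-trans (ℕ.m≤m+n (4 * n) 3) (ℕ.≤-reflexive (lemma j)))) (N≤e j)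
        where
        lemma : ∀ j → 4 * (3 + j) + 3 ≡ 4 * (2 + j) + 7
        lemma = solve-∀
      lemma₁ : ∀ n a b → 4 * (n * (a + b)) ≡ 4 * n * a + 4 * n * b
      lemma₁ = solve-∀
      lemma₂ : ∀ x → 9 * x + 3 * x ≡ 4 * (3 * x)
      lemma₂ = solve-∀

    0<N : 0 < N 0 n
    0<N = ℕ.>-nonZero⁻¹ (N 0 n) {{∣𝓜∣-nonZero n}}

    0<e : 0 < e n
    0<e = ℕ.*-cancelˡ-< 9 0 (e n) (ℕ.<-≤-trans
      (subst (_< 4 * n * N 0 n) (ℕ.*-zeroʳ (4 * n)) (ℕ.*-monoʳ-< (4 * n) 0<N)) 4nN≤9e)

-- Witnesses for multiples, inverses and square roots of cuts.

module Reals where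
  open import Data.Rational.Base using (_*_; _<_)
  open ℝ
  open IsPositive
  open +-*-Solver using (solve; _:=_; _:*_)

  L-· : ∀ x {c p q} → 0ℚ < c → L x p → q < c * p → L (c · x) q
  L-· x 0<c Lp q<cp = let r , Ur = U-inhabited x in
    _ , r , Lp , Ur , q<cp , ℚ.<-trans q<cp (*-mono-<-pos 0<c (L<U x Lp Ur))

  U-· : ∀ x {c r q} → 0ℚ < c → U x r → c * r < q → U (c · x) q
  U-· x 0<c Ur cr<q = let p , Lp = L-inhabited x in
    p , _ , Lp , Ur , ℚ.<-trans (*-mono-<-pos 0<c (L<U x Lp Ur)) cr<q , cr<q

  0<* : ∀ {p q} → 0ℚ < p → 0ℚ < q → 0ℚ < p * q
  0<* {p} {q} 0<p 0<q = subst (_< p * q) (ℚ.*-zeroʳ p) (*-mono-<-pos 0<p 0<q)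

  *-cancelʳ-< : ∀ r {p q} → 0ℚ < r → p * r < q * r → p < q
  *-cancelʳ-< r 0<r = ℚ.*-cancelʳ-<-nonNeg r {{ℚ.nonNegative (ℚ.<⇒≤ 0<r)}}

  *-monoʳ-<-pos : ∀ {p q r} → 0ℚ < r → p < q → p * r < q * r
  *-monoʳ-<-pos {r = r} 0<r = ℚ.*-monoˡ-<-pos r {{ℚ.positive 0<r}}

  recip-* : ∀ p .(0<p : 0ℚ < p) → recip p 0<p * p ≡ 1ℚ
  recip-* p 0<p = trans (ℚ.*-comm _ p) (*-recip p 0<p)

  *-recip-cancel : ∀ a p .(0<p : 0ℚ < p) → a * recip p 0<p * p ≡ a
  *-recip-cancel a p 0<p = trans (ℚ.*-assoc a _ p) (trans (cong (a *_) (recip-* p 0<p)) (ℚ.*-identityʳ a))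

  cross-< : ∀ {a b p q} (0<p : 0ℚ < p) (0<q : 0ℚ < q) → a * q < b * p → a * recip p 0<p < b * recip q 0<q
  cross-< {a} {b} {p} {q} 0<p 0<q aq<bp = *-cancelʳ-< (p * q) (0<* 0<p 0<q)
    (subst₂ _<_ (sym (trans (sym (ℚ.*-assoc (a * recip p 0<p) p q)) (cong (_* q) (*-recip-cancel a p 0<p))))
                (sym (trans (solve 4 (λ b r p q → b :* r :* (p :* q) := b :* r :* q :* p) refl b (recip q 0<q) p q)
                            (cong (_* p) (*-recip-cancel b q 0<q))))
                aq<bp)

  <-recip-* : ∀ {a q w} (0<a : 0ℚ < a) (0<w : 0ℚ < w) → q * w < a → recip a 0<a * q < recip w 0<w
  <-recip-* {a} {q} {w} 0<a 0<w qw<a = <-recip 0<w (subst₂ _<_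
    (solve 3 (λ r q w → r :* (q :* w) := w :* (r :* q)) refl (recip a 0<a) q w) (recip-* a 0<a)
    (*-mono-<-pos (0<recip 0<a) qw<a))

  recip-*-< : ∀ {a q w} (0<a : 0ℚ < a) (0<q : 0ℚ < q) (0<w : 0ℚ < w) → a < q * w → recip w 0<w < recip a 0<a * q
  recip-*-< {a} {q} {w} 0<a 0<q 0<w a<qw = recip-< 0<w (0<* (0<recip 0<a) 0<q) (subst₂ _<_ (recip-* a 0<a)
    (solve 3 (λ r q w → r :* (q :* w) := w :* (r :* q)) refl (recip a 0<a) q w)
    (*-mono-<-pos (0<recip 0<a) a<qw))

  -- For positive a and q, q < a / b says b < a / q. Openness of the cuts supplies the strict gaps
  -- that the definitions of `_·_` and `_⁻¹` demand.
  ratio-L : ∀ b {{b>0 : IsPositive b}} {a q} → 0ℚ < a → (0<q : 0ℚ < q) →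
    U b (a * recip q 0<q) → L (a · (b ⁻¹)) q
  ratio-L b {{b>0}} {a} {q} 0<a 0<q Ub =
    let w , w<a/q , Uw = U-open b Ub
        0<w = L<U b (0<x b>0) Uw
        qw<a = subst₂ _<_ (ℚ.*-comm w q) (*-recip-cancel a q 0<q) (*-monoʳ-<-pos 0<q w<a/q)
        p , q/a<p , p<1/w = ℚ.<-dense (<-recip-* 0<a 0<w qw<a)
    in L-· (b ⁻¹) 0<a (w , 0<w , Uw , p<1/w) (subst (_< a * p) (*-cancel-recip a q 0<a) (*-mono-<-pos 0<a q/a<p))

  ratio-U : ∀ b {{b>0 : IsPositive b}} {a q} → 0ℚ < a → (0<q : 0ℚ < q) →
    L b (a * recip q 0<q) → U (a · (b ⁻¹)) q
  ratio-U b {a = a} {q} 0<a 0<q Lb =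
    let w , a/q<w , Lw = L-open b Lb
        0<w = ℚ.<-trans (0<* 0<a (0<recip 0<q)) a/q<w
        a<qw = subst₂ _<_ (*-recip-cancel a q 0<q) (ℚ.*-comm w q) (*-monoʳ-<-pos 0<q a/q<w)
        p , 1/w<p , p<q/a = ℚ.<-dense (recip-*-< 0<a 0<q 0<w a<qw)
    in U-· (b ⁻¹) 0<a (w , 0<w , Lw , 1/w<p) (subst (a * p <_) (*-cancel-recip a q 0<a) (*-mono-<-pos 0<a p<q/a))

  U-√⁻¹ : ∀ x {{x>0 : IsPositive x}} {p v} → (0<p : 0ℚ < p) → L x (p * p) → recip p 0<p < v → U ((√ x) ⁻¹) v
  U-√⁻¹ x {p = p} {v} 0<p Lp² 1/p<v =
    let 0<v = ℚ.<-trans (0<recip 0<p) 1/p<v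
        t , 1/v<t , t<p = ℚ.<-dense (recip-swap-< 0<p 0<v 1/p<v)
        0<t = ℚ.<-trans (0<recip 0<v) 1/v<t
    in t , 0<t , (p , t<p , inj₂ (0<p , Lp²)) , recip-swap-< 0<v 0<t 1/v<t

  L-√⁻¹ : ∀ x {{x>0 : IsPositive x}} {p v} → (0<p : 0ℚ < p) → 0ℚ < v → U x (p * p) → v < recip p 0<p → L ((√ x) ⁻¹) v
  L-√⁻¹ x {p = p} {v} 0<p 0<v Up² v<1/p =
    let r , p<r , r<1/v = ℚ.<-dense (<-swap-recip 0<p 0<v v<1/p)
        0<r = ℚ.<-trans 0<p p<r
    in r , 0<r , (p , p<r , ℚ.<⇒≤ 0<p , Up²) , <-swap-recip 0<v 0<r r<1/v

  recip-cancel : ∀ a q (0<a : 0ℚ < a) → recip a 0<a * (a * q) ≡ q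
  recip-cancel a q 0<a = trans (sym (ℚ.*-assoc (recip a 0<a) a q)) (trans (cong (_* q) (recip-* a 0<a)) (ℚ.*-identityˡ q))

  <-divide : ∀ a {q z} (0<a : 0ℚ < a) → a * q < z → q < recip a 0<a * z
  <-divide a {q} {z} 0<a aq<z = subst (_< recip a 0<a * z) (recip-cancel a q 0<a) (*-mono-<-pos (0<recip 0<a) aq<z)

  divide-< : ∀ a {q z} (0<a : 0ℚ < a) → z < a * q → recip a 0<a * z < q
  divide-< a {q} {z} 0<a z<aq = subst (recip a 0<a * z <_) (recip-cancel a q 0<a) (*-mono-<-pos (0<recip 0<a) z<aq)

  multiply-< : ∀ a {q z} (0<a : 0ℚ < a) → q < recip a 0<a * z → a * q < z
  multiply-< a {q} {z} 0<a q<z/a = subst (a * q <_) (*-cancel-recip a z 0<a) (*-mono-<-pos 0<a q<z/a)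

  <-multiply : ∀ a {q z} (0<a : 0ℚ < a) → recip a 0<a * z < q → z < a * q
  <-multiply a {q} {z} 0<a z/a<q = subst (_< a * q) (*-cancel-recip a z 0<a) (*-mono-<-pos 0<a z/a<q)

  U-scaled-√⁻¹ : ∀ x {{x>0 : IsPositive x}} {A p z} → 0ℚ < A → (0<p : 0ℚ < p) → L x (p * p) →
    A * recip p 0<p < z → U (A · ((√ x) ⁻¹)) z
  U-scaled-√⁻¹ x {A = A} 0<A 0<p Lp² A/p<z with ℚ.<-dense (<-divide A 0<A A/p<z)
  ... | v , 1/p<v , v<z/A = U-· ((√ x) ⁻¹) 0<A (U-√⁻¹ x 0<p Lp² 1/p<v) (multiply-< A 0<A v<z/A)

  L-scaled-√⁻¹ : ∀ x {{x>0 : IsPositive x}} {A p z} → 0ℚ < A → (0<p : 0ℚ < p) → 0ℚ < z → U x (p * p) →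
    z < A * recip p 0<p → L (A · ((√ x) ⁻¹)) z
  L-scaled-√⁻¹ x {A = A} 0<A 0<p 0<z Up² z<A/p with ℚ.<-dense (divide-< A 0<A z<A/p)
  ... | v , z/A<v , v<1/p = L-· ((√ x) ⁻¹) 0<A (L-√⁻¹ x 0<p (ℚ.<-trans (0<* (0<recip 0<A) 0<z) z/A<v) Up² v<1/p) (<-multiply A 0<A z/A<v)

  module _ {b : ℚ} (0<b : 0ℚ < b) where

    scaled-< : ∀ {x y} → x * b < y → x < y * recip b 0<b
    scaled-< {x} {y} xb<y = *-cancelʳ-< b 0<b (subst (x * b <_) (sym (*-recip-cancel y b 0<b)) xb<y)

    <-scaled : ∀ {x y} → y < x * b → y * recip b 0<b < x
    <-scaled {x} {y} y<xb = *-cancelʳ-< b 0<b (subst (_< x * b) (sym (*-recip-cancel y b 0<b)) y<xb)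

-- Rational bounds on π from bounds on all cell areas.

module Pi where
  open import Data.Rational.Base using (_*_; _≤_; _<_)
  open ℝ
  open Reals
  open Embedding
  open Fractions
  open Growth using (sq)

  swap : ∀ x y z → x * y * z ≡ x * z * y
  swap = solve 3 (λ x y z → x :* y :* z := x :* z :* y) refl
    where open +-*-Solver

  module _ {a b : ℚ} (0<b : 0ℚ < b) where

    -- Locatedness turns absence into presence: some rational between q and a / b is not in `U x`,
    -- so q must be in `L x`.
    ¬U⇒L : ∀ x {q} → (∀ w → w * b < a → ¬ U x w) → q * b < a → L x q
    ¬U⇒L x {q} ¬U qb<a =
      let w , qb<w , w<a = ℚ.<-dense qb<a in
      [ id , (λ Uw → contradiction Uw (¬U (w * recip b 0<b) (subst (_< a) (sym (*-recip-cancel w b 0<b)) w<a))) ]′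
        (located x (scaled-< 0<b qb<w))

    ¬L⇒U : ∀ x {q} → (∀ w → a < w * b → ¬ L x w) → a < q * b → U x q
    ¬L⇒U x {q} ¬L a<qb =
      let w , a<w , w<qb = ℚ.<-dense a<qb in
      [ (λ Lw → contradiction Lw (¬L (w * recip b 0<b) (subst (a <_) (sym (*-recip-cancel w b 0<b)) a<w))) , id ]′
        (located x (<-scaled 0<b w<qb))

    π-L : (∀ k → a ≤ upperArea k * b) → ∀ {q} → q * b < a → L π q
    π-L a≤ = ¬U⇒L π λ w wb<a (k , upper<w) →
      ℚ.<-irrefl refl (ℚ.≤-<-trans (a≤ k) (ℚ.<-trans (*-monoʳ-<-pos 0<b upper<w) wb<a))

    π-U : (∀ k → lowerArea k * b ≤ a) → ∀ {q} → a < q * b → U π q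
    π-U ≤a = ¬L⇒U π λ w a<wb (k , w<lower) →
      ℚ.<-irrefl refl (ℚ.<-≤-trans (ℚ.<-trans a<wb (*-monoʳ-<-pos 0<b w<lower)) (≤a k))

  open ℚ.≤-Reasoning

  upperArea-bound : ∀ a b k → a ℕ.* sq (suc k) ℕ.≤ 3 ℕ.* b ℕ.* outer (suc k) → ι (4 ℕ.* a) ≤ upperArea k * ι (3 ℕ.* b)
  upperArea-bound a b k h = ℚ.*-cancelʳ-≤-pos (ι R²) {{ℚ.positive (0<ι R²)}} (begin
    ι (4 ℕ.* a) * ι R²                      ≡⟨ ι-* (4 ℕ.* a) R² ⟨
    ι (4 ℕ.* a ℕ.* R²)                      ≤⟨ ι-mono-≤ (ℕ.≤-trans (ℕ.≤-reflexive (ℕ.*-assoc 4 a R²))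
                                               (ℕ.≤-trans (ℕ.*-monoʳ-≤ 4 h) (ℕ.≤-reflexive (lemma b (outer (suc k)))))) ⟩
    ι (4 ℕ.* outer (suc k) ℕ.* (3 ℕ.* b))   ≡⟨ ι-* (4 ℕ.* outer (suc k)) (3 ℕ.* b) ⟩
    ι (4 ℕ.* outer (suc k)) * ι (3 ℕ.* b)   ≡⟨ cong (_* ι (3 ℕ.* b)) (/-ι (4 ℕ.* outer (suc k)) R²) ⟨
    upperArea k * ι R² * ι (3 ℕ.* b)        ≡⟨ swap (upperArea k) (ι R²) (ι (3 ℕ.* b)) ⟩
    upperArea k * ι (3 ℕ.* b) * ι R²        ∎)
    where
    R² = sq (suc k)
    lemma : ∀ b o → 4 ℕ.* (3 ℕ.* b ℕ.* o) ≡ 4 ℕ.* o ℕ.* (3 ℕ.* b)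
    lemma = solve-∀

  lowerArea-bound : ∀ a b k → 3 ℕ.* b ℕ.* inner (suc k) ℕ.≤ a ℕ.* sq (suc k) → lowerArea k * ι (3 ℕ.* b) ≤ ι (4 ℕ.* a)
  lowerArea-bound a b k h = ℚ.*-cancelʳ-≤-pos (ι R²) {{ℚ.positive (0<ι R²)}} (begin
    lowerArea k * ι (3 ℕ.* b) * ι R²        ≡⟨ swap (lowerArea k) (ι R²) (ι (3 ℕ.* b)) ⟨
    lowerArea k * ι R² * ι (3 ℕ.* b)        ≡⟨ cong (_* ι (3 ℕ.* b)) (/-ι (4 ℕ.* inner (suc k)) R²) ⟩
    ι (4 ℕ.* inner (suc k)) * ι (3 ℕ.* b)   ≡⟨ ι-* (4 ℕ.* inner (suc k)) (3 ℕ.* b) ⟨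
    ι (4 ℕ.* inner (suc k) ℕ.* (3 ℕ.* b))   ≤⟨ ι-mono-≤ (ℕ.≤-trans (ℕ.≤-reflexive (sym (lemma b (inner (suc k)))))
                                               (ℕ.≤-trans (ℕ.*-monoʳ-≤ 4 h) (ℕ.≤-reflexive (sym (ℕ.*-assoc 4 a R²))))) ⟩
    ι (4 ℕ.* a ℕ.* R²)                      ≡⟨ ι-* (4 ℕ.* a) R² ⟩
    ι (4 ℕ.* a) * ι R²                      ∎)
    where
    R² = sq (suc k)
    lemma : ∀ b o → 4 ℕ.* (3 ℕ.* b ℕ.* o) ≡ 4 ℕ.* o ℕ.* (3 ℕ.* b)
    lemma = solve-∀

-- Scaled inverse square roots against rational test points.

module Comparison where
  open import Data.Rational.Base using (_*_; _/_; _<_)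
  open ℝ
  open Reals
  open +-*-Solver using (solve; _:=_; _:*_)

  module _ {t n C a : ℚ} (x : ℝ) (0<t : 0ℚ < t) (0<n : 0ℚ < n) (0<C : 0ℚ < C) where
    private
      r₁ = recip t 0<t
      r₂ = recip n 0<n
      r₃ = recip C 0<C
      s q : ℚ → ℚ
      s w = r₁ * (w * r₃)
      q w = r₂ * s w

      ts : ∀ w → t * s w ≡ w * r₃
      ts w = *-cancel-recip t (w * r₃) 0<t

      nq : ∀ w → n * q w ≡ s w
      nq w = *-cancel-recip n (s w) 0<n

      s-mono : ∀ {w w′} → w < w′ → s w < s w′
      s-mono w<w′ = *-mono-<-pos (0<recip 0<t) (*-monoʳ-<-pos (0<recip 0<C) w<w′)

      qtCn : ∀ w → q w * (t * C) * n ≡ w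
      qtCn w = trans (solve 4 (λ q t C n → q :* (t :* C) :* n := t :* (n :* q) :* C) refl (q w) t C n)
        (trans (cong (λ z → t * z * C) (nq w)) (trans (cong (_* C) (ts w)) (*-recip-cancel w C 0<C)))

    product-L : (∀ {p} → p * (t * C) < a → L x p) → ∀ {v} → v * C < n * a → L (t · n · x) v
    product-L Lx {v} vC<na =
      -- Each of the two scalings consumes one strict gap, hence two intermediate points.
      let w₂ , vC<w₂ , w₂<na = ℚ.<-dense vC<na
          w₁ , vC<w₁ , w₁<w₂ = ℚ.<-dense vC<w₂
      in L-· (n · x) 0<t
           (L-· x 0<n (Lx {q w₂} (*-cancelʳ-< n 0<n (subst₂ _<_ (sym (qtCn w₂)) (ℚ.*-comm n a) w₂<na)))
             (subst (s w₁ <_) (sym (nq w₂)) (s-mono w₁<w₂)))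
           (subst (v <_) (sym (ts w₁)) (*-cancelʳ-< C 0<C (subst (v * C <_) (sym (*-recip-cancel w₁ C 0<C)) vC<w₁)))

    product-U : (∀ {p} → a < p * (t * C) → U x p) → ∀ {v} → n * a < v * C → U (t · n · x) v
    product-U Ux {v} na<vC =
      let w₂ , na<w₂ , w₂<vC = ℚ.<-dense na<vC
          w₁ , na<w₁ , w₁<w₂ = ℚ.<-dense na<w₂
      in U-· (n · x) 0<t
           (U-· x 0<n (Ux {q w₁} (*-cancelʳ-< n 0<n (subst₂ _<_ (ℚ.*-comm n a) (sym (qtCn w₁)) na<w₁)))
             (subst (_< s w₂) (sym (nq w₁)) (s-mono w₁<w₂)))
           (subst (_< v) (sym (ts w₂)) (*-cancelʳ-< C 0<C (subst (_< v * C) (sym (*-recip-cancel w₂ C 0<C)) w₂<vC)))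

  module _ {A e l n q : ℚ} (x : ℝ) {{x>0 : IsPositive x}}
           (0<A : 0ℚ < A) (0<e : 0ℚ < e) (0<l : 0ℚ < l) (0<n : 0ℚ < n) (0<q : 0ℚ < q) where
    private
      ρ = A * recip e 0<e
      0<ρ : 0ℚ < ρ
      0<ρ = 0<* 0<A (0<recip 0<e)
      ρe : ρ * e ≡ A
      ρe = *-recip-cancel A e 0<e

    -- The test point is √x ≈ (A / e) (n / n₁).
    scaled-U : ∀ {n₁} → n < n₁ → (∀ {v} → v * (n₁ * (e * e)) < n * (A * A) → L x v) →
      q * (e * n₁) < l * n → U (A · ((√ x) ⁻¹)) (l * recip q 0<q)
    scaled-U {n₁} n<n₁ Lx qen₁<ln = U-scaled-√⁻¹ x 0<A 0<p
      (Lx (subst₂ _<_ (sym p²) (cong (_* (A * A)) (ℚ.*-identityʳ n))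
        (*-monoʳ-<-pos (0<* 0<A 0<A) (*-mono-<-pos 0<n κ<1))))
      (cross-< {A} {l} 0<p 0<q (*-cancelʳ-< (e * n₁) (0<* 0<e 0<n₁) (subst₂ _<_
        (solve 4 (λ A q e m → A :* (q :* (e :* m)) := A :* q :* (e :* m)) refl A q e n₁)
        (sym lp) (*-mono-<-pos 0<A qen₁<ln))))
      where
      0<n₁ : 0ℚ < n₁
      0<n₁ = ℚ.<-trans 0<n n<n₁
      -- The hypothesis on x suggests √κ, but κ² < κ < 1 allows the rational κ itself in the test
      -- point.
      κ = n * recip n₁ 0<n₁
      0<κ : 0ℚ < κ
      0<κ = 0<* 0<n (0<recip 0<n₁)
      κn₁ : κ * n₁ ≡ n
      κn₁ = *-recip-cancel n n₁ 0<n₁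
      κ<1 : κ < 1ℚ
      κ<1 = *-cancelʳ-< n₁ 0<n₁ (subst₂ _<_ (sym κn₁) (sym (ℚ.*-identityˡ n₁)) n<n₁)
      0<p : 0ℚ < ρ * κ
      0<p = 0<* 0<ρ 0<κ
      p² : ρ * κ * (ρ * κ) * (n₁ * (e * e)) ≡ n * κ * (A * A)
      p² = trans (solve 4 (λ ρ κ m e → ρ :* κ :* (ρ :* κ) :* (m :* (e :* e)) := κ :* m :* κ :* ((ρ :* e) :* (ρ :* e))) refl ρ κ n₁ e)
        (cong₂ (λ y z → y * κ * (z * z)) κn₁ ρe)
      lp : l * (ρ * κ) * (e * n₁) ≡ A * (l * n)
      lp = trans (solve 5 (λ l ρ κ e m → l :* (ρ :* κ) :* (e :* m) := (ρ :* e) :* (l :* (κ :* m))) refl l ρ κ e n₁)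
        (cong₂ (λ y z → y * (l * z)) ρe κn₁)

    -- The test point is (A / e) λ′; the factor λ′ > 1 is the slack that lifts its square strictly
    -- above A² / e².
    scaled-L : ∀ {λ′} → 1ℚ < λ′ → (∀ {v} → n * (A * A) < v * (n * (e * e)) → U x v) →
      l * λ′ < q * e → L (A · ((√ x) ⁻¹)) (l * recip q 0<q)
    scaled-L {λ′} 1<λ Ux lλ<qe = L-scaled-√⁻¹ x 0<A 0<p (0<* 0<l (0<recip 0<q))
      (Ux (subst₂ _<_ (ℚ.*-identityʳ (n * (A * A))) (sym p²) (*-mono-<-pos (0<* 0<n (0<* 0<A 0<A)) 1<λ²)))
      (cross-< {l} {A} 0<q 0<p (*-cancelʳ-< e 0<e (subst₂ _<_ (sym lp)
        (solve 3 (λ A q e → A :* (q :* e) := A :* q :* e) refl A q e) (*-mono-<-pos 0<A lλ<qe))))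
      where
      0<λ : 0ℚ < λ′
      0<λ = ℚ.<-trans 0<1 1<λ
      0<p : 0ℚ < ρ * λ′
      0<p = 0<* 0<ρ 0<λ
      1<λ² : 1ℚ < λ′ * λ′
      1<λ² = ℚ.<-trans 1<λ (subst (_< λ′ * λ′) (ℚ.*-identityʳ λ′) (*-mono-<-pos 0<λ 1<λ))
      p² : ρ * λ′ * (ρ * λ′) * (n * (e * e)) ≡ n * (A * A) * (λ′ * λ′)
      p² = trans (solve 4 (λ ρ l n e → ρ :* l :* (ρ :* l) :* (n :* (e :* e)) := n :* ((ρ :* e) :* (ρ :* e)) :* (l :* l)) refl ρ λ′ n e)
        (cong (λ y → n * (y * y) * (λ′ * λ′)) ρe)
      lp : l * (ρ * λ′) * e ≡ A * (l * λ′)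
      lp = trans (solve 4 (λ l ρ k e → l :* (ρ :* k) :* e := (ρ :* e) :* (l :* k)) refl l ρ λ′ e) (cong (_* (l * λ′)) ρe)

-- The two asymptotic equivalences.

module Asymptotics where
  open import Data.Rational.Base using (_+_; _*_; _-_; -_; _/_; _≤_; _<_; _⊓_)
  open ℝ
  open Reals
  open Pi
  open Comparison
  open Embedding
  open Fractions
  open +-*-Solver using (solve; _:=_; _:+_; _:*_; _:-_; con)

  0<ι′ : ∀ {n} → 0 ℕ.< n → 0ℚ < ι n
  0<ι′ = ι-mono-<

  comparison : ℕ → Sequence
  comparison A n = ι A · (√ (ι 3 · ι n · π)) ⁻¹

  -- The loss of 4E is less than ε (n + 1) E by the choice of n.
  deficit : ∀ {n E l ε} → 0 ℕ.< E → suc n ℕ.* E ℕ.≤ n ℕ.* l ℕ.+ 4 ℕ.* E → ι 4 < ε * ι (suc n) →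
    (1ℚ - ε) * (ι E * ι (suc n)) < ι l * ι n
  deficit {n} {E} {l} {ε} 0<E mE≤nl+4E 4<εm = begin-strict
    (1ℚ - ε) * (ι E * ι (suc n))
      ≡⟨ solve 3 (λ ε E m → (con 1ℚ :- ε) :* (E :* m) := m :* E :- ε :* m :* E) refl ε (ι E) (ι (suc n)) ⟩
    ι (suc n) * ι E - ε * ι (suc n) * ι E
      <⟨ ℚ.+-monoʳ-< (ι (suc n) * ι E) (ℚ.neg-antimono-< (*-monoʳ-<-pos (0<ι′ 0<E) 4<εm)) ⟩
    ι (suc n) * ι E - ι 4 * ι E
      ≤⟨ ℚ.+-monoˡ-≤ (- (ι 4 * ι E)) (subst₂ _≤_ (ι-* (suc n) E)
           (trans (ι-+ (n ℕ.* l) (4 ℕ.* E)) (cong₂ _+_ (ι-* n l) (ι-* 4 E))) (ι-mono-≤ mE≤nl+4E)) ⟩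
    ι n * ι l + ι 4 * ι E - ι 4 * ι E
      ≡⟨ solve 3 (λ n l y → n :* l :+ y :- y := l :* n) refl (ι n) (ι l) (ι 4 * ι E) ⟩
    ι l * ι n ∎
    where open ℚ.≤-Reasoning

  module _ {ε : ℚ} (0<ε : 0ℚ < ε) (ε<1 : ε < 1ℚ) where

    0<1-ε : 0ℚ < 1ℚ - ε
    0<1-ε = subst (_< 1ℚ - ε) (ℚ.+-inverseʳ ε) (ℚ.+-monoˡ-< (- ε) ε<1)

    1<1+½ε : 1ℚ < 1ℚ + ½ * ε
    1<1+½ε = subst (_< 1ℚ + ½ * ε) (ℚ.+-identityʳ 1ℚ) (ℚ.+-monoʳ-< 1ℚ (0<* (ℚ.positive⁻¹ ½) 0<ε))

    1+½ε<1+ε : 1ℚ + ½ * ε < 1ℚ + ε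
    1+½ε<1+ε = ℚ.+-monoʳ-< 1ℚ (subst (½ * ε <_) (ℚ.*-identityˡ ε) (*-monoʳ-<-pos 0<ε (½<1)))
      where
      ½<1 : ½ < 1ℚ
      ½<1 = ℚ.*<* (ℤ.+<+ (s≤s (s≤s z≤n)))

    0<1+ε : 0ℚ < 1ℚ + ε
    0<1+ε = ℚ.<-trans 0<1 (ℚ.<-trans 1<1+½ε 1+½ε<1+ε)

    module _ {n E l : ℕ} .{{_ : ℕ.NonZero n}} (0<E : 0 ℕ.< E) (0<l : 0 ℕ.< l) (l≤E : l ℕ.≤ E)
             (mE≤nl+4E : suc n ℕ.* E ℕ.≤ n ℕ.* l ℕ.+ 4 ℕ.* E) (4<εm : ι 4 < ε * ι (suc n)) where

      -- In the application P = 9^n and A = 2 · 3^n. Then π lies between 4P / (3 (n + 1) E²) and 4P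
      -- / (3 n E²), and A² = 4P puts √(3nπ) near A / E.
      module _ {P A : ℕ} (0<A : 0 ℕ.< A) (A²≡4P : A ℕ.* A ≡ 4 ℕ.* P)
        (above : ∀ k → P ℕ.* (suc k ℕ.* suc k) ℕ.≤ 3 ℕ.* (suc n ℕ.* (E ℕ.* E)) ℕ.* outer (suc k))
        (below : ∀ k → 3 ℕ.* (n ℕ.* (E ℕ.* E)) ℕ.* inner (suc k) ℕ.≤ P ℕ.* (suc k ℕ.* suc k)) where
        private
          ι-3nE² : ∀ m → ι (3 ℕ.* (m ℕ.* (E ℕ.* E))) ≡ ι 3 * (ι m * (ι E * ι E))
          ι-3nE² m = trans (ι-* 3 (m ℕ.* (E ℕ.* E))) (cong (ι 3 *_) (trans (ι-* m (E ℕ.* E)) (cong (ι m *_) (ι-* E E))))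

          ι-A² : ι (4 ℕ.* P) ≡ ι A * ι A
          ι-A² = trans (cong ι (sym A²≡4P)) (ι-* A A)

          0<mE² : ∀ m → 0ℚ < ι m → 0ℚ < ι m * (ι E * ι E)
          0<mE² m 0<m = 0<* 0<m (0<* (0<ι′ 0<E) (0<ι′ 0<E))

          0<3mE² : ∀ m → 0ℚ < ι m → 0ℚ < ι 3 * (ι m * (ι E * ι E))
          0<3mE² m 0<m = 0<* (0<ι 3) (0<mE² m 0<m)

          πL : ∀ {p} → p * (ι 3 * (ι (suc n) * (ι E * ι E))) < ι A * ι A → L π p
          πL = π-L {ι A * ι A} {ι 3 * (ι (suc n) * (ι E * ι E))} (0<3mE² (suc n) (0<ι (suc n))) λ k →
            subst₂ _≤_ ι-A² (cong (upperArea k *_) (ι-3nE² (suc n))) (upperArea-bound P (suc n ℕ.* (E ℕ.* E)) k (above k))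

          πU : ∀ {p} → ι A * ι A < p * (ι 3 * (ι n * (ι E * ι E))) → U π p
          πU = π-U {ι A * ι A} {ι 3 * (ι n * (ι E * ι E))} (0<3mE² n (0<ι n)) λ k →
            subst₂ _≤_ (cong (lowerArea k *_) (ι-3nE² n)) ι-A² (lowerArea-bound P (n ℕ.* (E ℕ.* E)) k (below k))

          x-L : ∀ v → v * (ι (suc n) * (ι E * ι E)) < ι n * (ι A * ι A) → L (ι 3 · ι n · π) v
          x-L v = product-L {ι 3} {ι n} {ι (suc n) * (ι E * ι E)} {ι A * ι A} π (0<ι 3) (0<ι n) (0<mE² (suc n) (0<ι (suc n)))
            (λ {p} → πL {p}) {v}

          x-U : ∀ v → ι n * (ι A * ι A) < v * (ι n * (ι E * ι E)) → U (ι 3 · ι n · π) v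
          x-U v = product-U {ι 3} {ι n} {ι n * (ι E * ι E)} {ι A * ι A} π (0<ι 3) (0<ι n) (0<mE² n (0<ι n))
            (λ {p} → πU {p}) {v}

        edges-U : U (comparison A n) (ι l * recip (1ℚ - ε) 0<1-ε)
        edges-U = scaled-U {ι A} {ι E} {ι l} {ι n} {1ℚ - ε} (ι 3 · ι n · π) (0<ι′ 0<A) (0<ι′ 0<E) (0<ι′ 0<l) (0<ι n) 0<1-ε {ι (suc n)}
          (ι-mono-< (ℕ.n<1+n n)) (λ {v} → x-L v) (deficit {n} {E} {l} {ε} 0<E mE≤nl+4E 4<εm)

        -- Half of ε pays for the factor λ′ > 1 of `scaled-L`; the other half keeps the inequality
        -- strict.
        lλ<qE : ι l * (1ℚ + ½ * ε) < (1ℚ + ε) * ι E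
        lλ<qE = ℚ.≤-<-trans (ℚ.*-monoʳ-≤-nonNeg (1ℚ + ½ * ε) {{ℚ.nonNegative (ℚ.<⇒≤ (ℚ.<-trans 0<1 1<1+½ε))}} (ι-mono-≤ l≤E))
          (subst (_< (1ℚ + ε) * ι E) (ℚ.*-comm (1ℚ + ½ * ε) (ι E)) (*-monoʳ-<-pos (0<ι′ 0<E) 1+½ε<1+ε))

        edges-L : L (comparison A n) (ι l * recip (1ℚ + ε) 0<1+ε)
        edges-L = scaled-L {ι A} {ι E} {ι l} {ι n} {1ℚ + ε} (ι 3 · ι n · π) (0<ι′ 0<A) (0<ι′ 0<E) (0<ι′ 0<l) (0<ι n) 0<1+ε {1ℚ + ½ * ε}
          1<1+½ε (λ {v} → x-U v) lλ<qE

      module _ {N : ℕ} .{{_ : ℕ.NonZero N}} (4nN≤9E : 4 ℕ.* n ℕ.* N ℕ.≤ 9 ℕ.* E) (9E≤4[3+n]N : 9 ℕ.* E ℕ.≤ 4 ℕ.* (3 ℕ.+ n) ℕ.* N) where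
        open ℚ.≤-Reasoning
        private
          a c : ℚ
          a = ℤ.+ l / N
          c = ℤ.+ 4 / 9 * ι n
          0<9N : 0ℚ < ι 9 * ι N
          0<9N = 0<* (0<ι 9) (0<ι N)
          0<a : 0ℚ < a
          0<a = *-cancelʳ-< (ι N) (0<ι N) (subst₂ _<_ (sym (ℚ.*-zeroˡ (ι N))) (sym (/-ι l N)) (0<ι′ 0<l))
          c-eq : ∀ q → c * q * (ι 9 * ι N) ≡ q * ι (4 ℕ.* n ℕ.* N)
          c-eq q = trans (solve 5 (λ f n q i N → f :* n :* q :* (i :* N) := q :* ((f :* i) :* n :* N)) refl (ℤ.+ 4 / 9) (ι n) q (ι 9) (ι N))
            (cong (q *_) (trans (cong (λ z → z * ι n * ι N) (/-ι 4 9)) (sym (trans (ι-* (4 ℕ.* n) N) (cong (_* ι N) (ι-* 4 n))))))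
          a-eq : a * (ι 9 * ι N) ≡ ι 9 * ι l
          a-eq = trans (solve 3 (λ a i N → a :* (i :* N) := i :* (a :* N)) refl a (ι 9) (ι N)) (cong (ι 9 *_) (/-ι l N))
          cancel : ∀ {q} → q * ι (4 ℕ.* n ℕ.* N) < ι 9 * ι l → c * q < a
          cancel {q} h = *-cancelʳ-< (ι 9 * ι N) 0<9N (subst₂ _<_ (sym (c-eq q)) (sym a-eq) h)
          cancel′ : ∀ {q} → ι 9 * ι l < q * ι (4 ℕ.* n ℕ.* N) → a < c * q
          cancel′ {q} h = *-cancelʳ-< (ι 9 * ι N) 0<9N (subst₂ _<_ (sym a-eq) (sym (c-eq q)) h)
          lower : ∀ q → 0ℚ < q → q * (ι E * ι (suc n)) < ι l * ι n → q * ι (4 ℕ.* n ℕ.* N) < ι 9 * ι l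
          lower q 0<q qEm<ln = begin-strict
            q * ι (4 ℕ.* n ℕ.* N)   ≤⟨ ℚ.*-monoˡ-≤-nonNeg q {{ℚ.nonNegative (ℚ.<⇒≤ 0<q)}} (ι-mono-≤ 4nN≤9E) ⟩
            q * ι (9 ℕ.* E)         ≡⟨ trans (cong (q *_) (ι-* 9 E)) (solve 3 (λ q i E → q :* (i :* E) := i :* (q :* E)) refl q (ι 9) (ι E)) ⟩
            ι 9 * (q * ι E)         <⟨ *-mono-<-pos (0<ι 9) (*-cancelʳ-< (ι n) {q * ι E} {ι l} (0<ι n) (ℚ.<-trans
                                         (subst (q * ι E * ι n <_) (ℚ.*-assoc q (ι E) (ι (suc n))) (*-mono-<-pos (0<* 0<q (0<ι′ 0<E)) (ι-mono-< (ℕ.n<1+n n)))) qEm<ln)) ⟩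
            ι 9 * ι l               ∎
          -- The surplus of 4 (3 + n) N over 4nN is 3 · 4N, to be absorbed by ε n · 4N.
          3<εn : ι 3 < ε * ι n
          3<εn = subst₂ _<_ refl (solve 2 (λ ε n → ε :* (con 1ℚ :+ n) :- ε := ε :* n) refl ε (ι n)) (begin-strict
            ι 4 - 1ℚ                  <⟨ ℚ.+-mono-< 4<εm (ℚ.neg-antimono-< ε<1) ⟩
            ε * ι (suc n) - ε         ≡⟨ cong (λ z → ε * z - ε) (ι-+ 1 n) ⟩
            ε * (1ℚ + ι n) - ε        ∎)
          upper : ι 9 * ι l < (1ℚ + ε) * ι (4 ℕ.* n ℕ.* N)
          upper = begin-strict
            ι 9 * ι l                           ≡⟨ ι-* 9 l ⟨
            ι (9 ℕ.* l)                         ≤⟨ ι-mono-≤ (ℕ.≤-trans (ℕ.*-monoʳ-≤ 9 l≤E) 9E≤4[3+n]N) ⟩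
            ι (4 ℕ.* (3 ℕ.+ n) ℕ.* N)           ≡⟨ trans (cong ι (lemma n N)) (trans (ι-+ (4 ℕ.* n ℕ.* N) (3 ℕ.* (4 ℕ.* N)))
                                                      (cong (ι (4 ℕ.* n ℕ.* N) +_) (ι-* 3 (4 ℕ.* N)))) ⟩
            ι (4 ℕ.* n ℕ.* N) + ι 3 * ι (4 ℕ.* N)
              <⟨ ℚ.+-monoʳ-< (ι (4 ℕ.* n ℕ.* N)) (*-monoʳ-<-pos (subst (0ℚ <_) (sym (ι-* 4 N)) (0<* (0<ι 4) (0<ι N))) 3<εn) ⟩
            ι (4 ℕ.* n ℕ.* N) + ε * ι n * ι (4 ℕ.* N)
              ≡⟨ cong₂ (λ y z → y + ε * ι n * z) (4nN) (ι-* 4 N) ⟩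
            ι 4 * ι n * ι N + ε * ι n * (ι 4 * ι N)
              ≡⟨ solve 4 (λ i n N ε → i :* n :* N :+ ε :* n :* (i :* N) := (con 1ℚ :+ ε) :* (i :* n :* N)) refl (ι 4) (ι n) (ι N) ε ⟩
            (1ℚ + ε) * (ι 4 * ι n * ι N)        ≡⟨ cong ((1ℚ + ε) *_) 4nN ⟨
            (1ℚ + ε) * ι (4 ℕ.* n ℕ.* N)        ∎
            where
            4nN : ι (4 ℕ.* n ℕ.* N) ≡ ι 4 * ι n * ι N
            4nN = trans (ι-* (4 ℕ.* n) N) (cong (_* ι N) (ι-* 4 n))
            lemma : ∀ n N → 4 ℕ.* (3 ℕ.+ n) ℕ.* N ≡ 4 ℕ.* n ℕ.* N ℕ.+ 3 ℕ.* (4 ℕ.* N)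
            lemma = solve-∀

        0<index : 0ℚ < ℤ.+ l / N
        0<index = 0<a

        index-U : ℤ.+ 4 / 9 * ι n < ℤ.+ l / N * recip (1ℚ - ε) 0<1-ε
        index-U = scaled-< 0<1-ε {c} {a} (cancel {1ℚ - ε} (lower (1ℚ - ε) 0<1-ε (deficit {n} {E} {l} {ε} 0<E mE≤nl+4E 4<εm)))

        index-L : ℤ.+ l / N * recip (1ℚ + ε) 0<1+ε < ℤ.+ 4 / 9 * ι n
        index-L = <-scaled 0<1+ε {c} {a} (cancel′ {1ℚ + ε} upper)

  0<2*3^ : ∀ n → 0 ℕ.< 2 ℕ.* 3 ^ n
  0<2*3^ n = ℕ.>-nonZero⁻¹ (2 ℕ.* 3 ^ n) {{ℕ.m*n≢0 2 (3 ^ n) {{_}} {{ℕ.m^n≢0 3 n}}}}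

  [2*3^n]² : ∀ n → 2 ℕ.* 3 ^ n ℕ.* (2 ℕ.* 3 ^ n) ≡ 4 ℕ.* 9 ^ n
  [2*3^n]² zero    = refl
  [2*3^n]² (suc n) = trans (lemma (3 ^ n)) (trans (cong (9 ℕ.*_) ([2*3^n]² n)) (lemma′ (9 ^ n)))
    where
    lemma : ∀ p → 2 ℕ.* (3 ℕ.* p) ℕ.* (2 ℕ.* (3 ℕ.* p)) ≡ 9 ℕ.* (2 ℕ.* p ℕ.* (2 ℕ.* p))
    lemma = solve-∀
    lemma′ : ∀ p → 9 ℕ.* (4 ℕ.* p) ≡ 4 ℕ.* (9 ℕ.* p)
    lemma′ = solve-∀

  -- It suffices to treat ε < 1 and n with 4 < ε (n + 1).
  ∼-intro : ∀ a b → (∀ {ε} (0<ε : 0ℚ < ε) (ε<1 : ε < 1ℚ) j → 0 ℕ.< j → ι 4 < ε * ι (4 ℕ.+ j) →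
      0ℚ < a (3 ℕ.+ j)
      × U (b (3 ℕ.+ j)) (a (3 ℕ.+ j) * recip (1ℚ - ε) (0<1-ε 0<ε ε<1))
      × L (b (3 ℕ.+ j)) (a (3 ℕ.+ j) * recip (1ℚ + ε) (0<1+ε 0<ε ε<1))) → a ∼ b
  ∼-intro a b h ε 0<ε = 4 ℕ.+ k , main
    where
    δ = ε ⊓ ½
    0<δ : 0ℚ < δ
    0<δ = ⊓-glb-< 0<ε (ℚ.positive⁻¹ ½)
    δ≤ε : δ ≤ ε
    δ≤ε = ℚ.p⊓q≤p ε ½
    δ<1 : δ < 1ℚ
    δ<1 = ℚ.≤-<-trans (ℚ.p⊓q≤q ε ½) (ℚ.*<* (ℤ.+<+ (s≤s (s≤s z≤n))))
    k : ℕ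
    k = proj₁ (archimedean 4 0<δ)
    4<δ[k+1] : ι 4 < δ * ι (suc k)
    4<δ[k+1] = subst (_< δ * ι (suc k)) (/-ι 4 (suc k)) (*-monoʳ-<-pos (0<ι (suc k)) (proj₂ (archimedean 4 0<δ)))
    main : ∀ n .{{_ : ℕ.NonZero n}} → 4 ℕ.+ k ℕ.≤ n →
      Σ (IsPositive (b n)) λ b>0 → let a/b = a n · (b n ⁻¹) {{b>0}} in L a/b (1ℚ - ε) × U a/b (1ℚ + ε)
    -- The threshold `4 + k` rather than `3 + k` also makes j positive, on which positivity of the
    -- edge number will rest.
    main (suc (suc (suc j))) (s≤s (s≤s (s≤s k<j))) =
      let n = 3 ℕ.+ j
          0<a , Ub , Lb = h 0<δ δ<1 j (ℕ.≤-trans (s≤s z≤n) k<j)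
            (ℚ.<-≤-trans 4<δ[k+1] (ℚ.*-monoˡ-≤-nonNeg δ {{ℚ.nonNegative (ℚ.<⇒≤ 0<δ)}} (ι-mono-≤ (ℕ.m≤n⇒m≤o+n 4 k<j))))
          -- The lower bound a / (1 + δ) < b, with a > 0, already makes b positive.
          b>0 = isPositive (L-lower (b n) (0<* 0<a (0<recip (0<1+ε 0<δ δ<1))) Lb)
      in b>0 ,
         L-lower-≤ (a n · (b n ⁻¹) {{b>0}}) (ℚ.+-monoʳ-≤ 1ℚ (ℚ.neg-antimono-≤ δ≤ε)) (ratio-L (b n) {{b>0}} {a n} {1ℚ - δ} 0<a (0<1-ε 0<δ δ<1) Ub) ,
         U-upper-≤ (a n · (b n ⁻¹) {{b>0}}) (ℚ.+-monoʳ-≤ 1ℚ δ≤ε) (ratio-U (b n) {{b>0}} {a n} {1ℚ + δ} 0<a (0<1+ε 0<δ δ<1) Lb)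

  open Covers using (N)
  open Trinomials using (e)
  open Growth using (sq)
  open Disc using (inner-limit; outer-limit)
  open Estimates using (ℓ≤e; ne≤nℓ+3e; 4nN≤9e; 9e≤4[n+3]N; 0<e)

  [n+1]e≤nℓ+4e : ∀ j → let n = 3 ℕ.+ j in suc n ℕ.* e n ℕ.≤ n ℕ.* ℓ (𝓜 n) ℕ.+ 4 ℕ.* e n
  [n+1]e≤nℓ+4e j = ℕ.≤-trans (ℕ.+-monoʳ-≤ (e n) (ne≤nℓ+3e j)) (ℕ.≤-reflexive (lemma (e n) (n ℕ.* ℓ (𝓜 n))))
    where
    n = 3 ℕ.+ j
    lemma : ∀ E x → E ℕ.+ (x ℕ.+ 3 ℕ.* E) ≡ x ℕ.+ 4 ℕ.* E
    lemma = solve-∀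

  -- For n > 3, n e(n) exceeds 3 e(n), so `ne≤nℓ+3e` leaves a positive remainder for n ℓ.
  0<ℓ : ∀ j → 0 ℕ.< j → 0 ℕ.< ℓ (𝓜 (3 ℕ.+ j))
  0<ℓ j 0<j = ℕ.*-cancelˡ-< n 0 (ℓ (𝓜 n)) (subst (ℕ._< n ℕ.* ℓ (𝓜 n)) (sym (ℕ.*-zeroʳ n))
    (ℕ.+-cancelʳ-< (3 ℕ.* e n) 0 (n ℕ.* ℓ (𝓜 n)) (ℕ.<-≤-trans
      (ℕ.*-monoˡ-< (e n) {{ℕ.>-nonZero (0<e j)}} (ℕ.m<m+n 3 0<j)) (ne≤nℓ+3e j))))
    where n = 3 ℕ.+ j

  leading : Sequence
  leading n = comparison (2 ℕ.* 3 ^ n) n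

  module _ {ε : ℚ} (0<ε : 0ℚ < ε) (ε<1 : ε < 1ℚ) (j : ℕ) (0<j : 0 ℕ.< j) (4<ε[n+1] : ι 4 < ε * ι (4 ℕ.+ j)) where
    private
      n A : ℕ
      n = 3 ℕ.+ j
      A = 2 ℕ.* 3 ^ n

      above : ∀ k → 9 ^ n ℕ.* sq (suc k) ℕ.≤ 3 ℕ.* (suc n ℕ.* sq (e n)) ℕ.* outer (suc k)
      above k = outer-limit j (suc k)

      below : ∀ k → 3 ℕ.* (n ℕ.* sq (e n)) ℕ.* inner (suc k) ℕ.≤ 9 ^ n ℕ.* sq (suc k)
      below k = inner-limit j (suc k)

    edges-at-U : U (leading n) (ι (ℓ (𝓜 n)) * recip (1ℚ - ε) (0<1-ε 0<ε ε<1))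
    edges-at-U = edges-U {ε} 0<ε ε<1 {n} {e n} {ℓ (𝓜 n)} (0<e j) (0<ℓ j 0<j) (ℓ≤e j) ([n+1]e≤nℓ+4e j) 4<ε[n+1]
      {9 ^ n} {A} (0<2*3^ n) ([2*3^n]² n) above below

    edges-at-L : L (leading n) (ι (ℓ (𝓜 n)) * recip (1ℚ + ε) (0<1+ε 0<ε ε<1))
    edges-at-L = edges-L {ε} 0<ε ε<1 {n} {e n} {ℓ (𝓜 n)} (0<e j) (0<ℓ j 0<j) (ℓ≤e j) ([n+1]e≤nℓ+4e j) 4<ε[n+1]
      {9 ^ n} {A} (0<2*3^ n) ([2*3^n]² n) above below

  edges-∼ : (λ n → ι (ℓ (𝓜 n))) ∼ leading
  edges-∼ = ∼-intro (λ n → ι (ℓ (𝓜 n))) leading λ {ε} 0<ε ε<1 j 0<j 4<ε[n+1] →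
    0<ι′ (0<ℓ j 0<j) , edges-at-U {ε} 0<ε ε<1 j 0<j 4<ε[n+1] , edges-at-L {ε} 0<ε ε<1 j 0<j 4<ε[n+1]

  index-∼ : (λ n → i (𝓜 n) {{∣𝓜∣-nonZero n}}) ∼ (λ n → fromℚ (ℤ.+ 4 / 9 * ι n))
  index-∼ = ∼-intro (λ n → i (𝓜 n) {{∣𝓜∣-nonZero n}}) (λ n → fromℚ (ℤ.+ 4 / 9 * ι n)) λ {ε} 0<ε ε<1 j 0<j 4<ε[n+1] →
    0<index {ε} 0<ε ε<1 {3 ℕ.+ j} {e (3 ℕ.+ j)} {ℓ (𝓜 (3 ℕ.+ j))} (0<e j) (0<ℓ j 0<j) (ℓ≤e j) ([n+1]e≤nℓ+4e j) 4<ε[n+1]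
      {N 0 (3 ℕ.+ j)} {{∣𝓜∣-nonZero (3 ℕ.+ j)}} (4nN≤9e j) (9e≤4[n+3]N j) ,
    index-U {ε} 0<ε ε<1 {3 ℕ.+ j} {e (3 ℕ.+ j)} {ℓ (𝓜 (3 ℕ.+ j))} (0<e j) (0<ℓ j 0<j) (ℓ≤e j) ([n+1]e≤nℓ+4e j) 4<ε[n+1]
      {N 0 (3 ℕ.+ j)} {{∣𝓜∣-nonZero (3 ℕ.+ j)}} (4nN≤9e j) (9e≤4[n+3]N j) ,
    index-L {ε} 0<ε ε<1 {3 ℕ.+ j} {e (3 ℕ.+ j)} {ℓ (𝓜 (3 ℕ.+ j))} (0<e j) (0<ℓ j 0<j) (ℓ≤e j) ([n+1]e≤nℓ+4e j) 4<ε[n+1]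
      {N 0 (3 ℕ.+ j)} {{∣𝓜∣-nonZero (3 ℕ.+ j)}} (4nN≤9e j) (9e≤4[n+3]N j)

open import Data.Integer.Base using (+_)
open import Data.Nat.Base using (_∸_)
open import Data.Nat.Combinatorics using (_C_)
open import Data.Rational.Base using (_+_; _-_; _*_; _/_)

-- The closed form has its denominator multiplied out, as x² is not invertible among power series.
mainTheorem8 : (ι 2 ·ˢ X ^ˢ 2 *ˢ √ˢ 1-2X-3X² *ˢ (λ n → ι (ℓ (𝓜 n)))
    ≗ (1ˢ +ˢ X) *ˢ (1ˢ -ˢ ι 2 ·ˢ X -ˢ X ^ˢ 2 -ˢ (1ˢ -ˢ X) *ˢ √ˢ 1-2X-3X²))
    × (∀ n → 1 ℕ.≤ n → ι (ℓ (𝓜 n)) ≡ T n - M n + T (n ∸ 1) - M (n ∸ 1))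
    × (∀ n → 3 ℕ.≤ n → ι (ℓ (𝓜 n)) ≡ (1+X+X² ^ˢ n) (n ∸ 2) + (1+X+X² ^ˢ (n ∸ 1)) (n ∸ 3))
    × (∀ n .{{_ : ℕ.NonZero n}} → ι (ℓ (𝓜 n)) ≡
    + 2 / n * ∑[ k ≤ ⌊ n /2⌋ ]
    (ι (n C toℕ k) * ι ((n ∸ toℕ k) C toℕ k) * (+ (toℕ k ℕ.* (n ∸ toℕ k)) / suc (toℕ k))))
    × ((λ n → ι (ℓ (𝓜 n))) ∼ (λ n → ι (2 ℕ.* 3 ^ n) · (√ (ι 3 · ι n · π)) ⁻¹))
    × ((λ n → i (𝓜 n) {{∣𝓜∣-nonZero n}}) ∼ (λ n → fromℚ (+ 4 / 9 * ι n)))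
mainTheorem8 =
  Series.generating-function ,
  (λ { (suc n) _ → Identities.edges-trinomial-motzkin n }) ,
  (λ { (suc (suc (suc n))) _ → Identities.edges-coefficients n ; 1 (s≤s ()) ; 2 (s≤s (s≤s ())) }) ,
  (λ { (suc n) → BinomialFormula.binomial-formula n }) ,
  Asymptotics.edges-∼ ,
  Asymptotics.index-∼
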